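{- Let $m,n\ge 1$. Every monomial in Plücker coordinates is a linear combination of Non-Crossing Monomials in $R_{m,n}$, and in a unique way. Non-Crossing Monomials form a basis for the coordinate ring $R_{m,n}$ of the Grassmannian $\mathbb{G}_{m,n}$.
   Context: $\mathbb{G}_{m,n}$ is the Grassmannian of $m$-dimensional subspaces of $\mathbb{C}^{m+n}$, represented by $m\times(m+n)$ matrices of rank $m$. For $J=\{j_1<\dots<j_m\}\subset\{1,\dots,m+n\}$, the Plücker coordinate $P_J$ is the $m\times m$ minor on columns $J$. $R_{m,n}=\mathbb{C}[P_J]/I_{m,n}$ is the (homogeneous) coordinate ring of $\mathbb{G}_{m,n}$ in the Plücker embedding, where $I_{m,n}$ is the ideal generated by the Plücker relations; equivalently, $R_{m,n}$ is the subring generated by the maximal minors of a generic $m\times(m+n)$ matrix. A monomial $M=P_{J^1}\cdots P_{J^h}$ is non-crossing (a Non-Crossing Monomial, NCM) if the multiset $\{J^1,\dots,J^h\}$ is semi-noncrossing in the following sense. Two disjoint sets $a=\{a_1<\dots<a_m\}$, $b=\{b_1<\dots<b_m\}$ of integers are non-crossing if for no $1\le k\le m-1$ does $a_k<b_k<a_{k+1}<b_{k+1}$ or $b_k<a_k<b_{k+1}<a_{k+1}$ hold. Let $\mu_v$ be the number of indices $i$ with $v\in J^i$, and let $B_1,\dots,B_{m+n}$ be the consecutive segments of $\{1,\dots,mh\}$ of lengths $\mu_1,\dots,\mu_{m+n}$. The multiset $\{J^1,\dots,J^h\}$ is semi-noncrossing if there is a set partition of $\{1,\dots,mh\}$ into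 $h$ pairwise non-crossing blocks of size $m$, each block containing at most one element of each $B_v$, such that replacing every element of $B_v$ by $v$ (for all $v$) turns the multiset of blocks into $\{J^1,\dots,J^h\}$. The empty monomial $1$ is non-crossing. -}

module Defs where

open import Level using (Level; _⊔_; 0ℓ)
open import Algebra.Bundles using (CommutativeRing)
open import Algebra.Module.Bundles using (LeftModule)
open import Algebra.Structures using (IsCommutativeRing)
open import Algebra.Morphism.Structures using (module RingMorphisms)
import Algebra.Properties.Ring as RingProperties
open import Data.Fin as Fin using (Fin; toℕ)
import Data.Fin.Properties as Fin
open import Data.List as List using (List; []; _∷_; _++_)
import Data.List.Membership.DecPropositional as DecListMembership
open import Data.List.Membership.Propositional.Properties using (∈-∃++)
open import Data.List.Relation.Unary.Any using (here)
open import Data.List.Relation.Binary.Permutation.Propositional as Perm using (_↭_)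
open import Data.List.Relation.Binary.Permutation.Propositional.Properties
  using (∈-resp-↭; drop-∷; shift; ↭-empty-inv)
open import Data.Nat as ℕ using (ℕ; zero; suc)
open import Data.Nat.ListAction using (sum)
import Data.Nat.Properties as ℕ
open import Data.Product using (∃; _×_; _,_; proj₁; proj₂)
open import Data.Rational as ℚ using (ℚ; 0ℚ; 1ℚ; ½)
import Data.Rational.Properties as ℚ
open import Data.Rational.Solver using (module +-*-Solver)
open import Data.Vec as Vec using (Vec; []; _∷_)
open import Data.Vec.Membership.Propositional using (_∈_)
import Data.Vec.Membership.DecPropositional as DecVecMembership
open import Data.Vec.Relation.Unary.AllPairs using (AllPairs; allPairs?)
import Data.Vec.Properties as Vec
open import Function using (id; _⇔_; case_of_)
open import Relation.Binary.Bundles using (DecSetoid)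
open import Relation.Binary.Definitions using (DecidableEquality; Decidable)
open import Relation.Binary.PropositionalEquality as ≡ using (_≡_; _≢_)
open import Relation.Binary.Structures using (IsEquivalence)
open import Relation.Nullary using (¬_; yes; no)
open import Relation.Nullary.Decidable using (map′)
open import Relation.Unary using (Pred)

private variable
  a c ℓ ℓ′ p x : Level

module Reals where

  -- ∣ d i ∣ tends to 0 as ρ i tends to infinity.
  Vanishing : {I : Set} → (I → ℕ) → (I → ℚ) → Set
  Vanishing ρ d =
    ∀ ε → 0ℚ ℚ.< ε → ∃ λ N → ∀ i → N ℕ.≤ ρ i → ℚ.∣ d i ∣ ℚ.< ε

  minIndex : ℕ × ℕ → ℕ
  minIndex (i , j) = i ℕ.⊓ j

  Cauchy : (ℕ → ℚ) → Set
  Cauchy s = Vanishing minIndex (λ (i , j) → s i ℚ.- s j)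

  record ℝ : Set where
    constructor real
    field
      seq    : ℕ → ℚ
      cauchy : Cauchy seq

  open ℝ public

  infix 4 _≈_
  record _≈_ (r s : ℝ) : Set where
    constructor mk≈
    field vanishing : Vanishing id (λ i → seq r i ℚ.- seq s i)

  open _≈_ public

  module _ {I : Set} {ρ : I → ℕ} where

    vanishing-resp : ∀ {d e} → (∀ i → d i ≡ e i) → Vanishing ρ d → Vanishing ρ e
    vanishing-resp d≗e v ε 0<ε = let N , small = v ε 0<ε in N , λ i N≤ρi →
      ≡.subst (λ z → ℚ.∣ z ∣ ℚ.< ε) (d≗e i) (small i N≤ρi)

    vanishing-0 : Vanishing ρ (λ _ → 0ℚ)
    vanishing-0 ε 0<ε = 0 , λ _ _ → 0<ε

    vanishing-neg : ∀ {d} → Vanishing ρ d → Vanishing ρ (λ i → ℚ.- d i)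
    vanishing-neg {d} v ε 0<ε = let N , small = v ε 0<ε in N , λ i N≤ρi →
      ≡.subst (ℚ._< ε) (≡.sym (ℚ.∣-p∣≡∣p∣ (d i))) (small i N≤ρi)

    vanishing-+ : ∀ {d e} → Vanishing ρ d → Vanishing ρ e →
                  Vanishing ρ (λ i → d i ℚ.+ e i)
    vanishing-+ {d} {e} v w ε 0<ε = N ℕ.⊔ M , λ i N⊔M≤ρi → begin-strict
      ℚ.∣ d i ℚ.+ e i ∣        ≤⟨ ℚ.∣p+q∣≤∣p∣+∣q∣ (d i) (e i) ⟩
      ℚ.∣ d i ∣ ℚ.+ ℚ.∣ e i ∣  <⟨ ℚ.+-mono-< (small-d i (ℕ.m⊔n≤o⇒m≤o N M N⊔M≤ρi))
                                             (small-e i (ℕ.m⊔n≤o⇒n≤o N M N⊔M≤ρi)) ⟩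
      ½ ℚ.* ε ℚ.+ ½ ℚ.* ε      ≡⟨ ℚ.*-distribʳ-+ ε ½ ½ ⟨
      1ℚ ℚ.* ε                 ≡⟨ ℚ.*-identityˡ ε ⟩
      ε                        ∎
      where
      open ℚ.≤-Reasoning
      0<½ε : 0ℚ ℚ.< ½ ℚ.* ε
      0<½ε = ≡.subst (ℚ._< ½ ℚ.* ε) (ℚ.*-zeroʳ ½) (ℚ.*-monoʳ-<-pos ½ 0<ε)
      N = proj₁ (v (½ ℚ.* ε) 0<½ε)
      M = proj₁ (w (½ ℚ.* ε) 0<½ε)
      small-d = proj₂ (v (½ ℚ.* ε) 0<½ε)
      small-e = proj₂ (w (½ ℚ.* ε) 0<½ε)

    EventuallyBounded : (I → ℚ) → Set
    EventuallyBounded b =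
      ∃ λ B → ℚ.Positive B × ∃ λ N → ∀ i → N ℕ.≤ ρ i → ℚ.∣ b i ∣ ℚ.≤ B

    vanishing-* : ∀ {b d} → EventuallyBounded b → Vanishing ρ d →
                  Vanishing ρ (λ i → b i ℚ.* d i)
    vanishing-* {b} {d} (B , B>0 , M , bounded) v ε 0<ε =
      M ℕ.⊔ N , λ i M⊔N≤ρi → begin-strict
        ℚ.∣ b i ℚ.* d i ∣        ≡⟨ ℚ.∣p*q∣≡∣p∣*∣q∣ (b i) (d i) ⟩
        ℚ.∣ b i ∣ ℚ.* ℚ.∣ d i ∣  ≤⟨ ℚ.*-monoʳ-≤-nonNeg ℚ.∣ d i ∣ {{ℚ.∣-∣-nonNeg (d i)}}
                                     (bounded i (ℕ.m⊔n≤o⇒m≤o M N M⊔N≤ρi)) ⟩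
        B ℚ.* ℚ.∣ d i ∣          <⟨ ℚ.*-monoʳ-<-pos B
                                     (small i (ℕ.m⊔n≤o⇒n≤o M N M⊔N≤ρi)) ⟩
        B ℚ.* (B⁻¹ ℚ.* ε)        ≡⟨ ℚ.*-assoc B B⁻¹ ε ⟨
        B ℚ.* B⁻¹ ℚ.* ε          ≡⟨ ≡.cong (ℚ._* ε) (ℚ.*-inverseʳ B) ⟩
        1ℚ ℚ.* ε                 ≡⟨ ℚ.*-identityˡ ε ⟩
        ε                        ∎
      where
      open ℚ.≤-Reasoning
      instance
        B-pos : ℚ.Positive B
        B-pos = B>0
        B-nonZero : ℚ.NonZero B
        B-nonZero = ℚ.pos⇒nonZero B
      B⁻¹ = ℚ.1/ B
      0<δ : 0ℚ ℚ.< B⁻¹ ℚ.* ε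
      0<δ = ≡.subst (ℚ._< B⁻¹ ℚ.* ε) (ℚ.*-zeroʳ B⁻¹)
              (ℚ.*-monoʳ-<-pos B⁻¹ {{ℚ.1/pos⇒pos B}} 0<ε)
      N = proj₁ (v (B⁻¹ ℚ.* ε) 0<δ)
      small = proj₂ (v (B⁻¹ ℚ.* ε) 0<δ)

  cauchy⇒bounded : ∀ r → EventuallyBounded {ρ = id} (seq r)
  cauchy⇒bounded (real s s-cauchy) =
        1ℚ ℚ.+ ℚ.∣ s N ∣
      , ℚ.pos+nonNeg⇒pos 1ℚ ℚ.∣ s N ∣ {{ℚ.∣-∣-nonNeg (s N)}}
      , N , λ i N≤i → begin
        ℚ.∣ s i ∣                          ≡⟨ ≡.cong ℚ.∣_∣ (split (s i) (s N)) ⟩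
        ℚ.∣ (s i ℚ.- s N) ℚ.+ s N ∣        ≤⟨ ℚ.∣p+q∣≤∣p∣+∣q∣ (s i ℚ.- s N) (s N) ⟩
        ℚ.∣ s i ℚ.- s N ∣ ℚ.+ ℚ.∣ s N ∣    ≤⟨ ℚ.+-monoˡ-≤ ℚ.∣ s N ∣
                                               (ℚ.<⇒≤ (close (i , N) (ℕ.⊓-glb N≤i ℕ.≤-refl))) ⟩
        1ℚ ℚ.+ ℚ.∣ s N ∣                   ∎
    where
    open ℚ.≤-Reasoning
    open +-*-Solver
    N = proj₁ (s-cauchy 1ℚ (ℚ.positive⁻¹ 1ℚ))
    close = proj₂ (s-cauchy 1ℚ (ℚ.positive⁻¹ 1ℚ))
    split : ∀ y z → y ≡ (y ℚ.- z) ℚ.+ z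
    split = solve 2 (λ y z → y := (y :- z) :+ z) ≡.refl

  bounded₁ : ∀ r → EventuallyBounded {ρ = minIndex} (λ (i , j) → seq r i)
  bounded₁ r =
    let B , B>0 , N , bound = cauchy⇒bounded r
    in B , B>0 , N , λ (i , j) N≤ → bound i (ℕ.m≤n⊓o⇒m≤n i j N≤)

  bounded₂ : ∀ r → EventuallyBounded {ρ = minIndex} (λ (i , j) → seq r j)
  bounded₂ r =
    let B , B>0 , N , bound = cauchy⇒bounded r
    in B , B>0 , N , λ (i , j) N≤ → bound j (ℕ.m≤n⊓o⇒m≤o i j N≤)

  const : ℚ → ℝ
  const q = real (λ _ → q)
    (vanishing-resp (λ _ → ≡.sym (ℚ.+-inverseʳ q)) vanishing-0)

  infixl 6 _+_
  infixl 7 _*_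
  infix  8 -_

  _+_ : ℝ → ℝ → ℝ
  r + s = real (λ i → seq r i ℚ.+ seq s i)
    (vanishing-resp (λ (i , j) → regroup (seq r i) (seq s i) (seq r j) (seq s j))
      (vanishing-+ (cauchy r) (cauchy s)))
    where
    open +-*-Solver
    regroup : ∀ r s r′ s′ → (r ℚ.- r′) ℚ.+ (s ℚ.- s′) ≡ (r ℚ.+ s) ℚ.- (r′ ℚ.+ s′)
    regroup = solve 4 (λ r s r′ s′ → (r :- r′) :+ (s :- s′) := (r :+ s) :- (r′ :+ s′)) ≡.refl

  -_ : ℝ → ℝ
  - r = real (λ i → ℚ.- seq r i)
    (vanishing-resp (λ (i , j) → ℚ.neg-distrib-+ (seq r i) (ℚ.- seq r j))
      (vanishing-neg (cauchy r)))

  product-difference : ∀ r s r′ s′ →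
    r ℚ.* (s ℚ.- s′) ℚ.+ s′ ℚ.* (r ℚ.- r′) ≡ r ℚ.* s ℚ.- r′ ℚ.* s′
  product-difference = solve 4
    (λ r s r′ s′ → r :* (s :- s′) :+ s′ :* (r :- r′) := r :* s :- r′ :* s′) ≡.refl
    where open +-*-Solver

  _*_ : ℝ → ℝ → ℝ
  r * s = real (λ i → seq r i ℚ.* seq s i)
    (vanishing-resp
      (λ (i , j) → product-difference (seq r i) (seq s i) (seq r j) (seq s j))
      (vanishing-+ (vanishing-* (bounded₁ r) (cauchy s))
                   (vanishing-* (bounded₂ s) (cauchy r))))

  pointwise : ∀ {r s} → (∀ i → seq r i ≡ seq s i) → r ≈ s
  pointwise {r} {s} r≗s = mk≈ (vanishing-resp
    (λ i → ≡.sym (≡.trans (≡.cong (ℚ._- seq s i) (r≗s i)) (ℚ.+-inverseʳ (seq s i))))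
    vanishing-0)

  isEquivalence : IsEquivalence _≈_
  isEquivalence = record
    { refl  = pointwise (λ _ → ≡.refl)
    ; sym   = λ {r} {s} (mk≈ v) →
        mk≈ (vanishing-resp (λ i → flip (seq r i) (seq s i)) (vanishing-neg v))
    ; trans = λ {r} {s} {t} (mk≈ v) (mk≈ w) →
        mk≈ (vanishing-resp (λ i → join (seq r i) (seq s i) (seq t i)) (vanishing-+ v w))
    }
    where
    open +-*-Solver
    flip : ∀ y z → ℚ.- (y ℚ.- z) ≡ z ℚ.- y
    flip = solve 2 (λ y z → :- (y :- z) := z :- y) ≡.refl
    join : ∀ y z w → (y ℚ.- z) ℚ.+ (z ℚ.- w) ≡ y ℚ.- w
    join = solve 3 (λ y z w → (y :- z) :+ (z :- w) := y :- w) ≡.refl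

  +-cong : ∀ {r r′ s s′} → r ≈ r′ → s ≈ s′ → r + s ≈ r′ + s′
  +-cong {r} {r′} {s} {s′} (mk≈ v) (mk≈ w) = mk≈ (vanishing-resp
    (λ i → regroup (seq r i) (seq s i) (seq r′ i) (seq s′ i)) (vanishing-+ v w))
    where
    open +-*-Solver
    regroup : ∀ r s r′ s′ → (r ℚ.- r′) ℚ.+ (s ℚ.- s′) ≡ (r ℚ.+ s) ℚ.- (r′ ℚ.+ s′)
    regroup = solve 4 (λ r s r′ s′ → (r :- r′) :+ (s :- s′) := (r :+ s) :- (r′ :+ s′)) ≡.refl

  -‿cong : ∀ {r s} → r ≈ s → - r ≈ - s
  -‿cong {r} {s} (mk≈ v) = mk≈ (vanishing-resp
    (λ i → ℚ.neg-distrib-+ (seq r i) (ℚ.- seq s i)) (vanishing-neg v))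

  *-cong : ∀ {r r′ s s′} → r ≈ r′ → s ≈ s′ → r * s ≈ r′ * s′
  *-cong {r} {r′} {s} {s′} (mk≈ v) (mk≈ w) = mk≈ (vanishing-resp
    (λ i → product-difference (seq r i) (seq s i) (seq r′ i) (seq s′ i))
    (vanishing-+ (vanishing-* (cauchy⇒bounded r) w) (vanishing-* (cauchy⇒bounded s′) v)))

module Complex where

  open Reals using (ℝ; seq)
  private module Real = Reals

  record Carrier : Set where
    constructor _+i_
    field
      re : ℝ
      im : ℝ

  open Carrier public

  infix 4 _≈_
  record _≈_ (z w : Carrier) : Set where
    constructor mk≈
    field
      re≈ : re z Real.≈ re w
      im≈ : im z Real.≈ im w

  infixl 6 _+_
  infixl 7 _*_
  infix  8 -_

  _+_ _*_ : Carrier → Carrier → Carrier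
  (a +i b) + (c +i d) = (a Real.+ c) +i (b Real.+ d)
  (a +i b) * (c +i d) = (a Real.* c Real.+ Real.- (b Real.* d)) +i (a Real.* d Real.+ b Real.* c)

  -_ : Carrier → Carrier
  - (a +i b) = (Real.- a) +i (Real.- b)

  0# 1# : Carrier
  0# = Real.const 0ℚ +i Real.const 0ℚ
  1# = Real.const 1ℚ +i Real.const 0ℚ

  pointwise : ∀ {z w} → (∀ i → seq (re z) i ≡ seq (re w) i) →
              (∀ i → seq (im z) i ≡ seq (im w) i) → z ≈ w
  pointwise re≗ im≗ = mk≈ (Real.pointwise re≗) (Real.pointwise im≗)

  private module Laws where
    open import Data.Rational using () renaming (_+_ to _⊕_; _*_ to _⊗_; -_ to ⊖_)
    open +-*-Solver

    assoc-re : ∀ a b c d e f →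
      (a ⊗ c ⊕ ⊖ (b ⊗ d)) ⊗ e ⊕ ⊖ ((a ⊗ d ⊕ b ⊗ c) ⊗ f) ≡
      a ⊗ (c ⊗ e ⊕ ⊖ (d ⊗ f)) ⊕ ⊖ (b ⊗ (c ⊗ f ⊕ d ⊗ e))
    assoc-re = solve 6 (λ a b c d e f →
      (a :* c :+ :- (b :* d)) :* e :+ :- ((a :* d :+ b :* c) :* f) :=
      a :* (c :* e :+ :- (d :* f)) :+ :- (b :* (c :* f :+ d :* e))) ≡.refl

    assoc-im : ∀ a b c d e f →
      (a ⊗ c ⊕ ⊖ (b ⊗ d)) ⊗ f ⊕ (a ⊗ d ⊕ b ⊗ c) ⊗ e ≡
      a ⊗ (c ⊗ f ⊕ d ⊗ e) ⊕ b ⊗ (c ⊗ e ⊕ ⊖ (d ⊗ f))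
    assoc-im = solve 6 (λ a b c d e f →
      (a :* c :+ :- (b :* d)) :* f :+ (a :* d :+ b :* c) :* e :=
      a :* (c :* f :+ d :* e) :+ b :* (c :* e :+ :- (d :* f))) ≡.refl

    idˡ-re : ∀ a b → 1ℚ ⊗ a ⊕ ⊖ (0ℚ ⊗ b) ≡ a
    idˡ-re = solve 2 (λ a b → con 1ℚ :* a :+ :- (con 0ℚ :* b) := a) ≡.refl

    idˡ-im : ∀ a b → 1ℚ ⊗ b ⊕ 0ℚ ⊗ a ≡ b
    idˡ-im = solve 2 (λ a b → con 1ℚ :* b :+ con 0ℚ :* a := b) ≡.refl

    idʳ-re : ∀ a b → a ⊗ 1ℚ ⊕ ⊖ (b ⊗ 0ℚ) ≡ a
    idʳ-re = solve 2 (λ a b → a :* con 1ℚ :+ :- (b :* con 0ℚ) := a) ≡.refl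

    idʳ-im : ∀ a b → a ⊗ 0ℚ ⊕ b ⊗ 1ℚ ≡ b
    idʳ-im = solve 2 (λ a b → a :* con 0ℚ :+ b :* con 1ℚ := b) ≡.refl

    distˡ-re : ∀ a b c d e f →
      a ⊗ (c ⊕ e) ⊕ ⊖ (b ⊗ (d ⊕ f)) ≡ (a ⊗ c ⊕ ⊖ (b ⊗ d)) ⊕ (a ⊗ e ⊕ ⊖ (b ⊗ f))
    distˡ-re = solve 6 (λ a b c d e f →
      a :* (c :+ e) :+ :- (b :* (d :+ f)) :=
      (a :* c :+ :- (b :* d)) :+ (a :* e :+ :- (b :* f))) ≡.refl

    distˡ-im : ∀ a b c d e f →
      a ⊗ (d ⊕ f) ⊕ b ⊗ (c ⊕ e) ≡ (a ⊗ d ⊕ b ⊗ c) ⊕ (a ⊗ f ⊕ b ⊗ e)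
    distˡ-im = solve 6 (λ a b c d e f →
      a :* (d :+ f) :+ b :* (c :+ e) :=
      (a :* d :+ b :* c) :+ (a :* f :+ b :* e)) ≡.refl

    distʳ-re : ∀ a b c d e f →
      (c ⊕ e) ⊗ a ⊕ ⊖ ((d ⊕ f) ⊗ b) ≡ (c ⊗ a ⊕ ⊖ (d ⊗ b)) ⊕ (e ⊗ a ⊕ ⊖ (f ⊗ b))
    distʳ-re = solve 6 (λ a b c d e f →
      (c :+ e) :* a :+ :- ((d :+ f) :* b) :=
      (c :* a :+ :- (d :* b)) :+ (e :* a :+ :- (f :* b))) ≡.refl

    distʳ-im : ∀ a b c d e f →
      (c ⊕ e) ⊗ b ⊕ (d ⊕ f) ⊗ a ≡ (c ⊗ b ⊕ d ⊗ a) ⊕ (e ⊗ b ⊕ f ⊗ a)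
    distʳ-im = solve 6 (λ a b c d e f →
      (c :+ e) :* b :+ (d :+ f) :* a :=
      (c :* b :+ d :* a) :+ (e :* b :+ f :* a)) ≡.refl

    comm-re : ∀ a b c d → a ⊗ c ⊕ ⊖ (b ⊗ d) ≡ c ⊗ a ⊕ ⊖ (d ⊗ b)
    comm-re = solve 4 (λ a b c d →
      a :* c :+ :- (b :* d) := c :* a :+ :- (d :* b)) ≡.refl

    comm-im : ∀ a b c d → a ⊗ d ⊕ b ⊗ c ≡ c ⊗ b ⊕ d ⊗ a
    comm-im = solve 4 (λ a b c d →
      a :* d :+ b :* c := c :* b :+ d :* a) ≡.refl

  open Laws
  private module E = IsEquivalence Real.isEquivalence

  isEquivalence : IsEquivalence _≈_
  isEquivalence = record
    { refl  = mk≈ E.refl E.refl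
    ; sym   = λ (mk≈ p q) → mk≈ (E.sym p) (E.sym q)
    ; trans = λ (mk≈ p q) (mk≈ p′ q′) → mk≈ (E.trans p p′) (E.trans q q′)
    }

  +-cong : ∀ {z z′ w w′} → z ≈ z′ → w ≈ w′ → z + w ≈ z′ + w′
  +-cong {z} {z′} {w} {w′} (mk≈ p q) (mk≈ p′ q′) = mk≈
    (Real.+-cong {re z} {re z′} {re w} {re w′} p p′)
    (Real.+-cong {im z} {im z′} {im w} {im w′} q q′)

  *-cong : ∀ {z z′ w w′} → z ≈ z′ → w ≈ w′ → z * w ≈ z′ * w′
  *-cong {a +i b} {a′ +i b′} {c +i d} {c′ +i d′} (mk≈ p q) (mk≈ p′ q′) = mk≈
    (Real.+-cong {a Real.* c} {a′ Real.* c′} {Real.- (b Real.* d)} {Real.- (b′ Real.* d′)}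
      (Real.*-cong {a} {a′} {c} {c′} p p′)
      (Real.-‿cong {b Real.* d} {b′ Real.* d′} (Real.*-cong {b} {b′} {d} {d′} q q′)))
    (Real.+-cong {a Real.* d} {a′ Real.* d′} {b Real.* c} {b′ Real.* c′}
      (Real.*-cong {a} {a′} {d} {d′} p q′)
      (Real.*-cong {b} {b′} {c} {c′} q p′))

  -‿cong : ∀ {z w} → z ≈ w → - z ≈ - w
  -‿cong {z} {w} (mk≈ p q) = mk≈ (Real.-‿cong {re z} {re w} p) (Real.-‿cong {im z} {im w} q)

  +-assoc : ∀ z w u → (z + w) + u ≈ z + (w + u)
  +-assoc z w u = pointwise
    (λ i → ℚ.+-assoc (seq (re z) i) (seq (re w) i) (seq (re u) i))
    (λ i → ℚ.+-assoc (seq (im z) i) (seq (im w) i) (seq (im u) i))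

  +-comm : ∀ z w → z + w ≈ w + z
  +-comm z w = pointwise
    (λ i → ℚ.+-comm (seq (re z) i) (seq (re w) i))
    (λ i → ℚ.+-comm (seq (im z) i) (seq (im w) i))

  +-identityˡ : ∀ z → 0# + z ≈ z
  +-identityˡ z = pointwise
    (λ i → ℚ.+-identityˡ (seq (re z) i)) (λ i → ℚ.+-identityˡ (seq (im z) i))

  +-identityʳ : ∀ z → z + 0# ≈ z
  +-identityʳ z = pointwise
    (λ i → ℚ.+-identityʳ (seq (re z) i)) (λ i → ℚ.+-identityʳ (seq (im z) i))

  -‿inverseˡ : ∀ z → - z + z ≈ 0#
  -‿inverseˡ z = pointwise
    (λ i → ℚ.+-inverseˡ (seq (re z) i)) (λ i → ℚ.+-inverseˡ (seq (im z) i))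

  -‿inverseʳ : ∀ z → z + - z ≈ 0#
  -‿inverseʳ z = pointwise
    (λ i → ℚ.+-inverseʳ (seq (re z) i)) (λ i → ℚ.+-inverseʳ (seq (im z) i))

  *-assoc : ∀ z w u → (z * w) * u ≈ z * (w * u)
  *-assoc z w u = pointwise
    (λ i → assoc-re (seq (re z) i) (seq (im z) i) (seq (re w) i) (seq (im w) i) (seq (re u) i) (seq (im u) i))
    (λ i → assoc-im (seq (re z) i) (seq (im z) i) (seq (re w) i) (seq (im w) i) (seq (re u) i) (seq (im u) i))

  *-comm : ∀ z w → z * w ≈ w * z
  *-comm z w = pointwise
    (λ i → comm-re (seq (re z) i) (seq (im z) i) (seq (re w) i) (seq (im w) i))
    (λ i → comm-im (seq (re z) i) (seq (im z) i) (seq (re w) i) (seq (im w) i))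

  *-identityˡ : ∀ z → 1# * z ≈ z
  *-identityˡ z = pointwise
    (λ i → idˡ-re (seq (re z) i) (seq (im z) i)) (λ i → idˡ-im (seq (re z) i) (seq (im z) i))

  *-identityʳ : ∀ z → z * 1# ≈ z
  *-identityʳ z = pointwise
    (λ i → idʳ-re (seq (re z) i) (seq (im z) i)) (λ i → idʳ-im (seq (re z) i) (seq (im z) i))

  distribˡ : ∀ z w u → z * (w + u) ≈ z * w + z * u
  distribˡ z w u = pointwise
    (λ i → distˡ-re (seq (re z) i) (seq (im z) i) (seq (re w) i) (seq (im w) i) (seq (re u) i) (seq (im u) i))
    (λ i → distˡ-im (seq (re z) i) (seq (im z) i) (seq (re w) i) (seq (im w) i) (seq (re u) i) (seq (im u) i))

  distribʳ : ∀ z w u → (w + u) * z ≈ w * z + u * z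
  distribʳ z w u = pointwise
    (λ i → distʳ-re (seq (re z) i) (seq (im z) i) (seq (re w) i) (seq (im w) i) (seq (re u) i) (seq (im u) i))
    (λ i → distʳ-im (seq (re z) i) (seq (im z) i) (seq (re w) i) (seq (im w) i) (seq (re u) i) (seq (im u) i))

  isCommutativeRing : IsCommutativeRing _≈_ _+_ _*_ -_ 0# 1#
  isCommutativeRing = record
    { isRing = record
      { +-isAbelianGroup = record
        { isGroup = record
          { isMonoid = record
            { isSemigroup = record
              { isMagma = record { isEquivalence = isEquivalence ; ∙-cong = +-cong }
              ; assoc = +-assoc }
            ; identity = +-identityˡ , +-identityʳ }
          ; inverse = -‿inverseˡ , -‿inverseʳ
          ; ⁻¹-cong = -‿cong }
        ; comm = +-comm }
      ; *-cong = *-cong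
      ; *-assoc = *-assoc
      ; *-identity = *-identityˡ , *-identityʳ
      ; distrib = distribˡ , distribʳ
      }
    ; *-comm = *-comm
    }

-- Pairs of Cauchy sequences of rationals, sequences being identified when their
-- difference tends to 0. Only the ring structure of ℂ is used below.
ℂ : CommutativeRing 0ℓ 0ℓ
ℂ = record { isCommutativeRing = Complex.isCommutativeRing }

-- K[X] as the free commutative K-algebra on X: ring expressions in
-- constants and variables, identified exactly when the laws of commutative
-- K-algebras force them to be equal.
module Polynomials (K : CommutativeRing c ℓ) (X : Set x) where

  private module K = CommutativeRing K

  infix  4 _≈_
  infixl 6 _+_
  infixl 7 _*_
  infix  8 -_

  data Poly : Set (c ⊔ x) where
    con     : K.Carrier → Poly
    var     : X → Poly
    _+_ _*_ : Poly → Poly → Poly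
    -_      : Poly → Poly

  data _≈_ : Poly → Poly → Set (c ⊔ ℓ ⊔ x) where
    refl  : ∀ {f} → f ≈ f
    sym   : ∀ {f g} → f ≈ g → g ≈ f
    trans : ∀ {f g h} → f ≈ g → g ≈ h → f ≈ h

    +-cong : ∀ {f f′ g g′} → f ≈ f′ → g ≈ g′ → f + g ≈ f′ + g′
    *-cong : ∀ {f f′ g g′} → f ≈ f′ → g ≈ g′ → f * g ≈ f′ * g′
    -‿cong : ∀ {f g} → f ≈ g → - f ≈ - g

    +-assoc     : ∀ f g h → (f + g) + h ≈ f + (g + h)
    +-comm      : ∀ f g → f + g ≈ g + f
    +-identityˡ : ∀ f → con K.0# + f ≈ f
    -‿inverseˡ  : ∀ f → - f + f ≈ con K.0#
    *-assoc     : ∀ f g h → (f * g) * h ≈ f * (g * h)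
    *-comm      : ∀ f g → f * g ≈ g * f
    *-identityˡ : ∀ f → con K.1# * f ≈ f
    distribˡ    : ∀ f g h → f * (g + h) ≈ f * g + f * h

    con-cong : ∀ {k l} → k K.≈ l → con k ≈ con l
    con-+    : ∀ k l → con (k K.+ l) ≈ con k + con l
    con-*    : ∀ k l → con (k K.* l) ≈ con k * con l
    con-neg  : ∀ k → con (K.- k) ≈ - con k

  commutativeRing : CommutativeRing (c ⊔ x) (c ⊔ ℓ ⊔ x)
  commutativeRing = record
    { Carrier = Poly ; _≈_ = _≈_ ; _+_ = _+_ ; _*_ = _*_ ; -_ = -_
    ; 0# = con K.0# ; 1# = con K.1#
    ; isCommutativeRing = record
      { isRing = record
        { +-isAbelianGroup = record
          { isGroup = record
            { isMonoid = record
              { isSemigroup = record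
                { isMagma = record
                  { isEquivalence = record { refl = refl ; sym = sym ; trans = trans }
                  ; ∙-cong = +-cong }
                ; assoc = +-assoc }
              ; identity = +-identityˡ , λ f → trans (+-comm _ _) (+-identityˡ f) }
            ; inverse = -‿inverseˡ , λ f → trans (+-comm _ _) (-‿inverseˡ f)
            ; ⁻¹-cong = -‿cong }
          ; comm = +-comm }
        ; *-cong = *-cong
        ; *-assoc = *-assoc
        ; *-identity = *-identityˡ , λ f → trans (*-comm _ _) (*-identityˡ f)
        ; distrib = distribˡ , λ f g h → trans (*-comm _ _)
            (trans (distribˡ f g h) (+-cong (*-comm _ _) (*-comm _ _)))
        }
      ; *-comm = *-comm
      }
    }

module Quotient (A : CommutativeRing c ℓ) (S : Pred (CommutativeRing.Carrier A) p) where

  open CommutativeRing A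
  open RingProperties ring using (-‿distribˡ-*; -‿+-comm; -‿involutive; -0#≈0#)

  data Ideal : Carrier → Set (c ⊔ ℓ ⊔ p) where
    generator : ∀ {f} → S f → Ideal f
    resp      : ∀ {f g} → f ≈ g → Ideal f → Ideal g
    ideal-0   : Ideal 0#
    ideal-+   : ∀ {f g} → Ideal f → Ideal g → Ideal (f + g)
    ideal-*   : ∀ f {g} → Ideal g → Ideal (f * g)

  infix 4 _∼_
  record _∼_ (f g : Carrier) : Set (c ⊔ ℓ ⊔ p) where
    constructor mod
    field difference : Ideal (f - g)

  private
    module _ where
      open import Relation.Binary.Reasoning.Setoid setoid

      neg : ∀ {f} → Ideal f → Ideal (- f)
      neg {f} i = resp (trans (sym (-‿distribˡ-* 1# f)) (-‿cong (*-identityˡ f))) (ideal-* (- 1#) i)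

      swap-diff : ∀ f g → - (f - g) ≈ g - f
      swap-diff f g = begin
        - (f - g)      ≈⟨ -‿+-comm f (- g) ⟨
        - f + - (- g)  ≈⟨ +-congˡ (-‿involutive g) ⟩
        - f + g        ≈⟨ +-comm (- f) g ⟩
        g - f          ∎

      join-diff : ∀ f g h → (f - g) + (g - h) ≈ f - h
      join-diff f g h = begin
        (f - g) + (g - h)    ≈⟨ +-assoc f (- g) (g - h) ⟩
        f + (- g + (g - h))  ≈⟨ +-congˡ (+-assoc (- g) g (- h)) ⟨
        f + (- g + g - h)    ≈⟨ +-congˡ (+-congʳ (-‿inverseˡ g)) ⟩
        f + (0# - h)         ≈⟨ +-congˡ (+-identityˡ (- h)) ⟩
        f - h                ∎

      cancel-diff : ∀ f g h → (f + h) - (g + h) ≈ f - g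
      cancel-diff f g h = begin
        (f + h) - (g + h)        ≈⟨ +-congˡ (-‿+-comm g h) ⟨
        (f + h) + (- g + - h)    ≈⟨ +-congˡ (+-comm (- g) (- h)) ⟩
        (f + h) + (- h + - g)    ≈⟨ +-assoc f h (- h + - g) ⟩
        f + (h + (- h + - g))    ≈⟨ +-congˡ (+-assoc h (- h) (- g)) ⟨
        f + (h - h + - g)        ≈⟨ +-congˡ (+-congʳ (-‿inverseʳ h)) ⟩
        f + (0# + - g)           ≈⟨ +-congˡ (+-identityˡ (- g)) ⟩
        f - g                    ∎

      neg-diff : ∀ f g → - (f - g) ≈ - f - - g
      neg-diff f g = sym (-‿+-comm f (- g))

      scale-diff : ∀ h f g → h * (f - g) ≈ h * f - h * g
      scale-diff h f g = begin
        h * (f - g)        ≈⟨ distribˡ h f (- g) ⟩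
        h * f + h * - g    ≈⟨ +-congˡ (*-comm h (- g)) ⟩
        h * f + - g * h    ≈⟨ +-congˡ (-‿distribˡ-* g h) ⟨
        h * f - g * h      ≈⟨ +-congˡ (-‿cong (*-comm g h)) ⟩
        h * f - h * g      ∎

  ≈⇒∼ : ∀ {f g} → f ≈ g → f ∼ g
  ≈⇒∼ {f} {g} f≈g = mod (resp (sym (trans (+-congʳ f≈g) (-‿inverseʳ g))) ideal-0)

  ∼-sym : ∀ {f g} → f ∼ g → g ∼ f
  ∼-sym {f} {g} (mod i) = mod (resp (swap-diff f g) (neg i))

  ∼-trans : ∀ {f g h} → f ∼ g → g ∼ h → f ∼ h
  ∼-trans {f} {g} {h} (mod i) (mod j) = mod (resp (join-diff f g h) (ideal-+ i j))

  ∼-+-congʳ : ∀ h {f g} → f ∼ g → f + h ∼ g + h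
  ∼-+-congʳ h {f} {g} (mod i) = mod (resp (sym (cancel-diff f g h)) i)

  ∼-+-cong : ∀ {f f′ g g′} → f ∼ f′ → g ∼ g′ → f + g ∼ f′ + g′
  ∼-+-cong {f} {f′} {g} {g′} p q = ∼-trans (∼-+-congʳ g p)
    (∼-trans (≈⇒∼ (+-comm f′ g)) (∼-trans (∼-+-congʳ f′ q) (≈⇒∼ (+-comm g′ f′))))

  ∼-*-congˡ : ∀ h {f g} → f ∼ g → h * f ∼ h * g
  ∼-*-congˡ h {f} {g} (mod i) = mod (resp (scale-diff h f g) (ideal-* h i))

  ∼-*-cong : ∀ {f f′ g g′} → f ∼ f′ → g ∼ g′ → f * g ∼ f′ * g′
  ∼-*-cong {f} {f′} {g} {g′} p q = ∼-trans (∼-*-congˡ f q)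
    (∼-trans (≈⇒∼ (*-comm f g′)) (∼-trans (∼-*-congˡ g′ p) (≈⇒∼ (*-comm g′ f′))))

  commutativeRing : CommutativeRing c (c ⊔ ℓ ⊔ p)
  commutativeRing = record
    { Carrier = Carrier ; _≈_ = _∼_ ; _+_ = _+_ ; _*_ = _*_ ; -_ = -_ ; 0# = 0# ; 1# = 1#
    ; isCommutativeRing = record
      { isRing = record
        { +-isAbelianGroup = record
          { isGroup = record
            { isMonoid = record
              { isSemigroup = record
                { isMagma = record
                  { isEquivalence = record { refl = ≈⇒∼ refl ; sym = ∼-sym ; trans = ∼-trans }
                  ; ∙-cong = ∼-+-cong }
                ; assoc = λ f g h → ≈⇒∼ (+-assoc f g h) }
              ; identity = (λ f → ≈⇒∼ (+-identityˡ f)) , λ f → ≈⇒∼ (+-identityʳ f) }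
            ; inverse = (λ f → ≈⇒∼ (-‿inverseˡ f)) , λ f → ≈⇒∼ (-‿inverseʳ f)
            ; ⁻¹-cong = λ {f} {g} (mod i) → mod (resp (neg-diff f g) (neg i)) }
          ; comm = λ f g → ≈⇒∼ (+-comm f g) }
        ; *-cong = ∼-*-cong
        ; *-assoc = λ f g h → ≈⇒∼ (*-assoc f g h)
        ; *-identity = (λ f → ≈⇒∼ (*-identityˡ f)) , λ f → ≈⇒∼ (*-identityʳ f)
        ; distrib = (λ f g h → ≈⇒∼ (distribˡ f g h)) , λ f g h → ≈⇒∼ (distribʳ f g h)
        }
      ; *-comm = λ f g → ≈⇒∼ (*-comm f g)
      }
    }

module _ {c′} (K : CommutativeRing c ℓ) (A : CommutativeRing c′ ℓ′) where

  private
    module K = CommutativeRing K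
    module A = CommutativeRing A

  algebraModule : (φ : K.Carrier → A.Carrier) →
    RingMorphisms.IsRingHomomorphism K.rawRing A.rawRing φ → LeftModule K.ring c′ ℓ′
  algebraModule φ φ-hom = record
    { Carrierᴹ = A.Carrier
    ; _≈ᴹ_ = A._≈_ ; _+ᴹ_ = A._+_ ; _*ₗ_ = λ k f → φ k A.* f ; 0ᴹ = A.0# ; -ᴹ_ = A.-_
    ; isLeftModule = record
      { isLeftSemimodule = record
        { +ᴹ-isCommutativeMonoid = A.+-isCommutativeMonoid
        ; isPreleftSemimodule = record
          { *ₗ-cong = λ k≈l f≈g → A.*-cong (φ.⟦⟧-cong k≈l) f≈g
          ; *ₗ-zeroˡ = λ f → A.trans (A.*-congʳ φ.0#-homo) (A.zeroˡ f)
          ; *ₗ-distribʳ = λ f k l → A.trans (A.*-congʳ (φ.+-homo k l)) (A.distribʳ f (φ k) (φ l))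
          ; *ₗ-identityˡ = λ f → A.trans (A.*-congʳ φ.1#-homo) (A.*-identityˡ f)
          ; *ₗ-assoc = λ k l f → A.trans (A.*-congʳ (φ.*-homo k l)) (A.*-assoc (φ k) (φ l) f)
          ; *ₗ-zeroʳ = λ k → A.zeroʳ (φ k)
          ; *ₗ-distribˡ = λ k f g → A.distribˡ (φ k) f g
          }
        }
      ; -ᴹ‿cong = A.-‿cong
      ; -ᴹ‿inverse = A.-‿inverse
      }
    }
    where module φ = RingMorphisms.IsRingHomomorphism φ-hom

module LinearCombinations {m ℓm i ℓi} (K : CommutativeRing c ℓ)
  (M : LeftModule (CommutativeRing.ring K) m ℓm)
  (I : DecSetoid i ℓi) (b : DecSetoid.Carrier I → LeftModule.Carrierᴹ M) where

  private
    module K = CommutativeRing K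
    module M = LeftModule M
    module I = DecSetoid I

  -- Indices may be repeated (up to I._≈_); their coefficients then add up.
  LinComb : Set (c ⊔ i)
  LinComb = List (K.Carrier × I.Carrier)

  value : LinComb → M.Carrierᴹ
  value = List.foldr (λ (k , j) v → k M.*ₗ b j M.+ᴹ v) M.0ᴹ

  coefficient : LinComb → I.Carrier → K.Carrier
  coefficient []            j = K.0#
  coefficient ((k , j′) ∷ l) j with j′ I.≟ j
  ... | yes _ = k K.+ coefficient l j
  ... | no  _ = coefficient l j

  infix 4 _≋_
  _≋_ : LinComb → LinComb → Set (ℓ ⊔ i)
  l ≋ l′ = ∀ j → coefficient l j K.≈ coefficient l′ j

  Spanning : Set (c ⊔ i ⊔ m ⊔ ℓm)
  Spanning = ∀ v → ∃ λ l → v M.≈ᴹ value l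

  LinearlyIndependent : Set (c ⊔ ℓ ⊔ i ⊔ ℓm)
  LinearlyIndependent = ∀ l → value l M.≈ᴹ M.0ᴹ → l ≋ []

  IsBasis : Set (c ⊔ ℓ ⊔ i ⊔ m ⊔ ℓm)
  IsBasis = Spanning × LinearlyIndependent

-- A subset of size m of an N-element set, as its increasing list of elements.
record Subset (m N : ℕ) : Set where
  constructor subset
  field
    elements    : Vec (Fin N) m
    .increasing : AllPairs Fin._<_ elements

open Subset public

infix 4 _∈ˢ_ _∈ˢ?_ _≟ˢ_

_∈ˢ_ : ∀ {m N} → Fin N → Subset m N → Set
v ∈ˢ J = v ∈ elements J

_∈ˢ?_ : ∀ {m N} → Decidable (_∈ˢ_ {m} {N})
v ∈ˢ? J = DecVecMembership._∈?_ Fin._≟_ v (elements J)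

_≟ˢ_ : ∀ {m N} → DecidableEquality (Subset m N)
subset u _ ≟ˢ subset v _ =
  map′ (λ { ≡.refl → ≡.refl }) (≡.cong elements) (Vec.≡-dec Fin._≟_ u v)

-- P_{J¹} ⋯ P_{Jʰ} as the list J¹, …, Jʰ, to be taken up to reordering.
Monomial : (m n : ℕ) → Set
Monomial m n = List (Subset m (m ℕ.+ n))

↭-dec : {A : Set a} → DecidableEquality A → Decidable (_↭_ {A = A})
↭-dec _≟_ [] [] = yes Perm.refl
↭-dec _≟_ [] (y ∷ ys) = no λ p → case ↭-empty-inv (Perm.↭-sym p) of λ ()
↭-dec _≟_ (z ∷ xs) ys with DecListMembership._∈?_ _≟_ z ys
... | no z∉ys = no λ p → z∉ys (∈-resp-↭ p (here ≡.refl))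
... | yes z∈ys with ∈-∃++ z∈ys
...   | us , vs , ≡.refl = map′
        (λ p → Perm.trans (Perm.prep z p) (Perm.↭-sym (shift z us vs)))
        (λ p → drop-∷ (Perm.trans p (shift z us vs)))
        (↭-dec _≟_ xs (us ++ vs))

NonCrossing : ∀ {m N} → Subset m N → Subset m N → Set
NonCrossing {m} a b = ∀ (k k⁺ : Fin m) → toℕ k⁺ ≡ suc (toℕ k) →
    ¬ (a ‼ k Fin.< b ‼ k × b ‼ k Fin.< a ‼ k⁺ × a ‼ k⁺ Fin.< b ‼ k⁺)
  × ¬ (b ‼ k Fin.< a ‼ k × a ‼ k Fin.< b ‼ k⁺ × b ‼ k⁺ Fin.< a ‼ k⁺)
  where
  _‼_ : ∀ {N} → Subset m N → Fin m → Fin N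
  J ‼ k = Vec.lookup (elements J) k

module _ {m n : ℕ} (M : Monomial m n) where

  private h = List.length M

  multiplicity : Fin (m ℕ.+ n) → ℕ
  multiplicity v = List.length (List.filter (v ∈ˢ?_) M)

  segmentStart : Fin (m ℕ.+ n) → ℕ
  segmentStart v =
    sum (List.map multiplicity (List.filter (Fin._<? v) (List.allFin (m ℕ.+ n))))

  InSegment : Fin (m ℕ.+ n) → Fin (m ℕ.* h) → Set
  InSegment v e = segmentStart v ℕ.≤ toℕ e × toℕ e ℕ.< segmentStart v ℕ.+ multiplicity v

  -- The blocks are numbered so that the i-th one becomes Jⁱ; such a numbering
  -- exists exactly when the multiset of relabelled blocks is {J¹, …, Jʰ}.
  record SemiNonCrossing : Set where
    field
      block       : Fin h → Subset m (m ℕ.* h)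
      covering    : ∀ e → ∃ λ i → e ∈ˢ block i
      disjoint    : ∀ {i j} e → e ∈ˢ block i → e ∈ˢ block j → i ≡ j
      nonCrossing : ∀ {i j} → i ≢ j → NonCrossing (block i) (block j)
      atMostOne   : ∀ i v {e e′} → e ∈ˢ block i → e′ ∈ˢ block i →
                    InSegment v e → InSegment v e′ → e ≡ e′
      relabelled  : ∀ i v →
                    v ∈ˢ List.lookup M i ⇔ ∃ λ e → e ∈ˢ block i × InSegment v e

record NCM (m n : ℕ) : Set where
  constructor ncm
  field
    factors         : Monomial m n
    semiNonCrossing : SemiNonCrossing factors

open NCM public using (factors)

NCMs : (m n : ℕ) → DecSetoid 0ℓ 0ℓ
NCMs m n = record
  { Carrier = NCM m n
  ; _≈_ = λ M M′ → factors M ↭ factors M′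
  ; isDecEquivalence = record
    { isEquivalence = record
      { refl = Perm.↭-refl ; sym = Perm.↭-sym ; trans = Perm.↭-trans }
    ; _≟_ = λ M M′ → ↭-dec _≟ˢ_ (factors M) (factors M′)
    }
  }

module _ {A : Set a} where

  -- All ways to split a sequence into subsequences of lengths t and r, each with
  -- the number of pairs whose earlier entry goes to the second subsequence and
  -- whose later entry goes to the first.
  splittings leftFirst rightFirst : ∀ t r {s} → Vec A s → List (ℕ × Vec A t × Vec A r)

  splittings zero    zero    [] = (0 , [] , []) ∷ []
  splittings zero    (suc r) [] = []
  splittings (suc t) r       [] = []
  splittings t       r       (y ∷ ys) = leftFirst t r (y ∷ ys) ++ rightFirst t r (y ∷ ys)

  leftFirst (suc t) r (y ∷ ys) =
    List.map (λ (k , us , vs) → k , y ∷ us , vs) (splittings t r ys)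
  leftFirst _ _ _ = []

  rightFirst t (suc r) (y ∷ ys) =
    List.map (λ (k , us , vs) → t ℕ.+ k , us , y ∷ vs) (splittings t r ys)
  rightFirst _ _ _ = []

module _ {N : ℕ} where

  insert : ∀ {k} → Fin N → Vec (Fin N) k → Vec (Fin N) (suc k)
  insert u [] = u ∷ []
  insert u (v ∷ vs) with u Fin.≤? v
  ... | yes _ = u ∷ v ∷ vs
  ... | no  _ = v ∷ insert u vs

  sort : ∀ {k} → Vec (Fin N) k → Vec (Fin N) k
  sort [] = []
  sort (v ∷ vs) = insert v (sort vs)

  inversions : ∀ {k} → Vec (Fin N) k → ℕ
  inversions [] = 0
  inversions (v ∷ vs) = Vec.count (Fin._<? v) vs ℕ.+ inversions vs

module Grassmannian (K : CommutativeRing c ℓ) (m n : ℕ) where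

  private
    module K = CommutativeRing K
    N = m ℕ.+ n

  module Poly = Polynomials K (Subset m N)
  open Poly using (Poly; con; var; _+_; _*_; -_)

  signed : ℕ → Poly → Poly
  signed zero    f = f
  signed (suc k) f = - signed k f

  -- The minor on the columns s₁, …, sₘ in this order: ± P_J if these are the
  -- distinct elements of J, and 0 if some column is repeated.
  bracket : Vec (Fin N) m → Poly
  bracket s with allPairs? Fin._<?_ (sort s)
  ... | yes inc = signed (inversions s) (var (subset (sort s) inc))
  ... | no  _   = con K.0#

  -- For sequences a, c, b of columns with c longer than m, antisymmetrising
  -- over c the product of brackets [a c₁…c_t] [c_{t+1}…c_{t+r} b] gives 0.
  -- With q = 0 and r = m (so t = 1) these are the relations
  -- Σᵢ ± [a cᵢ] [c₁…ĉᵢ…c_{m+1}] = 0.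
  data PlückerRelation : Poly → Set (c ⊔ ℓ) where
    plücker : ∀ {p t r q} (p+t≡m : p ℕ.+ t ≡ m) (r+q≡m : r ℕ.+ q ≡ m) → m ℕ.< t ℕ.+ r →
      (a : Vec (Fin N) p) (c : Vec (Fin N) (t ℕ.+ r)) (b : Vec (Fin N) q) →
      PlückerRelation
        (List.foldr _+_ (con K.0#)
          (List.map
            (λ (k , c′ , c″) → signed k
              ( bracket (Vec.cast p+t≡m (a Vec.++ c′))
              * bracket (Vec.cast r+q≡m (c″ Vec.++ b)) ))
            (splittings t r c)))

  module R = Quotient Poly.commutativeRing PlückerRelation

  coordinateRing : CommutativeRing c (c ⊔ ℓ)
  coordinateRing = R.commutativeRing

  coordinateModule : LeftModule K.ring c (c ⊔ ℓ)
  coordinateModule = algebraModule K coordinateRing con (record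
    { isSemiringHomomorphism = record
      { isNearSemiringHomomorphism = record
        { +-isMonoidHomomorphism = record
          { isMagmaHomomorphism = record
            { isRelHomomorphism = record { cong = λ k≈l → R.≈⇒∼ (Poly.con-cong k≈l) }
            ; homo = λ k l → R.≈⇒∼ (Poly.con-+ k l) }
          ; ε-homo = R.≈⇒∼ Poly.refl }
        ; *-homo = λ k l → R.≈⇒∼ (Poly.con-* k l) }
      ; 1#-homo = R.≈⇒∼ Poly.refl }
    ; -‿homo = λ k → R.≈⇒∼ (Poly.con-neg k)
    })

  open CommutativeRing coordinateRing public using (Carrier; _≈_)

  monomial : Monomial m n → Carrier
  monomial = List.foldr (λ J f → var J * f) (con K.1#)

  open LinearCombinations K coordinateModule (NCMs m n) (λ M → monomial (factors M)) public

{-# OPTIONS --safe #-}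
module Submission where

-- Expand a Plücker coordinate P_J as a maximal minor of a generic matrix and weight
-- the entry in row k and column j by k·j (up to a shift). Its term of largest weight is the
-- diagonal one, so the leading exponent of a monomial records, row by row, the
-- multiset of the k-th elements of its factors: its row content. Two kinds of
-- monomials are determined by their row content. The standard monomials, whose factors
-- form a chain, are obtained by sorting every row. In a non-crossing monomial the
-- arcs joining the k-th to the (k+1)-st elements of the blocks form a non-crossing
-- matching, and such a matching is determined by its two rows, the first closing being
-- matched with the last opening before it; it exists because the k-th entry of a
-- column is smaller than the (k+1)-st.
--
-- Distinct leading exponents give linear independence. The standard monomials
-- span by straightening along the Plücker relations. A standard monomial minus the
-- non-crossing one with the same row content has smaller weight, and is therefore a
-- combination of standard monomials of smaller weight; by induction on the weight the
-- non-crossing monomials span as well.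

open import Defs
open import Data.Nat using (ℕ; _≤_)
open import Data.Product using (_×_; ∃!)

open import Level using (Level; Lift; lift; _⊔_; 0ℓ)
open import Algebra.Bundles using (CommutativeRing; RawRing)
open import Algebra.Module.Bundles using (LeftModule)
import Algebra.Properties.CommutativeMonoid.Sum as Summation
import Algebra.Properties.CommutativeSemigroup as CommutativeSemigroupProperties
import Algebra.Properties.Ring as RingProperties
import Algebra.Properties.Semiring.Mult as Multiples
import Algebra.Properties.Semiring.Sum as SemiringSummation
import Algebra.Solver.Ring as RingSolver
import Algebra.Solver.Ring.AlmostCommutativeRing as ACR
open import Algebra.Structures using (IsCommutativeMonoid; IsCommutativeRing)
open import Data.Bool using (true; false; if_then_else_)
open import Data.Fin as Fin using (Fin; zero; suc; toℕ; punchIn; punchOut)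
import Data.Fin.Induction as Fin
import Data.Fin.Permutation as Permutation
import Data.Fin.Properties as Fin
open import Data.List as List using (List; []; _∷_; _++_; length)
open import Data.List.Membership.Propositional using (_∈_)
import Data.List.Properties as List
open import Data.List.Relation.Binary.Permutation.Propositional as Perm using (_↭_)
import Data.List.Relation.Binary.Permutation.Propositional.Properties as Perm
open import Data.List.Relation.Unary.All as ListAll using ([]; _∷_)
import Data.List.Relation.Unary.All.Properties as ListAll
open import Data.List.Relation.Unary.AllPairs as ListPairs using ([]; _∷_)
open import Data.List.Relation.Unary.Any using (here; there)
open import Data.Maybe using (Maybe; just; nothing)
open import Data.Nat as ℕ using (zero; suc; _<_)
open import Data.Nat.Induction using (<-wellFounded)
import Data.Nat.ListAction as ℕ
import Data.Nat.Properties as ℕ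
import Data.Nat.Solver as ℕ-Solver
open import Data.Product using (∃; ∃₂; _,_; proj₁; proj₂)
open import Data.Sum using (_⊎_; inj₁; inj₂)
open import Data.Unit using (⊤)
open import Data.Vec as Vec using (Vec; []; _∷_; toList)
open import Data.Vec.Membership.Propositional using () renaming (_∈_ to _∈ᵛ_)
open import Data.Vec.Membership.Propositional.Properties using (∈-tabulate⁺; ∈-lookup)
import Data.Vec.Properties as Vec
open import Data.Vec.Relation.Unary.All as All using (All; []; _∷_)
import Data.Vec.Relation.Unary.All.Properties as All
open import Data.Vec.Relation.Unary.AllPairs using (AllPairs; []; _∷_; allPairs?)
open import Data.Vec.Relation.Unary.Any using (here; there)
open import Function using (_∘_; id; mk⇔; Equivalence)
open import Induction.WellFounded using (Acc; acc)
open import Relation.Binary.Bundles using (DecSetoid)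
open import Relation.Binary.Definitions using (DecidableEquality; tri<; tri≈; tri>)
open import Relation.Binary.PropositionalEquality as ≡ using (_≡_; _≢_; _≗_)
open import Relation.Nullary using (¬_; Dec; yes; no; does; contradiction)
open import Relation.Nullary.Decidable using (dec-true; dec-false; recompute)
open import Relation.Unary using (Pred; Decidable)

-- Equality in `ℂ`, a matter of limits of Cauchy sequences, cannot be decided, so a polynomial
-- cannot be normalised and its leading term cannot be looked up. Two devices avoid this. An element
-- of the monoid algebra is known only through linear functionals, and having a given leading
-- exponent means being evaluated correctly by every functional that kills the smaller weights. A
-- linear combination is reduced by removing members of maximal weight one after another, their
-- coefficients being proved zero rather than tested. All leading coefficients are 1, so the
-- argument takes place over an arbitrary commutative ring.
--
-- The polynomials of the statement are identified by a generated equivalence, so telling two of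
-- them apart takes a model: the monoid algebra.
--
-- Being non-crossing is a property of places in 1, ..., mh, where each column owns a whole segment,
-- while row contents only see columns. `Nested` bridges the gap: it keeps an order of the entries
-- in every row and turns crossings into inequalities between columns. These are weak, since a
-- closing may be placed before an opening of the same segment.

open Summation ℕ.+-0-commutativeMonoid using (sum; sum-cong-≗; ∑-distrib-+; ∑-comm; sum-permute; sum-replicate-zero)
open SemiringSummation ℕ.+-*-semiring using (*-distribˡ-sum)

-- Integer coefficients, (a , b) standing for a − b, let the solver cancel over an
-- arbitrary commutative ring.
module IntegralSolver {c ℓ : Level} (R : CommutativeRing c ℓ) where

  open CommutativeRing R
  open RingProperties ring
    using (-‿+-comm; -0#≈0#; x[y-z]≈xy-xz; [y-z]x≈yx-zx; ⁻¹-anti-homo‿-)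
  open CommutativeSemigroupProperties +-commutativeSemigroup
    using () renaming (interchange to +-interchange)
  open Multiples semiring using (×-homo-+; ×1-homo-*) renaming (_×_ to _·_)
  open import Relation.Binary.Reasoning.Setoid setoid

  private
    Difference : RawRing _ _
    Difference = record
      { Carrier = ℕ × ℕ
      ; _≈_ = _≡_
      ; _+_ = λ (a , b) (a′ , b′) → a ℕ.+ a′ , b ℕ.+ b′
      ; _*_ = λ (a , b) (a′ , b′) → a ℕ.* a′ ℕ.+ b ℕ.* b′ , a ℕ.* b′ ℕ.+ b ℕ.* a′
      ; -_ = λ (a , b) → b , a
      ; 0# = 0 , 0
      ; 1# = 1 , 0
      }

    ⟦_⟧ : ℕ × ℕ → Carrier
    ⟦ a , b ⟧ = a · 1# - b · 1#

    sub-+ : ∀ x y z w → (x + z) - (y + w) ≈ (x - y) + (z - w)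
    sub-+ x y z w = begin
      (x + z) - (y + w)        ≈⟨ +-congˡ (-‿+-comm y w) ⟨
      (x + z) + (- y + - w)    ≈⟨ +-interchange x z (- y) (- w) ⟩
      (x - y) + (z - w)        ∎

    ⟦⟧-+ : ∀ a b a′ b′ → ⟦ a ℕ.+ a′ , b ℕ.+ b′ ⟧ ≈ ⟦ a , b ⟧ + ⟦ a′ , b′ ⟧
    ⟦⟧-+ a b a′ b′ = trans
      (+-cong (×-homo-+ 1# a a′) (-‿cong (×-homo-+ 1# b b′)))
      (sub-+ (a · 1#) (b · 1#) (a′ · 1#) (b′ · 1#))

    sub-* : ∀ x y z w → (x - y) * (z - w) ≈ (x * z + y * w) - (x * w + y * z)
    sub-* x y z w = begin
      (x - y) * (z - w)                      ≈⟨ [y-z]x≈yx-zx (z - w) x y ⟩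
      x * (z - w) - y * (z - w)              ≈⟨ +-cong (x[y-z]≈xy-xz x z w) (-‿cong (x[y-z]≈xy-xz y z w)) ⟩
      (x * z - x * w) - (y * z - y * w)      ≈⟨ +-congˡ (⁻¹-anti-homo‿- (y * z) (y * w)) ⟩
      (x * z - x * w) + (y * w - y * z)      ≈⟨ sub-+ (x * z) (x * w) (y * w) (y * z) ⟨
      (x * z + y * w) - (x * w + y * z)      ∎

    ⟦⟧-* : ∀ a b a′ b′ →
      ⟦ a ℕ.* a′ ℕ.+ b ℕ.* b′ , a ℕ.* b′ ℕ.+ b ℕ.* a′ ⟧ ≈ ⟦ a , b ⟧ * ⟦ a′ , b′ ⟧
    ⟦⟧-* a b a′ b′ = trans
      (+-cong (expand a a′ b b′) (-‿cong (expand a b′ b a′)))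
      (sym (sub-* (a · 1#) (b · 1#) (a′ · 1#) (b′ · 1#)))
      where
      expand : ∀ i j k l →
        (i ℕ.* j ℕ.+ k ℕ.* l) · 1# ≈ i · 1# * j · 1# + k · 1# * l · 1#
      expand i j k l = trans (×-homo-+ 1# (i ℕ.* j) (k ℕ.* l))
        (+-cong (×1-homo-* i j) (×1-homo-* k l))

    ⟦⟧-neg : ∀ a b → ⟦ b , a ⟧ ≈ - ⟦ a , b ⟧
    ⟦⟧-neg a b = sym (⁻¹-anti-homo‿- (a · 1#) (b · 1#))

    acr : ACR.AlmostCommutativeRing c ℓ
    acr = ACR.fromCommutativeRing R

    ⟦⟧-hom : Difference ACR.-Raw-AlmostCommutative⟶ acr
    ⟦⟧-hom = record
      { ⟦_⟧ = ⟦_⟧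
      ; +-homo = λ (a , b) (a′ , b′) → ⟦⟧-+ a b a′ b′
      ; *-homo = λ (a , b) (a′ , b′) → ⟦⟧-* a b a′ b′
      ; -‿homo = λ (a , b) → ⟦⟧-neg a b
      ; 0-homo = -‿inverseʳ 0#
      ; 1-homo = trans (+-cong (+-identityʳ 1#) -0#≈0#) (+-identityʳ 1#)
      }

    equal? : ∀ x y → Maybe (⟦ x ⟧ ≈ ⟦ y ⟧)
    equal? (a , b) (a′ , b′) with a ℕ.+ b′ ℕ.≟ a′ ℕ.+ b
    ... | no _ = nothing
    ... | yes eq = just (begin
      ⟦ a , b ⟧                      ≈⟨ +-identityʳ _ ⟨
      ⟦ a , b ⟧ + 0#                 ≈⟨ +-congˡ (-‿inverseʳ (b′ · 1#)) ⟨
      ⟦ a , b ⟧ + ⟦ b′ , b′ ⟧        ≈⟨ ⟦⟧-+ a b b′ b′ ⟨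
      ⟦ a ℕ.+ b′ , b ℕ.+ b′ ⟧        ≡⟨ ≡.cong₂ (λ i j → ⟦ i , j ⟧) eq (ℕ.+-comm b b′) ⟩
      ⟦ a′ ℕ.+ b , b′ ℕ.+ b ⟧        ≈⟨ ⟦⟧-+ a′ b′ b b ⟩
      ⟦ a′ , b′ ⟧ + ⟦ b , b ⟧        ≈⟨ +-congˡ (-‿inverseʳ (b · 1#)) ⟩
      ⟦ a′ , b′ ⟧ + 0#               ≈⟨ +-identityʳ _ ⟩
      ⟦ a′ , b′ ⟧                    ∎)

  open RingSolver Difference acr ⟦⟧-hom equal? public
    using (solve; _:=_; _:+_; _:*_; _:-_; :-_; con)

-- Exterior products of functions on the columns, determinants, and the vanishing of long products

module Forms {c ℓ v : Level} (S : CommutativeRing c ℓ) (V : Set v) where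

  open CommutativeRing S
  open RingProperties ring
    using (-‿distribˡ-*; -0#≈0#; -1*x≈-x)
  open IntegralSolver S
  open import Relation.Binary.Reasoning.Setoid setoid

  -- A form of degree t vanishes on the lists of length other than t.
  Form : Set (c ⊔ v)
  Form = List V → Carrier

  infix 4 _≋_
  _≋_ : Form → Form → Set (ℓ ⊔ v)
  ω ≋ η = ∀ vs → ω vs ≈ η vs

  ι : V → Form → Form
  ι u ω vs = ω (u ∷ vs)

  infixr 7 _⋏_
  infixl 7 _∧_

  -- The exterior product of a one-form with a form, defined by its contractions: `ι u` is an
  -- antiderivation, ι u (x ⋏ ω) = x u · ω - x ⋏ ι u ω. Recursion on the arguments replaces sums
  -- over permutations.
  _⋏_ : (V → Carrier) → Form → Form
  (x ⋏ ω) []       = 0#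
  (x ⋏ ω) (u ∷ vs) = x u * ω vs - (x ⋏ ι u ω) vs

  -- Multiplication by (-1)^t in degree t, the sign that `ι u` picks up when it passes a left factor
  -- of degree t.
  grade : Form → Form
  grade ω []       = ω []
  grade ω (u ∷ vs) = - grade (ι u ω) vs

  -- The shuffle product, again defined by contraction in the first argument. Unfolded over all
  -- arguments it is a signed sum over their splittings into two subsequences, the shape of a
  -- Plücker relation (`splittings-∧`).
  _∧_ : Form → Form → Form
  (ω ∧ η) []       = ω [] * η []
  (ω ∧ η) (u ∷ vs) = (ι u ω ∧ η) vs + (grade ω ∧ ι u η) vs

  combine : Carrier → Form → Carrier → Form → Form
  combine s ω t η vs = s * ω vs + t * η vs

  record Linear (T : Form → Form) : Set (c ⊔ ℓ ⊔ v) where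
    field
      cong   : ∀ {ω η} → ω ≋ η → T ω ≋ T η
      linear : ∀ s ω t η → T (combine s ω t η) ≋ combine s (T ω) t (T η)

    add : ∀ ω η → T (λ vs → ω vs + η vs) ≋ λ vs → T ω vs + T η vs
    add ω η vs = begin
      T (λ vs → ω vs + η vs) vs      ≈⟨ cong (λ us → +-cong (*-identityˡ (ω us)) (*-identityˡ (η us))) vs ⟨
      T (combine 1# ω 1# η) vs       ≈⟨ linear 1# ω 1# η vs ⟩
      combine 1# (T ω) 1# (T η) vs   ≈⟨ +-cong (*-identityˡ _) (*-identityˡ _) ⟩
      T ω vs + T η vs                ∎

    subtract : ∀ s ω η → T (λ vs → s * ω vs - η vs) ≋ λ vs → s * T ω vs - T η vs
    subtract s ω η vs = begin
      T (λ vs → s * ω vs - η vs) vs   ≈⟨ cong (λ us → +-congˡ (-1*x≈-x (η us))) vs ⟨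
      T (combine s ω (- 1#) η) vs     ≈⟨ linear s ω (- 1#) η vs ⟩
      combine s (T ω) (- 1#) (T η) vs ≈⟨ +-congˡ (-1*x≈-x _) ⟩
      s * T ω vs - T η vs             ∎

    scale : ∀ s ω → T (λ vs → s * ω vs) ≋ λ vs → s * T ω vs
    scale s ω vs = begin
      T (λ vs → s * ω vs) vs      ≈⟨ cong (λ us → drop (ω us)) vs ⟨
      T (combine s ω 0# ω) vs     ≈⟨ linear s ω 0# ω vs ⟩
      combine s (T ω) 0# (T ω) vs ≈⟨ drop (T ω vs) ⟩
      s * T ω vs                  ∎
      where
      drop : ∀ z → s * z + 0# * z ≈ s * z
      drop z = trans (+-congˡ (zeroˡ z)) (+-identityʳ (s * z))

    negate : ∀ ω → T (λ vs → - ω vs) ≋ λ vs → - T ω vs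
    negate ω vs = begin
      T (λ vs → - ω vs) vs        ≈⟨ cong (λ us → -1*x≈-x (ω us)) vs ⟨
      T (λ vs → - 1# * ω vs) vs   ≈⟨ scale (- 1#) ω vs ⟩
      - 1# * T ω vs               ≈⟨ -1*x≈-x _ ⟩
      - T ω vs                    ∎

    vanish : ∀ {ω} → (∀ vs → ω vs ≈ 0#) → ∀ vs → T ω vs ≈ 0#
    vanish {ω} ω≈0 vs = begin
      T ω vs                     ≈⟨ cong (λ us → trans (ω≈0 us) (sym (zeroˡ (ω us)))) vs ⟩
      T (λ vs → 0# * ω vs) vs    ≈⟨ scale 0# ω vs ⟩
      0# * T ω vs                ≈⟨ zeroˡ _ ⟩
      0#                         ∎

  private
    lin-0 : ∀ s t → 0# ≈ s * 0# + t * 0#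
    lin-0 s t = sym (trans (+-cong (zeroʳ s) (zeroʳ t)) (+-identityʳ 0#))

  ⋏-linear : ∀ x → Linear (x ⋏_)
  ⋏-linear x = record { cong = cong′ ; linear = linear′ }
    where
    cong′ : ∀ {ω η} → ω ≋ η → x ⋏ ω ≋ x ⋏ η
    cong′ p []       = refl
    cong′ p (u ∷ vs) = +-cong (*-congˡ (p vs)) (-‿cong (cong′ (λ us → p (u ∷ us)) vs))
    linear′ : ∀ s ω t η → x ⋏ combine s ω t η ≋ combine s (x ⋏ ω) t (x ⋏ η)
    linear′ s ω t η []       = lin-0 s t
    linear′ s ω t η (u ∷ vs) = trans (+-congˡ (-‿cong (linear′ s (ι u ω) t (ι u η) vs)))
      (solve 7 (λ s t x a b c d →
        x :* (s :* a :+ t :* b) :- (s :* c :+ t :* d) :=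
        s :* (x :* a :- c) :+ t :* (x :* b :- d)) refl
        s t (x u) (ω vs) (η vs) ((x ⋏ ι u ω) vs) ((x ⋏ ι u η) vs))

  grade-linear : Linear grade
  grade-linear = record { cong = cong′ ; linear = linear′ }
    where
    cong′ : ∀ {ω η} → ω ≋ η → grade ω ≋ grade η
    cong′ p []       = p []
    cong′ p (u ∷ vs) = -‿cong (cong′ (λ us → p (u ∷ us)) vs)
    linear′ : ∀ s ω t η → grade (combine s ω t η) ≋ combine s (grade ω) t (grade η)
    linear′ s ω t η []       = refl
    linear′ s ω t η (u ∷ vs) = trans (-‿cong (linear′ s (ι u ω) t (ι u η) vs))
      (solve 4 (λ s t a b → :- (s :* a :+ t :* b) := s :* :- a :+ t :* :- b) refl
        s t (grade (ι u ω) vs) (grade (ι u η) vs))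

  private module Grade = Linear grade-linear

  ∧-cong : ∀ {ω ω′ η η′} → ω ≋ ω′ → η ≋ η′ → ω ∧ η ≋ ω′ ∧ η′
  ∧-cong p q []       = *-cong (p []) (q [])
  ∧-cong p q (u ∷ vs) = +-cong (∧-cong (λ us → p (u ∷ us)) q vs)
    (∧-cong (Grade.cong p) (λ us → q (u ∷ us)) vs)

  private
    regroup : ∀ s t a b c d →
      (s * a + t * b) + (s * c + t * d) ≈ s * (a + c) + t * (b + d)
    regroup = solve 6 (λ s t a b c d →
      (s :* a :+ t :* b) :+ (s :* c :+ t :* d) := s :* (a :+ c) :+ t :* (b :+ d)) refl

  ∧-linearˡ : ∀ η → Linear (_∧ η)
  ∧-linearˡ η = record { cong = λ p → ∧-cong p (λ _ → refl) ; linear = linear′ η }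
    where
    linear′ : ∀ η s ω t ζ → combine s ω t ζ ∧ η ≋ combine s (ω ∧ η) t (ζ ∧ η)
    linear′ η s ω t ζ []       = solve 5 (λ s t a b e →
      (s :* a :+ t :* b) :* e := s :* (a :* e) :+ t :* (b :* e)) refl s t (ω []) (ζ []) (η [])
    linear′ η s ω t ζ (u ∷ vs) = trans
      (+-cong (linear′ η s (ι u ω) t (ι u ζ) vs)
        (trans (∧-cong (Grade.linear s ω t ζ) (λ _ → refl) vs)
          (linear′ (ι u η) s (grade ω) t (grade ζ) vs)))
      (regroup s t _ _ _ _)

  ∧-linearʳ : ∀ ω → Linear (ω ∧_)
  ∧-linearʳ ω = record { cong = ∧-cong (λ _ → refl) ; linear = linear′ ω }
    where
    linear′ : ∀ ω s η t ζ → ω ∧ combine s η t ζ ≋ combine s (ω ∧ η) t (ω ∧ ζ)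
    linear′ ω s η t ζ []       = solve 5 (λ s t a b e →
      e :* (s :* a :+ t :* b) := s :* (e :* a) :+ t :* (e :* b)) refl s t (η []) (ζ []) (ω [])
    linear′ ω s η t ζ (u ∷ vs) = trans
      (+-cong (linear′ (ι u ω) s η t ζ vs) (linear′ (grade ω) s (ι u η) t (ι u ζ) vs))
      (regroup s t _ _ _ _)

  private
    module Wedge x = Linear (⋏-linear x)
    module Left η = Linear (∧-linearˡ η)
    module Right ω = Linear (∧-linearʳ ω)

  grade-⋏ : ∀ x ω → grade (x ⋏ ω) ≋ λ vs → - (x ⋏ grade ω) vs
  grade-⋏ x ω []       = sym -0#≈0#
  grade-⋏ x ω (u ∷ vs) = -‿cong (begin
    grade (λ us → x u * ω us - (x ⋏ ι u ω) us) vs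
      ≈⟨ Grade.subtract (x u) ω (x ⋏ ι u ω) vs ⟩
    x u * grade ω vs - grade (x ⋏ ι u ω) vs
      ≈⟨ +-congˡ (-‿cong (trans (grade-⋏ x (ι u ω) vs) (sym (Wedge.negate x (grade (ι u ω)) vs)))) ⟩
    x u * grade ω vs - (x ⋏ ι u (grade ω)) vs ∎)

  ⋏-⋏ : ∀ x ω vs → (x ⋏ x ⋏ ω) vs ≈ 0#
  ⋏-⋏ x ω []       = refl
  ⋏-⋏ x ω (u ∷ vs) = begin
    x u * (x ⋏ ω) vs - (x ⋏ (λ us → x u * ω us - (x ⋏ ι u ω) us)) vs
      ≈⟨ +-congˡ (-‿cong (trans (Wedge.subtract x (x u) ω (x ⋏ ι u ω) vs)
           (+-congˡ (-‿cong (⋏-⋏ x (ι u ω) vs))))) ⟩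
    x u * (x ⋏ ω) vs - (x u * (x ⋏ ω) vs - 0#)
      ≈⟨ solve 2 (λ a z → a :- (a :- z) := z) refl _ 0# ⟩
    0# ∎

  ⋏-∧ : ∀ x ω η → (x ⋏ ω) ∧ η ≋ x ⋏ (ω ∧ η)
  ⋏-∧ x ω η []       = zeroˡ (η [])
  ⋏-∧ x ω η (u ∷ vs) = begin
    ((λ us → x u * ω us - (x ⋏ ι u ω) us) ∧ η) vs + (grade (x ⋏ ω) ∧ ι u η) vs
      ≈⟨ +-cong (Left.subtract η (x u) ω (x ⋏ ι u ω) vs)
           (trans (∧-cong (grade-⋏ x ω) (λ _ → refl) vs)
             (Left.negate (ι u η) (x ⋏ grade ω) vs)) ⟩
    (x u * (ω ∧ η) vs - ((x ⋏ ι u ω) ∧ η) vs) - ((x ⋏ grade ω) ∧ ι u η) vs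
      ≈⟨ +-cong (+-congˡ (-‿cong (⋏-∧ x (ι u ω) η vs))) (-‿cong (⋏-∧ x (grade ω) (ι u η) vs)) ⟩
    (x u * (ω ∧ η) vs - (x ⋏ (ι u ω ∧ η)) vs) - (x ⋏ (grade ω ∧ ι u η)) vs
      ≈⟨ solve 3 (λ a b c → (a :- b) :- c := a :- (b :+ c)) refl _ _ _ ⟩
    x u * (ω ∧ η) vs - ((x ⋏ (ι u ω ∧ η)) vs + (x ⋏ (grade ω ∧ ι u η)) vs)
      ≈⟨ +-congˡ (-‿cong (Wedge.add x (ι u ω ∧ η) (grade ω ∧ ι u η) vs)) ⟨
    x u * (ω ∧ η) vs - (x ⋏ ι u (ω ∧ η)) vs ∎

  ∧-⋏ : ∀ x ω η → ω ∧ (x ⋏ η) ≋ x ⋏ (grade ω ∧ η)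
  ∧-⋏ x ω η []       = zeroʳ (ω [])
  ∧-⋏ x ω η (u ∷ vs) = begin
    (ι u ω ∧ (x ⋏ η)) vs + (grade ω ∧ (λ us → x u * η us - (x ⋏ ι u η) us)) vs
      ≈⟨ +-cong (∧-⋏ x (ι u ω) η vs)
           (trans (Right.subtract (grade ω) (x u) η (x ⋏ ι u η) vs)
             (+-congˡ (-‿cong (∧-⋏ x (grade ω) (ι u η) vs)))) ⟩
    (x ⋏ (grade (ι u ω) ∧ η)) vs +
      (x u * (grade ω ∧ η) vs - (x ⋏ (grade (grade ω) ∧ ι u η)) vs)
      ≈⟨ solve 3 (λ a b c → a :+ (b :- c) := b :- (:- a :+ c)) refl _ _ _ ⟩
    x u * (grade ω ∧ η) vs -
      (- (x ⋏ (grade (ι u ω) ∧ η)) vs + (x ⋏ (grade (grade ω) ∧ ι u η)) vs)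
      ≈⟨ +-congˡ (-‿cong (+-congʳ (trans (sym (Wedge.negate x _ vs))
           (Wedge.cong x (λ us → sym (Left.negate η (grade (ι u ω)) us)) vs)))) ⟩
    x u * (grade ω ∧ η) vs -
      ((x ⋏ (ι u (grade ω) ∧ η)) vs + (x ⋏ (grade (grade ω) ∧ ι u η)) vs)
      ≈⟨ +-congˡ (-‿cong (Wedge.add x (ι u (grade ω) ∧ η) (grade (grade ω) ∧ ι u η) vs)) ⟨
    x u * (grade ω ∧ η) vs - (x ⋏ ι u (grade ω ∧ η)) vs ∎

  -- The forms generated by the one-forms x ∈ xs, in the normal form
  -- ω₁ + x ⋏ ω₂ with ω₁ and ω₂ generated by the remaining one-forms.
  Generated : List (V → Carrier) → Form → Set (c ⊔ ℓ ⊔ v)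
  Generated []       ω = Lift (c ⊔ ℓ ⊔ v) (∀ u vs → ω (u ∷ vs) ≈ 0#)
  Generated (x ∷ xs) ω = ∃₂ λ ω₁ ω₂ → Generated xs ω₁ × Generated xs ω₂ ×
    (ω ≋ λ vs → ω₁ vs + (x ⋏ ω₂) vs)

  generated-resp : ∀ xs {ω η} → ω ≋ η → Generated xs ω → Generated xs η
  generated-resp []       p (lift g) =
    lift λ u vs → trans (sym (p (u ∷ vs))) (g u vs)
  generated-resp (x ∷ xs) p (ω₁ , ω₂ , g₁ , g₂ , q) =
    ω₁ , ω₂ , g₁ , g₂ , λ vs → trans (sym (p vs)) (q vs)

  generated-combine : ∀ xs {ω η} s t → Generated xs ω → Generated xs η →
                      Generated xs (combine s ω t η)
  generated-combine []       s t (lift g) (lift h) = lift λ u vs →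
    trans (+-cong (*-congˡ (g u vs)) (*-congˡ (h u vs))) (sym (lin-0 s t))
  generated-combine (x ∷ xs) s t (ω₁ , ω₂ , g₁ , g₂ , p) (η₁ , η₂ , h₁ , h₂ , q) =
    combine s ω₁ t η₁ , combine s ω₂ t η₂ ,
    generated-combine xs s t g₁ h₁ , generated-combine xs s t g₂ h₂ , λ vs →
    trans (+-cong (*-congˡ (p vs)) (*-congˡ (q vs)))
      (trans (solve 6 (λ s t a b c d →
          s :* (a :+ b) :+ t :* (c :+ d) := (s :* a :+ t :* c) :+ (s :* b :+ t :* d)) refl
          s t (ω₁ vs) ((x ⋏ ω₂) vs) (η₁ vs) ((x ⋏ η₂) vs))
        (+-congˡ (sym (Wedge.linear x s ω₂ t η₂ vs))))

  generated-scale : ∀ xs {ω} s → Generated xs ω → Generated xs (λ vs → s * ω vs)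
  generated-scale xs {ω} s g = generated-resp xs
    (λ vs → trans (+-congˡ (zeroˡ (ω vs))) (+-identityʳ (s * ω vs)))
    (generated-combine xs s 0# g g)

  generated-+ : ∀ xs {ω η} → Generated xs ω → Generated xs η →
                Generated xs (λ vs → ω vs + η vs)
  generated-+ xs {ω} {η} g h = generated-resp xs
    (λ vs → +-cong (*-identityˡ (ω vs)) (*-identityˡ (η vs)))
    (generated-combine xs 1# 1# g h)

  generated-neg : ∀ xs {ω} → Generated xs ω → Generated xs (λ vs → - ω vs)
  generated-neg xs {ω} g = generated-resp xs
    (λ vs → -1*x≈-x (ω vs))
    (generated-scale xs (- 1#) g)

  generated-0 : ∀ xs → Generated xs (λ _ → 0#)
  generated-0 []       = lift λ _ _ → refl
  generated-0 (x ∷ xs) = (λ _ → 0#) , (λ _ → 0#) , generated-0 xs , generated-0 xs , λ vs →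
    sym (trans (+-identityˡ _) (Wedge.vanish x (λ _ → refl) vs))

  generated-ι : ∀ xs {ω} u → Generated xs ω → Generated xs (ι u ω)
  generated-ι []       u (lift g) = lift λ w vs → g u (w ∷ vs)
  generated-ι (x ∷ xs) u (ω₁ , ω₂ , g₁ , g₂ , p) =
    (λ vs → ω₁ (u ∷ vs) + x u * ω₂ vs) , (λ vs → - ω₂ (u ∷ vs)) ,
    generated-+ xs (generated-ι xs u g₁) (generated-scale xs (x u) g₂) ,
    generated-neg xs (generated-ι xs u g₂) , λ vs → begin
      _ ≈⟨ p (u ∷ vs) ⟩
      ω₁ (u ∷ vs) + (x u * ω₂ vs - (x ⋏ ι u ω₂) vs)
        ≈⟨ +-assoc _ _ _ ⟨
      (ω₁ (u ∷ vs) + x u * ω₂ vs) - (x ⋏ ι u ω₂) vs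
        ≈⟨ +-congˡ (Wedge.negate x (ι u ω₂) vs) ⟨
      (ω₁ (u ∷ vs) + x u * ω₂ vs) + (x ⋏ (λ us → - ω₂ (u ∷ us))) vs ∎

  generated-grade : ∀ xs {ω} → Generated xs ω → Generated xs (grade ω)
  generated-grade []       {ω} (lift g) = lift λ u vs →
    trans (-‿cong (Grade.vanish (g u) vs)) -0#≈0#
  generated-grade (x ∷ xs) (ω₁ , ω₂ , g₁ , g₂ , p) =
    grade ω₁ , (λ vs → - grade ω₂ vs) ,
    generated-grade xs g₁ , generated-neg xs (generated-grade xs g₂) , λ vs →
    trans (Grade.cong p vs) (trans (Grade.add ω₁ (x ⋏ ω₂) vs)
      (+-congˡ (trans (grade-⋏ x ω₂ vs) (sym (Wedge.negate x (grade ω₂) vs)))))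

  -- The one-form x reaches the last argument only after passing all of vs, at the cost of the sign
  -- recorded by `grade`. Fixing final arguments is required for the second bracket of a Plücker
  -- relation, where the fixed columns come last.
  ⋏-∷ʳ : ∀ x ω vs u →
    (x ⋏ ω) (vs ++ u ∷ []) ≈ x u * grade ω vs + (x ⋏ (λ us → ω (us ++ u ∷ []))) vs
  ⋏-∷ʳ x ω []       u = +-congˡ -0#≈0#
  ⋏-∷ʳ x ω (w ∷ vs) u = trans (+-congˡ (-‿cong (⋏-∷ʳ x (ι w ω) vs u)))
    (solve 4 (λ a b c d → a :- (b :* c :+ d) := b :* :- c :+ (a :- d)) refl _ (x u) _ _)

  generated-∷ʳ : ∀ xs {ω} u → Generated xs ω → Generated xs (λ vs → ω (vs ++ u ∷ []))
  generated-∷ʳ []       u (lift g) = lift λ w vs → g w (vs ++ u ∷ [])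
  generated-∷ʳ (x ∷ xs) u (ω₁ , ω₂ , g₁ , g₂ , p) =
    (λ vs → ω₁ (vs ++ u ∷ []) + x u * grade ω₂ vs) , (λ vs → ω₂ (vs ++ u ∷ [])) ,
    generated-+ xs (generated-∷ʳ xs u g₁) (generated-scale xs (x u) (generated-grade xs g₂)) ,
    generated-∷ʳ xs u g₂ , λ vs →
    trans (p (vs ++ u ∷ [])) (trans (+-congˡ (⋏-∷ʳ x ω₂ vs u)) (sym (+-assoc _ _ _)))

  generated-++ : ∀ xs {ω} us → Generated xs ω → Generated xs (λ vs → ω (us ++ vs))
  generated-++ xs []       g = g
  generated-++ xs (u ∷ us) g = generated-++ xs us (generated-ι xs u g)

  generated-++ʳ : ∀ xs {ω} us → Generated xs ω → Generated xs (λ vs → ω (vs ++ us))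
  generated-++ʳ xs {ω} []       g = generated-resp xs
    (λ vs → reflexive (≡.cong ω (≡.sym (List.++-identityʳ vs)))) g
  generated-++ʳ xs {ω} (u ∷ us) g = generated-resp xs
    (λ vs → reflexive (≡.cong ω (List.++-assoc vs (u ∷ []) us)))
    (generated-∷ʳ xs u (generated-++ʳ xs us g))

  -- Of the four products of summands, the one containing x twice is zero; in the two containing it
  -- once, `⋏-∧` and `∧-⋏` pull x to the front.
  generated-∧ : ∀ xs {ω η} → Generated xs ω → Generated xs η → Generated xs (ω ∧ η)
  generated-∧ [] {ω} {η} (lift g) (lift h) = lift λ u vs →
    trans (+-cong (Left.vanish η (g u) vs) (Right.vanish (grade ω) (h u) vs)) (+-identityʳ 0#)
  generated-∧ (x ∷ xs) {ω} {η} (ω₁ , ω₂ , g₁ , g₂ , p) (η₁ , η₂ , h₁ , h₂ , q) =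
    (ω₁ ∧ η₁) , (λ vs → (grade ω₁ ∧ η₂) vs + (ω₂ ∧ η₁) vs) ,
    generated-∧ xs g₁ h₁ ,
    generated-+ xs (generated-∧ xs (generated-grade xs g₁) h₂) (generated-∧ xs g₂ h₁) ,
    λ vs → begin
      (ω ∧ η) vs
        ≈⟨ ∧-cong p q vs ⟩
      ((λ us → ω₁ us + (x ⋏ ω₂) us) ∧ (λ us → η₁ us + (x ⋏ η₂) us)) vs
        ≈⟨ Left.add _ ω₁ (x ⋏ ω₂) vs ⟩
      (ω₁ ∧ (λ us → η₁ us + (x ⋏ η₂) us)) vs + ((x ⋏ ω₂) ∧ (λ us → η₁ us + (x ⋏ η₂) us)) vs
        ≈⟨ +-cong (Right.add ω₁ η₁ (x ⋏ η₂) vs) (Right.add (x ⋏ ω₂) η₁ (x ⋏ η₂) vs) ⟩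
      ((ω₁ ∧ η₁) vs + (ω₁ ∧ (x ⋏ η₂)) vs) +
        (((x ⋏ ω₂) ∧ η₁) vs + ((x ⋏ ω₂) ∧ (x ⋏ η₂)) vs)
        ≈⟨ +-cong (+-congˡ (∧-⋏ x ω₁ η₂ vs)) (+-cong (⋏-∧ x ω₂ η₁ vs) (square vs)) ⟩
      ((ω₁ ∧ η₁) vs + (x ⋏ (grade ω₁ ∧ η₂)) vs) + ((x ⋏ (ω₂ ∧ η₁)) vs + 0#)
        ≈⟨ +-congˡ (+-identityʳ _) ⟩
      ((ω₁ ∧ η₁) vs + (x ⋏ (grade ω₁ ∧ η₂)) vs) + (x ⋏ (ω₂ ∧ η₁)) vs
        ≈⟨ +-assoc _ _ _ ⟩
      (ω₁ ∧ η₁) vs + ((x ⋏ (grade ω₁ ∧ η₂)) vs + (x ⋏ (ω₂ ∧ η₁)) vs)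
        ≈⟨ +-congˡ (Wedge.add x (grade ω₁ ∧ η₂) (ω₂ ∧ η₁) vs) ⟨
      (ω₁ ∧ η₁) vs + (x ⋏ (λ us → (grade ω₁ ∧ η₂) us + (ω₂ ∧ η₁) us)) vs ∎
    where
    square : ∀ vs → ((x ⋏ ω₂) ∧ (x ⋏ η₂)) vs ≈ 0#
    square vs = trans (⋏-∧ x ω₂ (x ⋏ η₂) vs)
      (trans (Wedge.cong x (∧-⋏ x ω₂ η₂) vs) (⋏-⋏ x (grade ω₂ ∧ η₂) vs))

  ⋏-vanish : ∀ {n} x {ω} → (∀ vs → n < length vs → ω vs ≈ 0#) →
             ∀ vs → suc n < length vs → (x ⋏ ω) vs ≈ 0#
  ⋏-vanish x ω≈0 []       _ = refl
  ⋏-vanish {n} x {ω} ω≈0 (u ∷ vs) (ℕ.s≤s n<∣vs∣) = begin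
    x u * ω vs - (x ⋏ ι u ω) vs
      ≈⟨ +-cong (trans (*-congˡ (ω≈0 vs n<∣vs∣)) (zeroʳ (x u))) (-‿cong (rest n ω≈0 n<∣vs∣)) ⟩
    0# - 0# ≈⟨ -‿inverseʳ 0# ⟩
    0#      ∎
    where
    -- For n = 0 the form `ι u ω` already vanishes on all lists; otherwise it vanishes on those
    -- longer than n - 1, and the induction applies.
    rest : ∀ n → (∀ vs → n < length vs → ω vs ≈ 0#) → n < length vs → (x ⋏ ι u ω) vs ≈ 0#
    rest zero    z _ = Wedge.vanish x (λ us → z (u ∷ us) (ℕ.s≤s ℕ.z≤n)) vs
    rest (suc n) z p = ⋏-vanish x (λ us q → z (u ∷ us) (ℕ.s≤s q)) vs p

  -- In the normal form every generator occurs at most once, so degrees stop at the number of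
  -- generators.
  generated-vanish : ∀ xs {ω} → Generated xs ω →
                     ∀ vs → length xs < length vs → ω vs ≈ 0#
  generated-vanish []       (lift g) (u ∷ vs) _ = g u vs
  generated-vanish (x ∷ xs) (ω₁ , ω₂ , g₁ , g₂ , p) vs l =
    trans (p vs) (trans (+-cong
      (generated-vanish xs g₁ vs (ℕ.<-trans (ℕ.n<1+n _) l))
      (⋏-vanish x (generated-vanish xs g₂) vs l)) (+-identityʳ 0#))

  unit : Form
  unit []       = 1#
  unit (_ ∷ _)  = 0#

  det : List (V → Carrier) → Form
  det []       = unit
  det (x ∷ xs) = x ⋏ det xs

  det-generated : ∀ xs → Generated xs (det xs)
  det-generated []       = lift λ _ _ → refl
  det-generated (x ∷ xs) = (λ _ → 0#) , det xs , generated-0 xs , det-generated xs ,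
    λ vs → sym (+-identityˡ _)

  OfDegree : ℕ → Form → Set (ℓ ⊔ v)
  OfDegree t ω = ∀ vs → length vs ≢ t → ω vs ≈ 0#

  ⋏-ofDegree : ∀ {t} x {ω} → OfDegree t ω → OfDegree (suc t) (x ⋏ ω)
  ⋏-ofDegree x d []       _ = refl
  ⋏-ofDegree {t} x {ω} d (u ∷ vs) ≢t = trans
    (+-cong (trans (*-congˡ (d vs (≢t ∘ ≡.cong suc))) (zeroʳ (x u))) (-‿cong (rest t d ≢t)))
    (-‿inverseʳ 0#)
    where
    rest : ∀ t → OfDegree t ω → length (u ∷ vs) ≢ suc t → (x ⋏ ι u ω) vs ≈ 0#
    rest zero    d _ = Wedge.vanish x (λ us → d (u ∷ us) λ ()) vs
    rest (suc t) d q = ⋏-ofDegree x (λ us r → d (u ∷ us) (r ∘ ℕ.suc-injective)) vs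
      (q ∘ ≡.cong suc)

  det-ofDegree : ∀ xs → OfDegree (length xs) (det xs)
  det-ofDegree []       []       0≢0 = contradiction ≡.refl 0≢0
  det-ofDegree []       (_ ∷ _)  _   = refl
  det-ofDegree (x ∷ xs) = ⋏-ofDegree x (det-ofDegree xs)

  -- Both are kept because 2 may be a zero divisor, so that the first does not imply the second.
  -- Reordering columns uses the first, a repeated column the second.
  Antisymmetric Alternating : Form → Set (ℓ ⊔ v)
  Antisymmetric ω = ∀ us v w vs → ω (us ++ v ∷ w ∷ vs) ≈ - ω (us ++ w ∷ v ∷ vs)
  Alternating ω = ∀ us v vs → ω (us ++ v ∷ v ∷ vs) ≈ 0#

  ⋏-antisymmetric : ∀ x {ω} → Antisymmetric ω → Antisymmetric (x ⋏ ω)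
  ⋏-antisymmetric x {ω} a [] v w vs = begin
    x v * ω (w ∷ vs) - (x w * ω (v ∷ vs) - (x ⋏ ι w (ι v ω)) vs)
      ≈⟨ +-congˡ (-‿cong (+-congˡ (-‿cong
           (trans (Wedge.cong x (a [] v w) vs) (Wedge.negate x (ι v (ι w ω)) vs))))) ⟩
    x v * ω (w ∷ vs) - (x w * ω (v ∷ vs) - - (x ⋏ ι v (ι w ω)) vs)
      ≈⟨ solve 3 (λ p q r → p :- (q :- :- r) := :- (q :- (p :- r))) refl _ _ _ ⟩
    - (x w * ω (v ∷ vs) - (x v * ω (w ∷ vs) - (x ⋏ ι v (ι w ω)) vs)) ∎
  ⋏-antisymmetric x {ω} a (u ∷ us) v w vs = trans
    (+-cong (*-congˡ (a us v w vs)) (-‿cong (⋏-antisymmetric x (λ us′ → a (u ∷ us′)) us v w vs)))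
    (solve 3 (λ p q r → p :* :- q :- :- r := :- (p :* q :- r)) refl _ _ _)

  ⋏-alternating : ∀ x {ω} → Alternating ω → Alternating (x ⋏ ω)
  ⋏-alternating x {ω} a [] v vs = begin
    x v * ω (v ∷ vs) - (x v * ω (v ∷ vs) - (x ⋏ ι v (ι v ω)) vs)
      ≈⟨ solve 2 (λ p q → p :- (p :- q) := q) refl _ _ ⟩
    (x ⋏ ι v (ι v ω)) vs
      ≈⟨ Wedge.vanish x (a [] v) vs ⟩
    0# ∎
  ⋏-alternating x {ω} a (u ∷ us) v vs = trans
    (+-cong (trans (*-congˡ (a us v vs)) (zeroʳ (x u)))
      (-‿cong (⋏-alternating x (λ us′ → a (u ∷ us′)) us v vs)))
    (-‿inverseʳ 0#)

  det-antisymmetric : ∀ xs → Antisymmetric (det xs)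
  det-antisymmetric []       []       v w vs = sym -0#≈0#
  det-antisymmetric []       (_ ∷ _)  v w vs = sym -0#≈0#
  det-antisymmetric (x ∷ xs) = ⋏-antisymmetric x (det-antisymmetric xs)

  det-alternating : ∀ xs → Alternating (det xs)
  det-alternating []       []       v vs = refl
  det-alternating []       (_ ∷ _)  v vs = refl
  det-alternating (x ∷ xs) = ⋏-alternating x (det-alternating xs)

  -- The source of the Plücker relations: fixing some arguments of the determinant leaves a form in
  -- the algebra generated by its rows. The product of two such forms stays in that algebra, whose
  -- degrees are bounded by the number of rows.
  ∧-of-minors-vanish : ∀ xs us ws vs → length xs < length vs →
    ((λ cs → det xs (us ++ cs)) ∧ (λ cs → det xs (cs ++ ws))) vs ≈ 0#
  ∧-of-minors-vanish xs us ws = generated-vanish xs (generated-∧ xs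
    (generated-++ xs us (det-generated xs)) (generated-++ʳ xs ws (det-generated xs)))

-- The monoid algebra K[E]. Elements are identified when every function E → K,
-- extended linearly, agrees on them.
module MonoidAlgebra {c ℓ : Level} (K : CommutativeRing c ℓ)
  {E : Set} {_∙_ : E → E → E} {ε : E}
  (isCommutativeMonoid : IsCommutativeMonoid _≡_ _∙_ ε) where

  private
    module K = CommutativeRing K
    module E = IsCommutativeMonoid isCommutativeMonoid
  open RingProperties K.ring using (-‿distribˡ-*; -‿+-comm; -0#≈0#)
  open CommutativeSemigroupProperties K.+-commutativeSemigroup
    using () renaming (interchange to +-interchange)
  open CommutativeSemigroupProperties K.*-commutativeSemigroup using (x∙yz≈y∙xz)
  open import Relation.Binary.Reasoning.Setoid K.setoid

  Element : Set c
  Element = List (K.Carrier × E)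

  pair : Element → (E → K.Carrier) → K.Carrier
  pair []            χ = K.0#
  pair ((k , e) ∷ f) χ = k K.* χ e K.+ pair f χ

  infix 4 _≈_
  record _≈_ (f g : Element) : Set (c ⊔ ℓ) where
    constructor mk≈
    field at : ∀ χ → pair f χ K.≈ pair g χ

  open _≈_ public

  shift : K.Carrier → E → Element → Element
  shift k e = List.map (λ (k′ , e′) → k K.* k′ , (e ∙ e′))

  infixl 7 _*_

  _*_ : Element → Element → Element
  []            * g = []
  ((k , e) ∷ f) * g = shift k e g ++ f * g

  -_ : Element → Element
  -_ = List.map (λ (k , e) → K.- k , e)

  single : E → Element
  single e = (K.1# , e) ∷ []

  embed : K.Carrier → Element
  embed k = (k , ε) ∷ []

  pair-cong : ∀ f {χ ψ} → (∀ e → χ e K.≈ ψ e) → pair f χ K.≈ pair f ψ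
  pair-cong []            p = K.refl
  pair-cong ((k , e) ∷ f) p = K.+-cong (K.*-congˡ (p e)) (pair-cong f p)

  pair-++ : ∀ f g χ → pair (f ++ g) χ K.≈ pair f χ K.+ pair g χ
  pair-++ []            g χ = K.sym (K.+-identityˡ _)
  pair-++ ((k , e) ∷ f) g χ = K.trans (K.+-congˡ (pair-++ f g χ)) (K.sym (K.+-assoc _ _ _))

  pair-neg : ∀ f χ → pair (- f) χ K.≈ K.- pair f χ
  pair-neg []            χ = K.sym -0#≈0#
  pair-neg ((k , e) ∷ f) χ = K.trans
    (K.+-cong (K.sym (-‿distribˡ-* k (χ e))) (pair-neg f χ)) (-‿+-comm _ _)

  pair-0 : ∀ f → pair f (λ _ → K.0#) K.≈ K.0#
  pair-0 []            = K.refl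
  pair-0 ((k , e) ∷ f) = K.trans (K.+-cong (K.zeroʳ k) (pair-0 f)) (K.+-identityʳ K.0#)

  pair-+ : ∀ f χ ψ → pair f (λ e → χ e K.+ ψ e) K.≈ pair f χ K.+ pair f ψ
  pair-+ []            χ ψ = K.sym (K.+-identityʳ K.0#)
  pair-+ ((k , e) ∷ f) χ ψ = K.trans
    (K.+-cong (K.distribˡ k (χ e) (ψ e)) (pair-+ f χ ψ)) (+-interchange _ _ _ _)

  pair-scale : ∀ f k χ → pair f (λ e → k K.* χ e) K.≈ k K.* pair f χ
  pair-scale []             k χ = K.sym (K.zeroʳ k)
  pair-scale ((k′ , e) ∷ f) k χ = K.trans
    (K.+-cong (x∙yz≈y∙xz k′ k (χ e)) (pair-scale f k χ)) (K.sym (K.distribˡ k _ _))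

  pair-shift : ∀ k e g χ → pair (shift k e g) χ K.≈ k K.* pair g (λ e′ → χ (e ∙ e′))
  pair-shift k e []              χ = K.sym (K.zeroʳ k)
  pair-shift k e ((k′ , e′) ∷ g) χ = K.trans
    (K.+-cong (K.*-assoc k k′ _) (pair-shift k e g χ)) (K.sym (K.distribˡ k _ _))

  -- Convolution becomes an iterated pairing; the laws of multiplication then follow from those of E
  -- and from the exchange of pairings in `pair-swap`.
  pair-* : ∀ f g χ → pair (f * g) χ K.≈ pair f (λ e → pair g (λ e′ → χ (e ∙ e′)))
  pair-* []            g χ = K.refl
  pair-* ((k , e) ∷ f) g χ = K.trans (pair-++ (shift k e g) (f * g) χ)
    (K.+-cong (pair-shift k e g χ) (pair-* f g χ))

  pair-swap : ∀ f g (χ : E → E → K.Carrier) →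
    pair f (λ e → pair g (χ e)) K.≈ pair g (λ e′ → pair f (λ e → χ e e′))
  pair-swap []            g χ = K.sym (pair-0 g)
  pair-swap ((k , e) ∷ f) g χ = begin
    k K.* pair g (χ e) K.+ pair f (λ e → pair g (χ e))
      ≈⟨ K.+-cong (K.sym (pair-scale g k (χ e))) (pair-swap f g χ) ⟩
    pair g (λ e′ → k K.* χ e e′) K.+ pair g (λ e′ → pair f (λ e → χ e e′))
      ≈⟨ pair-+ g _ _ ⟨
    pair g (λ e′ → k K.* χ e e′ K.+ pair f (λ e → χ e e′)) ∎

  pair-single : ∀ e χ → pair (single e) χ K.≈ χ e
  pair-single e χ = K.trans (K.+-identityʳ _) (K.*-identityˡ (χ e))

  pair-embed-* : ∀ k f χ → pair (embed k * f) χ K.≈ k K.* pair f χ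
  pair-embed-* k f χ = K.trans (pair-* (embed k) f χ) (K.trans (K.+-identityʳ _)
    (K.*-congˡ (pair-cong f λ e → K.reflexive (≡.cong χ (E.identityˡ e)))))

  *-comm : ∀ f g → f * g ≈ g * f
  *-comm f g = mk≈ λ χ → begin
    pair (f * g) χ                              ≈⟨ pair-* f g χ ⟩
    pair f (λ e → pair g (λ e′ → χ (e ∙ e′)))   ≈⟨ pair-swap f g (λ e e′ → χ (e ∙ e′)) ⟩
    pair g (λ e′ → pair f (λ e → χ (e ∙ e′)))
      ≈⟨ pair-cong g (λ e′ → pair-cong f λ e → K.reflexive (≡.cong χ (E.comm e e′))) ⟩
    pair g (λ e′ → pair f (λ e → χ (e′ ∙ e)))   ≈⟨ pair-* g f χ ⟨
    pair (g * f) χ                              ∎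

  *-assoc : ∀ f g h → (f * g) * h ≈ f * (g * h)
  *-assoc f g h = mk≈ λ χ → begin
    pair ((f * g) * h) χ
      ≈⟨ pair-* (f * g) h χ ⟩
    pair (f * g) (λ e → pair h (λ e″ → χ (e ∙ e″)))
      ≈⟨ pair-* f g _ ⟩
    pair f (λ e → pair g (λ e′ → pair h (λ e″ → χ ((e ∙ e′) ∙ e″))))
      ≈⟨ pair-cong f (λ e → pair-cong g λ e′ → pair-cong h λ e″ →
           K.reflexive (≡.cong χ (E.assoc e e′ e″))) ⟩
    pair f (λ e → pair g (λ e′ → pair h (λ e″ → χ (e ∙ (e′ ∙ e″)))))
      ≈⟨ pair-cong f (λ e → pair-* g h (λ e′ → χ (e ∙ e′))) ⟨
    pair f (λ e → pair (g * h) (λ e′ → χ (e ∙ e′)))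
      ≈⟨ pair-* f (g * h) χ ⟨
    pair (f * (g * h)) χ ∎

  *-cong : ∀ {f f′ g g′} → f ≈ f′ → g ≈ g′ → f * g ≈ f′ * g′
  *-cong {f} {f′} {g} {g′} (mk≈ p) (mk≈ q) = mk≈ λ χ → begin
    pair (f * g) χ                               ≈⟨ pair-* f g χ ⟩
    pair f (λ e → pair g (λ e′ → χ (e ∙ e′)))    ≈⟨ p _ ⟩
    pair f′ (λ e → pair g (λ e′ → χ (e ∙ e′)))   ≈⟨ pair-cong f′ (λ e → q _) ⟩
    pair f′ (λ e → pair g′ (λ e′ → χ (e ∙ e′)))  ≈⟨ pair-* f′ g′ χ ⟨
    pair (f′ * g′) χ                             ∎

  ++-cong : ∀ {f f′ g g′} → f ≈ f′ → g ≈ g′ → f ++ g ≈ f′ ++ g′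
  ++-cong {f} {f′} {g} {g′} (mk≈ p) (mk≈ q) = mk≈ λ χ →
    K.trans (pair-++ f g χ) (K.trans (K.+-cong (p χ) (q χ)) (K.sym (pair-++ f′ g′ χ)))

  ++-comm : ∀ f g → f ++ g ≈ g ++ f
  ++-comm f g = mk≈ λ χ →
    K.trans (pair-++ f g χ) (K.trans (K.+-comm _ _) (K.sym (pair-++ g f χ)))

  ++-assoc : ∀ f g h → (f ++ g) ++ h ≈ f ++ (g ++ h)
  ++-assoc []      g h = mk≈ λ χ → K.refl
  ++-assoc (t ∷ f) g h = mk≈ λ χ → K.+-congˡ (at (++-assoc f g h) χ)

  -‿cong : ∀ {f g} → f ≈ g → - f ≈ - g
  -‿cong {f} {g} (mk≈ p) = mk≈ λ χ →
    K.trans (pair-neg f χ) (K.trans (K.-‿cong (p χ)) (K.sym (pair-neg g χ)))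

  -‿inverseˡ : ∀ f → - f ++ f ≈ []
  -‿inverseˡ f = mk≈ λ χ → K.trans (pair-++ (- f) f χ)
    (K.trans (K.+-congʳ (pair-neg f χ)) (K.-‿inverseˡ _))

  *-identityˡ : ∀ f → embed K.1# * f ≈ f
  *-identityˡ f = mk≈ λ χ → K.trans (pair-embed-* K.1# f χ) (K.*-identityˡ _)

  *-distribˡ : ∀ f g h → f * (g ++ h) ≈ f * g ++ f * h
  *-distribˡ f g h = mk≈ λ χ → begin
    pair (f * (g ++ h)) χ
      ≈⟨ pair-* f (g ++ h) χ ⟩
    pair f (λ e → pair (g ++ h) (λ e′ → χ (e ∙ e′)))
      ≈⟨ pair-cong f (λ e → pair-++ g h _) ⟩
    pair f (λ e → pair g (λ e′ → χ (e ∙ e′)) K.+ pair h (λ e′ → χ (e ∙ e′)))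
      ≈⟨ pair-+ f _ _ ⟩
    pair f (λ e → pair g (λ e′ → χ (e ∙ e′))) K.+ pair f (λ e → pair h (λ e′ → χ (e ∙ e′)))
      ≈⟨ K.+-cong (pair-* f g χ) (pair-* f h χ) ⟨
    pair (f * g) χ K.+ pair (f * h) χ
      ≈⟨ pair-++ (f * g) (f * h) χ ⟨
    pair (f * g ++ f * h) χ ∎

  private
    ≈-trans : ∀ {f g h} → f ≈ g → g ≈ h → f ≈ h
    ≈-trans (mk≈ p) (mk≈ q) = mk≈ λ χ → K.trans (p χ) (q χ)

  opaque

    isCommutativeRing : IsCommutativeRing _≈_ _++_ _*_ -_ [] (embed K.1#)
    isCommutativeRing = record
      { isRing = record
        { +-isAbelianGroup = record
          { isGroup = record
            { isMonoid = record
              { isSemigroup = record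
                { isMagma = record
                  { isEquivalence = record
                    { refl = mk≈ λ χ → K.refl
                    ; sym = λ (mk≈ p) → mk≈ λ χ → K.sym (p χ)
                    ; trans = ≈-trans }
                  ; ∙-cong = ++-cong }
                ; assoc = ++-assoc }
              ; identity = (λ f → mk≈ λ χ → K.refl) , λ f → ≈-trans (++-comm f []) (mk≈ λ χ → K.refl) }
            ; inverse = -‿inverseˡ , λ f → ≈-trans (++-comm f (- f)) (-‿inverseˡ f)
            ; ⁻¹-cong = -‿cong }
          ; comm = ++-comm }
        ; *-cong = *-cong
        ; *-assoc = *-assoc
        ; *-identity = *-identityˡ , λ f → ≈-trans (*-comm f _) (*-identityˡ f)
        ; distrib = *-distribˡ , λ f g h → ≈-trans (*-comm _ f)
            (≈-trans (*-distribˡ f g h) (++-cong (*-comm f g) (*-comm f h)))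
        }
      ; *-comm = *-comm
      }

  commutativeRing : CommutativeRing c (c ⊔ ℓ)
  commutativeRing = record { isCommutativeRing = isCommutativeRing }

  embed-cong : ∀ {k l} → k K.≈ l → embed k ≈ embed l
  embed-cong p = mk≈ λ χ → K.+-congʳ (K.*-congʳ p)

  embed-+ : ∀ k l → embed (k K.+ l) ≈ embed k ++ embed l
  embed-+ k l = mk≈ λ χ → begin
    (k K.+ l) K.* χ ε K.+ K.0#                ≈⟨ K.+-congʳ (K.distribʳ (χ ε) k l) ⟩
    (k K.* χ ε K.+ l K.* χ ε) K.+ K.0#        ≈⟨ K.+-assoc _ _ _ ⟩
    k K.* χ ε K.+ (l K.* χ ε K.+ K.0#)        ∎

  embed-* : ∀ k l → embed (k K.* l) ≈ embed k * embed l
  embed-* k l = mk≈ λ χ → begin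
    k K.* l K.* χ ε K.+ K.0#          ≈⟨ K.+-congʳ (K.*-assoc k l (χ ε)) ⟩
    k K.* (l K.* χ ε) K.+ K.0#        ≈⟨ K.+-congʳ (K.*-congˡ (K.+-identityʳ _)) ⟨
    k K.* (l K.* χ ε K.+ K.0#) K.+ K.0# ≈⟨ K.+-identityʳ _ ⟩
    k K.* (l K.* χ ε K.+ K.0#)        ≈⟨ pair-embed-* k (embed l) χ ⟨
    pair (embed k * embed l) χ        ∎

  embed-0 : embed K.0# ≈ []
  embed-0 = mk≈ λ χ → K.trans (K.+-identityʳ _) (K.zeroˡ _)

  -- Leading exponents with respect to a weight

  module Leading (wt : E → ℕ) (wt-∙ : ∀ e e′ → wt (e ∙ e′) ≡ wt e ℕ.+ wt e′) where

    -- In f the terms of weight at least w cancel. Cancellation cannot be seen on the list of terms,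
    -- so it is expressed by the functionals that ignore all smaller weights.
    record Below (w : ℕ) (f : Element) : Set (c ⊔ ℓ) where
      constructor below
      field vanish : ∀ χ → (∀ e → wt e < w → χ e K.≈ K.0#) → pair f χ K.≈ K.0#

    -- f = e + terms of smaller weight.
    record Leads (e : E) (f : Element) : Set (c ⊔ ℓ) where
      constructor leads
      field value : ∀ χ → (∀ e′ → wt e′ < wt e → χ e′ K.≈ K.0#) → pair f χ K.≈ χ e

    below-[] : ∀ {w} → Below w []
    below-[] = below λ χ p → K.refl

    below-++ : ∀ {w f g} → Below w f → Below w g → Below w (f ++ g)
    below-++ {f = f} {g} (below b) (below b′) = below λ χ p → K.trans (pair-++ f g χ)
      (K.trans (K.+-cong (b χ p) (b′ χ p)) (K.+-identityʳ K.0#))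

    below-neg : ∀ {w f} → Below w f → Below w (- f)
    below-neg {f = f} (below b) = below λ χ p →
      K.trans (pair-neg f χ) (K.trans (K.-‿cong (b χ p)) -0#≈0#)

    below-mono : ∀ {w w′ f} → w ≤ w′ → Below w f → Below w′ f
    below-mono w≤w′ (below b) = below λ χ p → b χ λ e lt → p e (ℕ.<-≤-trans lt w≤w′)

    leads-below : ∀ {e f w} → Leads e f → wt e < w → Below w f
    leads-below {e} (leads l) wte<w = below λ χ p →
      K.trans (l χ λ e′ lt → p e′ (ℕ.<-trans lt wte<w)) (p e wte<w)

    below-single-* : ∀ {w} e {f} → Below w f → Below (wt e ℕ.+ w) (single e * f)
    below-single-* {w} e {f} (below b) = below λ χ p → K.trans (pair-* (single e) f χ)
      (K.trans (pair-single e (λ a → pair f (λ b → χ (a ∙ b)))) (b (λ b → χ (e ∙ b)) λ e′ lt →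
        p (e ∙ e′) (≡.subst (ℕ._< wt e ℕ.+ w) (≡.sym (wt-∙ e e′)) (ℕ.+-monoʳ-< (wt e) lt))))

    leads-single : ∀ e → Leads e (single e)
    leads-single e = leads λ χ p → pair-single e χ

    -- The exponents a of f are fixed first: for wt a ≤ wt e the function b ↦ χ (a ∙ b) vanishes
    -- below wt e′, so pairing it with g evaluates it at e′. The resulting function of a vanishes
    -- below wt e, so pairing it with f evaluates it at e.
    leads-* : ∀ {e e′ f g} → Leads e f → Leads e′ g → Leads (e ∙ e′) (f * g)
    leads-* {e} {e′} {f} {g} (leads l) (leads l′) = leads λ χ p → let
        g-part : ∀ a → wt a ≤ wt e → pair g (λ b → χ (a ∙ b)) K.≈ χ (a ∙ e′)
        g-part a le = l′ (λ b → χ (a ∙ b)) λ b lt → p (a ∙ b) (smaller a b (ℕ.+-mono-≤-< le lt))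
      in K.trans (pair-* f g χ) (K.trans
        (l (λ a → pair g (λ b → χ (a ∙ b))) λ a lt → K.trans (g-part a (ℕ.<⇒≤ lt))
          (p (a ∙ e′) (smaller a e′ (ℕ.+-monoˡ-< (wt e′) lt))))
        (g-part e ℕ.≤-refl))
      where
      smaller : ∀ a b → wt a ℕ.+ wt b < wt e ℕ.+ wt e′ → wt (a ∙ b) < wt (e ∙ e′)
      smaller a b = ≡.subst₂ ℕ._<_ (≡.sym (wt-∙ a b)) (≡.sym (wt-∙ e e′))

    leads-minus : ∀ {e f g} → Leads e f → Below (wt e) g → Leads e (f ++ - g)
    leads-minus {f = f} {g} (leads l) b = leads λ χ p → K.trans (pair-++ f (- g) χ)
      (K.trans (K.+-cong (l χ p) (Below.vanish (below-neg b) χ p)) (K.+-identityʳ _))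

-- Exponents of monomials in the matrix entries, and their weight

-- The exponent of a monomial in variables x k v: row k counts, for every u, the
-- factors x k v with u ≤ v.
Exponent : ℕ → ℕ → Set
Exponent m N = Vec (Vec ℕ N) m

module _ {m N : ℕ} where

  infixl 6 _⊕_
  _⊕_ : Exponent m N → Exponent m N → Exponent m N
  _⊕_ = Vec.zipWith (Vec.zipWith ℕ._+_)

  ∅ : Exponent m N
  ∅ = Vec.replicate m (Vec.replicate N 0)

  opaque

    ⊕-isCommutativeMonoid : IsCommutativeMonoid _≡_ _⊕_ ∅
    ⊕-isCommutativeMonoid = record
      { isMonoid = record
        { isSemigroup = record
          { isMagma = ≡.isMagma _⊕_
          ; assoc = Vec.zipWith-assoc (Vec.zipWith-assoc ℕ.+-assoc) }
        ; identity = Vec.zipWith-identityˡ (Vec.zipWith-identityˡ ℕ.+-identityˡ)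
                   , Vec.zipWith-identityʳ (Vec.zipWith-identityʳ ℕ.+-identityʳ) }
      ; comm = Vec.zipWith-comm (Vec.zipWith-comm ℕ.+-comm) }

-- The cumulative form has two benefits: the sum of the entries is v + 1, which makes the weight
-- additive, and a row of `rowContent` becomes the counting function `countAbove`, by which sorted
-- rows are compared.
indicator : ∀ {N} → Fin N → Vec ℕ N
indicator {suc N} zero    = 1 ∷ Vec.replicate N 0
indicator {suc N} (suc v) = 1 ∷ indicator v

sum-replicate-0 : ∀ N → Vec.sum (Vec.replicate N 0) ≡ 0
sum-replicate-0 zero    = ≡.refl
sum-replicate-0 (suc N) = sum-replicate-0 N

sum-indicator : ∀ {N} (v : Fin N) → Vec.sum (indicator v) ≡ suc (toℕ v)
sum-indicator {suc N} zero    = ≡.cong suc (sum-replicate-0 N)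
sum-indicator {suc N} (suc v) = ≡.cong suc (sum-indicator v)

sum-zipWith-+ : ∀ {N} (xs ys : Vec ℕ N) →
  Vec.sum (Vec.zipWith ℕ._+_ xs ys) ≡ Vec.sum xs ℕ.+ Vec.sum ys
sum-zipWith-+ []       []       = ≡.refl
sum-zipWith-+ (x ∷ xs) (y ∷ ys) = ≡.trans (≡.cong (x ℕ.+ y ℕ.+_) (sum-zipWith-+ xs ys))
  (solve 4 (λ x y a b → (x :+ y) :+ (a :+ b) := (x :+ a) :+ (y :+ b)) ≡.refl x y _ _)
  where open ℕ-Solver.+-*-Solver

weight : ∀ {m N} → ℕ → Exponent m N → ℕ
weight k []      = 0
weight k (r ∷ e) = k ℕ.* Vec.sum r ℕ.+ weight (suc k) e

weight-⊕ : ∀ {m N} k (e e′ : Exponent m N) → weight k (e ⊕ e′) ≡ weight k e ℕ.+ weight k e′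
weight-⊕ k []      []        = ≡.refl
weight-⊕ k (r ∷ e) (r′ ∷ e′) = ≡.trans
  (≡.cong₂ (λ a b → k ℕ.* a ℕ.+ b) (sum-zipWith-+ r r′) (weight-⊕ (suc k) e e′))
  (solve 5 (λ k x y a b → k :* (x :+ y) :+ (a :+ b) := (k :* x :+ a) :+ (k :* y :+ b)) ≡.refl k _ _ _ _)
  where open ℕ-Solver.+-*-Solver

weight-∅ : ∀ m N k → weight k (∅ {m} {N}) ≡ 0
weight-∅ zero    N k = ≡.refl
weight-∅ (suc m) N k = ≡.cong₂ ℕ._+_
  (≡.trans (≡.cong (k ℕ.*_) (sum-replicate-0 N)) (ℕ.*-zeroʳ k)) (weight-∅ m N (suc k))

-- The generic matrix, row by row: the k-th function sends a column v to the exponent of the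
-- variable x k v.
unitExponents : ∀ m {N} → List (Fin N → Exponent m N)
unitExponents zero    = []
unitExponents (suc m) {N} = (λ v → indicator v ∷ ∅) ∷
  List.map (λ x v → Vec.replicate N 0 ∷ x v) (unitExponents m)

length-unitExponents : ∀ m {N} → length (unitExponents m {N}) ≡ m
length-unitExponents zero    = ≡.refl
length-unitExponents (suc m) =
  ≡.cong suc (≡.trans (List.length-map _ (unitExponents m)) (length-unitExponents m))

module _ {E : Set} {N : ℕ} (_∙_ : E → E → E) (ε : E) where

  diagonal : List (Fin N → E) → List (Fin N) → E
  diagonal (x ∷ xs) (v ∷ vs) = x v ∙ diagonal xs vs
  diagonal _        _        = ε

diagonal-map : ∀ {m N} (xs : List (Fin N → Exponent m N)) vs →
  diagonal _⊕_ ∅ (List.map (λ x v → Vec.replicate N 0 ∷ x v) xs) vs ≡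
  Vec.replicate N 0 ∷ diagonal _⊕_ ∅ xs vs
diagonal-map []       vs       = ≡.refl
diagonal-map (x ∷ xs) []       = ≡.refl
diagonal-map (x ∷ xs) (v ∷ vs) = ≡.trans
  (≡.cong ((_ ∷ x v) ⊕_) (diagonal-map xs vs))
  (≡.cong (_∷ (x v ⊕ diagonal _⊕_ ∅ xs vs)) (Vec.zipWith-identityˡ ℕ.+-identityˡ _))

diagonal-unitExponents : ∀ {m N} (vs : Vec (Fin N) m) →
  diagonal _⊕_ ∅ (unitExponents m) (toList vs) ≡ Vec.map indicator vs
diagonal-unitExponents []       = ≡.refl
diagonal-unitExponents {suc m} {N} (v ∷ vs) = ≡.trans
  (≡.cong ((indicator v ∷ ∅) ⊕_)
    (≡.trans (diagonal-map (unitExponents m) (toList vs)) (≡.cong (_ ∷_) (diagonal-unitExponents vs))))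
  (≡.cong₂ _∷_ (Vec.zipWith-identityʳ ℕ.+-identityʳ (indicator v))
    (Vec.zipWith-identityˡ (Vec.zipWith-identityˡ ℕ.+-identityˡ) (Vec.map indicator vs)))

data Graded {E : Set} {N : ℕ} (wt : E → ℕ) : ℕ → List (Fin N → E) → Set where
  []  : ∀ {k} → Graded wt k []
  _∷_ : ∀ {k x xs} → (∀ v → wt (x v) ≡ k ℕ.* suc (toℕ v)) →
        Graded wt (suc k) xs → Graded wt k (x ∷ xs)

graded-map : ∀ {m N k} {xs : List (Fin N → Exponent m N)} j →
  Graded (weight (suc j)) k xs →
  Graded (weight j) k (List.map (λ x v → Vec.replicate N 0 ∷ x v) xs)
graded-map j [] = []
graded-map {N = N} {xs = x ∷ xs} j (g ∷ gs) = (λ v → ≡.trans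
  (≡.cong (ℕ._+ weight (suc j) (x v))
    (≡.trans (≡.cong (j ℕ.*_) (sum-replicate-0 N)) (ℕ.*-zeroʳ j))) (g v)) ∷ graded-map j gs

unitExponents-graded : ∀ m {N} k → Graded (weight k) k (unitExponents m {N})
unitExponents-graded zero    k = []
unitExponents-graded (suc m) {N} k =
  (λ v → ≡.trans (≡.cong₂ (λ a b → k ℕ.* a ℕ.+ b) (sum-indicator v) (weight-∅ m N (suc k)))
    (ℕ.+-identityʳ _)) ∷ graded-map k (unitExponents-graded m (suc k))

-- The diagonal term of a minor has the largest weight

module _ {N : ℕ} where

  Increasing : List (Fin N) → Set
  Increasing = ListPairs.AllPairs Fin._<_

  diagonalWeight : ℕ → List (Fin N) → ℕ
  diagonalWeight k []       = 0
  diagonalWeight k (v ∷ vs) = k ℕ.* suc (toℕ v) ℕ.+ diagonalWeight (suc k) vs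

  increasing-remove : ∀ us {y ws} → Increasing (us ++ y ∷ ws) → Increasing (us ++ ws)
  increasing-remove []       (_ ∷ inc) = inc
  increasing-remove (u ∷ us) (u< ∷ inc) =
    ListAll.++⁺ (ListAll.++⁻ˡ us u<) (ListAll.tail (ListAll.++⁻ʳ us u<)) ∷ increasing-remove us inc

  mutual

    early-row-≤ : ∀ k us {y ws} → Increasing (us ++ y ∷ ws) →
      k ℕ.* suc (toℕ y) ℕ.+ diagonalWeight (suc k) (us ++ ws) ≤ diagonalWeight k (us ++ y ∷ ws)
    early-row-≤ k []       inc = ℕ.≤-refl
    early-row-≤ k (u ∷ us) inc = ℕ.<⇒≤ (early-row-< k u us inc)

    -- Moving y from its own row up to row k costs weight, since the smaller
    -- entries before it each descend by one row.
    early-row-< : ∀ k u us {y ws} → Increasing (u ∷ us ++ y ∷ ws) →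
      k ℕ.* suc (toℕ y) ℕ.+ diagonalWeight (suc k) (u ∷ us ++ ws) ℕ.<
      diagonalWeight k (u ∷ us ++ y ∷ ws)
    early-row-< k u us {y} {ws} (u< ∷ inc) = begin-strict
      k ℕ.* Y ℕ.+ (suc k ℕ.* U ℕ.+ d)
        ≡⟨ solve 4 (λ k y u d → k :* y :+ ((u :+ k :* u) :+ d) := u :+ (k :* u :+ k :* y :+ d)) ≡.refl k Y U d ⟩
      U ℕ.+ (k ℕ.* U ℕ.+ k ℕ.* Y ℕ.+ d)
        <⟨ ℕ.+-monoˡ-< _ (ℕ.s≤s (ListAll.head (ListAll.++⁻ʳ us u<))) ⟩
      Y ℕ.+ (k ℕ.* U ℕ.+ k ℕ.* Y ℕ.+ d)
        ≡⟨ solve 4 (λ k y u d → y :+ (k :* u :+ k :* y :+ d) := k :* u :+ ((y :+ k :* y) :+ d)) ≡.refl k Y U d ⟩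
      k ℕ.* U ℕ.+ (suc k ℕ.* Y ℕ.+ d)
        ≤⟨ ℕ.+-monoʳ-≤ (k ℕ.* U) (early-row-≤ (suc k) us inc) ⟩
      k ℕ.* U ℕ.+ diagonalWeight (suc k) (us ++ y ∷ ws) ∎
      where
      open ℕ.≤-Reasoning
      open ℕ-Solver.+-*-Solver
      Y = suc (toℕ y)
      U = suc (toℕ u)
      d = diagonalWeight (suc (suc k)) (us ++ ws)

module LeadingMinors {c ℓ : Level} (K : CommutativeRing c ℓ) {N : ℕ}
  {E : Set} {_∙_ : E → E → E} {ε : E} (isCommutativeMonoid : IsCommutativeMonoid _≡_ _∙_ ε)
  (wt : E → ℕ) (wt-∙ : ∀ e e′ → wt (e ∙ e′) ≡ wt e ℕ.+ wt e′) (wt-ε : wt ε ≡ 0) where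

  open MonoidAlgebra K isCommutativeMonoid
  open Leading wt wt-∙
  open Forms commutativeRing (Fin N)
  private module S = CommutativeRing commutativeRing

  minor : List (Fin N → E) → Form
  minor xs = det (List.map (single ∘_) xs)

  -- Expansion along the first row: y is the column used there and `us ++ ws` are the remaining
  -- ones, so each term can be bounded on its own.
  below-⋏ : ∀ {w} x {ω} vs →
    (∀ us y ws → vs ≡ us ++ y ∷ ws → Below w (x y * ω (us ++ ws))) → Below w ((x ⋏ ω) vs)
  below-⋏ x {ω} []       b = below-[]
  below-⋏ x {ω} (v ∷ vs) b = below-++ (b [] v vs ≡.refl)
    (below-neg (below-⋏ x vs λ us y ws eq → b (v ∷ us) y ws (≡.cong (v ∷_) eq)))

  wt-diagonal : ∀ {k xs} (vs : List (Fin N)) → Graded wt k xs → length vs ≡ length xs →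
    wt (diagonal _∙_ ε xs vs) ≡ diagonalWeight k vs
  wt-diagonal []       []       eq = wt-ε
  wt-diagonal {k} {x ∷ xs} (v ∷ vs) (g ∷ gs) eq = ≡.trans (wt-∙ (x v) (diagonal _∙_ ε xs vs))
    (≡.cong₂ ℕ._+_ (g v) (wt-diagonal vs gs (ℕ.suc-injective eq)))

  -- Expansion along the first row. The term of v leads by induction on the remaining minor. In the
  -- term of a later column y the remaining minor is led by its own diagonal, over `v ∷ us ++ ws`,
  -- and `early-row-<` shows that the total weight falls short of the full diagonal.
  minor-leads : ∀ {k xs} vs → Graded wt k xs → length vs ≡ length xs → Increasing vs →
    Leads (diagonal _∙_ ε xs vs) (minor xs vs)
  minor-leads []       []       eq inc = leads-single ε
  minor-leads {k} {x ∷ xs} (v ∷ vs) (g ∷ gs) eq (v< ∷ inc) = leads-minus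
    (leads-* (leads-single (x v)) (minor-leads vs gs (ℕ.suc-injective eq) inc))
    (below-⋏ (single ∘ x) vs λ us y ws vs≡ → below-mono (bound us y ws vs≡)
      (below-single-* (x y) (leads-below
        (minor-leads (v ∷ us ++ ws) gs (len us vs≡) (inc′ us vs≡))
        (ℕ.≤-reflexive (≡.cong suc (wt-diagonal (v ∷ us ++ ws) gs (len us vs≡)))))))
    where
    len : ∀ us {y ws} → vs ≡ us ++ y ∷ ws → length (v ∷ us ++ ws) ≡ length xs
    len us {y} {ws} ≡.refl = ≡.trans (≡.cong suc (List.length-++ us))
      (≡.trans (≡.sym (ℕ.+-suc (length us) (length ws)))
        (≡.trans (≡.sym (List.length-++ us)) (ℕ.suc-injective eq)))
    inc′ : ∀ us {y ws} → vs ≡ us ++ y ∷ ws → Increasing (v ∷ us ++ ws)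
    inc′ us ≡.refl = increasing-remove (v ∷ us) (v< ∷ inc)
    bound : ∀ us y ws → vs ≡ us ++ y ∷ ws →
      wt (x y) ℕ.+ suc (diagonalWeight (suc k) (v ∷ us ++ ws)) ≤ wt (x v ∙ diagonal _∙_ ε xs vs)
    bound us y ws ≡.refl = begin
      wt (x y) ℕ.+ suc (diagonalWeight (suc k) (v ∷ us ++ ws))
        ≡⟨ ℕ.+-suc (wt (x y)) _ ⟩
      suc (wt (x y) ℕ.+ diagonalWeight (suc k) (v ∷ us ++ ws))
        ≡⟨ ≡.cong (λ a → suc (a ℕ.+ diagonalWeight (suc k) (v ∷ us ++ ws))) (g y) ⟩
      suc (k ℕ.* suc (toℕ y) ℕ.+ diagonalWeight (suc k) (v ∷ us ++ ws))
        ≤⟨ early-row-< k v us (v< ∷ inc) ⟩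
      diagonalWeight k (v ∷ us ++ y ∷ ws)
        ≡⟨ wt-diagonal (v ∷ us ++ y ∷ ws) (g ∷ gs) eq ⟨
      wt (x v ∙ diagonal _∙_ ε xs vs) ∎
      where open ℕ.≤-Reasoning

-- Sorting sequences of columns

module _ {N : ℕ} where

  insert-all : ∀ {k p} {P : Pred (Fin N) p} {u} {vs : Vec (Fin N) k} →
               P u → All P vs → All P (insert u vs)
  insert-all pu [] = pu ∷ []
  insert-all {u = u} pu (_∷_ {x = v} pv ps) with u Fin.≤? v
  ... | yes _ = pu ∷ pv ∷ ps
  ... | no  _ = pv ∷ insert-all pu ps

  WeaklyIncreasing : ∀ {k} → Vec (Fin N) k → Set
  WeaklyIncreasing = AllPairs Fin._≤_

  insert-weaklyIncreasing : ∀ {k} u {vs : Vec (Fin N) k} →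
                            WeaklyIncreasing vs → WeaklyIncreasing (insert u vs)
  insert-weaklyIncreasing u [] = [] ∷ []
  insert-weaklyIncreasing u (_∷_ {x = v} v≤ inc) with u Fin.≤? v
  ... | yes u≤v = (u≤v ∷ All.map (ℕ.≤-trans u≤v) v≤) ∷ v≤ ∷ inc
  ... | no  u≰v = insert-all (ℕ.<⇒≤ (ℕ.≰⇒> u≰v)) v≤ ∷ insert-weaklyIncreasing u inc

  sort-weaklyIncreasing : ∀ {k} (vs : Vec (Fin N) k) → WeaklyIncreasing (sort vs)
  sort-weaklyIncreasing []       = []
  sort-weaklyIncreasing (v ∷ vs) = insert-weaklyIncreasing v (sort-weaklyIncreasing vs)

  sort-increasing : ∀ {k} {vs : Vec (Fin N) k} → AllPairs Fin._<_ vs → sort vs ≡ vs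
  sort-increasing [] = ≡.refl
  sort-increasing {vs = v ∷ vs} (v< ∷ inc) =
    ≡.trans (≡.cong (insert v) (sort-increasing inc)) (insert-least v<)
    where
    insert-least : ∀ {k} {vs : Vec (Fin N) k} → All (v Fin.<_) vs → insert v vs ≡ v ∷ vs
    insert-least [] = ≡.refl
    insert-least (_∷_ {x = w} v<w _) with v Fin.≤? w
    ... | yes _   = ≡.refl
    ... | no  v≰w = contradiction (ℕ.<⇒≤ v<w) v≰w

  private
    count< : ∀ {k} → Fin N → Vec (Fin N) k → ℕ
    count< u = Vec.count (Fin._<? u)

  count-yes : ∀ {k u v} (vs : Vec (Fin N) k) → v Fin.< u → count< u (v ∷ vs) ≡ suc (count< u vs)
  count-yes {u = u} {v} vs v<u =
    ≡.cong (λ b → (if b then suc else id) (count< u vs)) (dec-true (v Fin.<? u) v<u)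

  count-no : ∀ {k u v} (vs : Vec (Fin N) k) → ¬ v Fin.< u → count< u (v ∷ vs) ≡ count< u vs
  count-no {u = u} {v} vs v≮u =
    ≡.cong (λ b → (if b then suc else id) (count< u vs)) (dec-false (v Fin.<? u) v≮u)

  count-none : ∀ {k u} {vs : Vec (Fin N) k} → All (u Fin.≤_) vs → count< u vs ≡ 0
  count-none []                           = ≡.refl
  count-none {vs = _ ∷ vs} (u≤v ∷ u≤) = ≡.trans (count-no vs (ℕ.≤⇒≯ u≤v)) (count-none u≤)

  count-cons : ∀ {k} u v (vs ws : Vec (Fin N) k) →
    count< u vs ≡ count< u ws → count< u (v ∷ vs) ≡ count< u (v ∷ ws)
  count-cons u v vs ws = ≡.cong (if does (v Fin.<? u) then suc else id)

  count-swap : ∀ {k} u v w (vs : Vec (Fin N) k) →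
               count< u (v ∷ w ∷ vs) ≡ count< u (w ∷ v ∷ vs)
  count-swap u v w vs with does (v Fin.<? u) | does (w Fin.<? u)
  ... | true  | true  = ≡.refl
  ... | true  | false = ≡.refl
  ... | false | true  = ≡.refl
  ... | false | false = ≡.refl

  count-insert : ∀ {k} u v (vs : Vec (Fin N) k) → count< u (insert v vs) ≡ count< u (v ∷ vs)
  count-insert u v [] = ≡.refl
  count-insert u v (w ∷ vs) with v Fin.≤? w
  ... | yes _ = ≡.refl
  ... | no  _ = ≡.trans (count-cons u w (insert v vs) (v ∷ vs) (count-insert u v vs)) (count-swap u w v vs)

  count-sort : ∀ {k} u (vs : Vec (Fin N) k) → count< u (sort vs) ≡ count< u vs
  count-sort u []       = ≡.refl
  count-sort u (v ∷ vs) = ≡.trans (count-insert u v (sort vs)) (count-cons u v (sort vs) vs (count-sort u vs))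

  inversions-increasing : ∀ {k} {vs : Vec (Fin N) k} → AllPairs Fin._<_ vs → inversions vs ≡ 0
  inversions-increasing [] = ≡.refl
  inversions-increasing (v< ∷ inc) =
    ≡.cong₂ ℕ._+_ (count-none (All.map ℕ.<⇒≤ v<)) (inversions-increasing inc)

  sumToℕ : ∀ {k} → Vec (Fin N) k → ℕ
  sumToℕ []       = 0
  sumToℕ (v ∷ vs) = toℕ v ℕ.+ sumToℕ vs

  sumToℕ-insert : ∀ {k} u (vs : Vec (Fin N) k) → sumToℕ (insert u vs) ≡ toℕ u ℕ.+ sumToℕ vs
  sumToℕ-insert u [] = ≡.refl
  sumToℕ-insert u (v ∷ vs) with u Fin.≤? v
  ... | yes _ = ≡.refl
  ... | no  _ = begin
    toℕ v ℕ.+ sumToℕ (insert u vs)      ≡⟨ ≡.cong (toℕ v ℕ.+_) (sumToℕ-insert u vs) ⟩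
    toℕ v ℕ.+ (toℕ u ℕ.+ sumToℕ vs)     ≡⟨ ℕ.+-assoc (toℕ v) (toℕ u) _ ⟨
    toℕ v ℕ.+ toℕ u ℕ.+ sumToℕ vs       ≡⟨ ≡.cong (ℕ._+ sumToℕ vs) (ℕ.+-comm (toℕ v) (toℕ u)) ⟩
    toℕ u ℕ.+ toℕ v ℕ.+ sumToℕ vs       ≡⟨ ℕ.+-assoc (toℕ u) (toℕ v) _ ⟩
    toℕ u ℕ.+ (toℕ v ℕ.+ sumToℕ vs)     ∎
    where open ≡.≡-Reasoning

  sumToℕ-sort : ∀ {k} (vs : Vec (Fin N) k) → sumToℕ (sort vs) ≡ sumToℕ vs
  sumToℕ-sort []       = ≡.refl
  sumToℕ-sort (v ∷ vs) = ≡.trans (sumToℕ-insert v (sort vs)) (≡.cong (toℕ v ℕ.+_) (sumToℕ-sort vs))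

-- Splittings of a sequence, signs, and Plücker sums as products of forms

module _ {a : Level} {A : Set a} where

  splittings-∷ : ∀ t r {s} y (ys : Vec A s) →
    splittings t r (y ∷ ys) ≡ leftFirst t r (y ∷ ys) ++ rightFirst t r (y ∷ ys)
  splittings-∷ zero    zero    y ys = ≡.refl
  splittings-∷ zero    (suc r) y ys = ≡.refl
  splittings-∷ (suc t) r       y ys = ≡.refl

  all-splittings-∷ : ∀ {p} t r {s} y (ys : Vec A s) {P : ℕ × Vec A t × Vec A r → Set p} →
    ListAll.All P (leftFirst t r (y ∷ ys)) → ListAll.All P (rightFirst t r (y ∷ ys)) →
    ListAll.All P (splittings t r (y ∷ ys))
  all-splittings-∷ t r y ys {P} l r′ =
    ≡.subst (ListAll.All P) (≡.sym (splittings-∷ t r y ys)) (ListAll.++⁺ l r′)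

  splittings-all : ∀ {p} (P : ∀ {s} → Vec A s → ∀ {t} → Vec A t → ∀ {r} → Vec A r → Set p) →
    P [] [] [] →
    (∀ y {s t r} {ys : Vec A s} {us : Vec A t} {vs : Vec A r} → P ys us vs → P (y ∷ ys) (y ∷ us) vs) →
    (∀ y {s t r} {ys : Vec A s} {us : Vec A t} {vs : Vec A r} → P ys us vs → P (y ∷ ys) us (y ∷ vs)) →
    ∀ t r {s} (ys : Vec A s) → ListAll.All (λ (_ , us , vs) → P ys us vs) (splittings t r ys)
  splittings-all P P[] left right = go
    where
    go : ∀ t r {s} (ys : Vec A s) → ListAll.All (λ (_ , us , vs) → P ys us vs) (splittings t r ys)
    go zero    zero    [] = P[] ∷ []
    go zero    (suc r) [] = []
    go (suc t) r       [] = []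
    go t r (y ∷ ys) = all-splittings-∷ t r y ys (goLeft t) (goRight r)
      where
      goLeft : ∀ t → ListAll.All (λ (_ , us , vs) → P (y ∷ ys) us vs) (leftFirst t r (y ∷ ys))
      goLeft zero    = []
      goLeft (suc t) = ListAll.map⁺ (ListAll.map (left y) (go t r ys))
      goRight : ∀ r → ListAll.All (λ (_ , us , vs) → P (y ∷ ys) us vs) (rightFirst t r (y ∷ ys))
      goRight zero    = []
      goRight (suc r) = ListAll.map⁺ (ListAll.map (right y) (go t r ys))

module SignedForms {c ℓ v : Level} (S : CommutativeRing c ℓ) (V : Set v) where

  open CommutativeRing S
  open RingProperties ring using (-‿distribˡ-*; -0#≈0#)
  open Forms S V
  open import Relation.Binary.Reasoning.Setoid setoid

  sign : ℕ → Carrier → Carrier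
  sign zero    z = z
  sign (suc k) z = - sign k z

  sign-cong : ∀ k {y z} → y ≈ z → sign k y ≈ sign k z
  sign-cong zero    p = p
  sign-cong (suc k) p = -‿cong (sign-cong k p)

  sign-+ : ∀ k l z → sign (k ℕ.+ l) z ≡ sign k (sign l z)
  sign-+ zero    l z = ≡.refl
  sign-+ (suc k) l z = ≡.cong -_ (sign-+ k l z)

  sign-swap : ∀ k l z → sign k (sign l z) ≡ sign l (sign k z)
  sign-swap k l z = ≡.trans (≡.sym (sign-+ k l z))
    (≡.trans (≡.cong (λ j → sign j z) (ℕ.+-comm k l)) (sign-+ l k z))

  sign-0 : ∀ k → sign k 0# ≈ 0#
  sign-0 zero    = refl
  sign-0 (suc k) = trans (-‿cong (sign-0 k)) -0#≈0#

  sign-* : ∀ k y z → sign k (y * z) ≈ sign k y * z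
  sign-* zero    y z = refl
  sign-* (suc k) y z = trans (-‿cong (sign-* k y z)) (-‿distribˡ-* (sign k y) z)

  grade-toList : ∀ {t} ω (us : Vec V t) → grade ω (toList us) ≈ sign t (ω (toList us))
  grade-toList ω []       = refl
  grade-toList ω (u ∷ us) = -‿cong (grade-toList (ι u ω) us)

  splitSum : ∀ {t r} → Form → Form → List (ℕ × Vec V t × Vec V r) → Carrier
  splitSum ω η = List.foldr (λ (k , us , vs) z → sign k (ω (toList us) * η (toList vs)) + z) 0#

  splitSum-++ : ∀ {t r} ω η (L L′ : List (ℕ × Vec V t × Vec V r)) →
    splitSum ω η (L ++ L′) ≈ splitSum ω η L + splitSum ω η L′
  splitSum-++ ω η []      L′ = sym (+-identityˡ _)
  splitSum-++ ω η (_ ∷ L) L′ = trans (+-congˡ (splitSum-++ ω η L L′)) (sym (+-assoc _ _ _))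

  private
    ι-ofDegree : ∀ {t ω} u → OfDegree (suc t) ω → OfDegree t (ι u ω)
    ι-ofDegree u d vs q = d (u ∷ vs) (q ∘ ℕ.suc-injective)

    grade-ofDegree : ∀ {t ω} → OfDegree t ω → OfDegree t (grade ω)
    grade-ofDegree {ω = ω} d vs q = ≡.subst (λ us → grade ω us ≈ 0#) (Vec.toList∘fromList vs)
      (trans (grade-toList ω (Vec.fromList vs)) (trans (sign-cong (length vs)
        (trans (reflexive (≡.cong ω (Vec.toList∘fromList vs))) (d vs q))) (sign-0 (length vs))))

  -- Both sides treat the first argument alike: it goes to the left factor, or to the right one past
  -- the t arguments of the left, which is the t added in `rightFirst`. The shuffle product also
  -- ranges over splittings into other sizes; these vanish because the degrees are t and r.
  splittings-∧ : ∀ {t r s ω η} → OfDegree t ω → OfDegree r η → (vs : Vec V s) →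
    splitSum ω η (splittings t r vs) ≈ (ω ∧ η) (toList vs)
  left-∧ : ∀ {t r s ω η} → OfDegree t ω → OfDegree r η → ∀ v (vs : Vec V s) →
    splitSum ω η (leftFirst t r (v ∷ vs)) ≈ (ι v ω ∧ η) (toList vs)
  right-∧ : ∀ {t r s ω η} → OfDegree t ω → OfDegree r η → ∀ v (vs : Vec V s) →
    splitSum ω η (rightFirst t r (v ∷ vs)) ≈ (grade ω ∧ ι v η) (toList vs)

  splittings-∧ {zero}  {zero}  {ω = ω} {η} d e [] = +-identityʳ _
  splittings-∧ {zero}  {suc r} {ω = ω} {η} d e [] = sym (trans (*-congˡ (e [] λ ())) (zeroʳ _))
  splittings-∧ {suc t} {r}     {ω = ω} {η} d e [] = sym (trans (*-congʳ (d [] λ ())) (zeroˡ _))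
  splittings-∧ {t} {r} {ω = ω} {η} d e (v ∷ vs) = trans
    (reflexive (≡.cong (splitSum ω η) (splittings-∷ t r v vs)))
    (trans (splitSum-++ ω η (leftFirst t r (v ∷ vs)) (rightFirst t r (v ∷ vs)))
      (+-cong (left-∧ d e v vs) (right-∧ d e v vs)))

  left-∧ {zero}  {η = η} d e v vs =
    sym (Linear.vanish (∧-linearˡ η) (λ us → d (v ∷ us) λ ()) (toList vs))
  left-∧ {suc t} {r} {ω = ω} {η} d e v vs =
    trans (reflexive (cons (splittings t r vs))) (splittings-∧ (ι-ofDegree v d) e vs)
    where
    cons : ∀ L → splitSum ω η (List.map (λ (k , us , vs) → k , v ∷ us , vs) L) ≡ splitSum (ι v ω) η L
    cons []      = ≡.refl
    cons (_ ∷ L) = ≡.cong (_ +_) (cons L)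

  right-∧ {r = zero} {ω = ω} d e v vs =
    sym (Linear.vanish (∧-linearʳ (grade ω)) (λ us → e (v ∷ us) λ ()) (toList vs))
  right-∧ {t} {suc r} {ω = ω} {η} d e v vs =
    trans (cons (splittings t r vs)) (splittings-∧ (grade-ofDegree d) (ι-ofDegree v e) vs)
    where
    cons : ∀ L → splitSum ω η (List.map (λ (k , us , vs) → t ℕ.+ k , us , v ∷ vs) L) ≈
                 splitSum (grade ω) (ι v η) L
    cons []                  = refl
    cons ((k , us , vs) ∷ L) = +-cong (begin
      sign (t ℕ.+ k) (ω (toList us) * η (v ∷ toList vs))
        ≡⟨ ≡.trans (sign-+ t k _) (sign-swap t k _) ⟩
      sign k (sign t (ω (toList us) * η (v ∷ toList vs)))
        ≈⟨ sign-cong k (trans (sign-* t _ _) (*-congʳ (sym (grade-toList ω us)))) ⟩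
      sign k (grade ω (toList us) * η (v ∷ toList vs)) ∎) (cons L)

module SortedForms {c ℓ : Level} (S : CommutativeRing c ℓ) (N : ℕ) where

  open CommutativeRing S
  open Forms S (Fin N)
  open SignedForms S (Fin N)
  open import Relation.Binary.Reasoning.Setoid setoid

  -- On its way into a sorted sequence u passes exactly the entries smaller than itself, each by one
  -- transposition.
  insert-sign : ∀ {k} ω → Antisymmetric ω → ∀ u {vs : Vec (Fin N) k} → WeaklyIncreasing vs →
    ω (u ∷ toList vs) ≈ sign (Vec.count (Fin._<? u) vs) (ω (toList (insert u vs)))
  insert-sign ω a u [] = refl
  insert-sign ω a u {v ∷ vs} (v≤ ∷ inc) with u Fin.≤? v
  ... | yes u≤v = reflexive (≡.cong (λ j → sign j (ω (u ∷ v ∷ toList vs)))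
    (≡.sym (count-none (u≤v ∷ All.map (ℕ.≤-trans u≤v) v≤))))
  ... | no  u≰v = begin
    ω (u ∷ v ∷ toList vs)
      ≈⟨ a [] u v (toList vs) ⟩
    - ω (v ∷ u ∷ toList vs)
      ≈⟨ -‿cong (insert-sign (ι v ω) (λ us → a (v ∷ us)) u inc) ⟩
    sign (suc (Vec.count (Fin._<? u) vs)) z
      ≡⟨ ≡.cong (λ j → sign j z) (count-yes vs (ℕ.≰⇒> u≰v)) ⟨
    sign (Vec.count (Fin._<? u) (v ∷ vs)) z ∎
    where z = ω (v ∷ toList (insert u vs))

  sort-sign : ∀ {k} ω → Antisymmetric ω → (vs : Vec (Fin N) k) →
    ω (toList vs) ≈ sign (inversions vs) (ω (toList (sort vs)))
  sort-sign ω a [] = refl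
  sort-sign ω a (v ∷ vs) = begin
    ω (v ∷ toList vs)
      ≈⟨ sort-sign (ι v ω) (λ us → a (v ∷ us)) vs ⟩
    sign (inversions vs) (ω (v ∷ toList (sort vs)))
      ≈⟨ sign-cong (inversions vs) (insert-sign ω a v (sort-weaklyIncreasing vs)) ⟩
    sign (inversions vs) (sign (Vec.count (Fin._<? v) (sort vs)) z)
      ≡⟨ ≡.cong (λ j → sign (inversions vs) (sign j z)) (count-sort v vs) ⟩
    sign (inversions vs) (sign (Vec.count (Fin._<? v) vs) z)
      ≡⟨ sign-swap (inversions vs) (Vec.count (Fin._<? v) vs) z ⟩
    sign (Vec.count (Fin._<? v) vs) (sign (inversions vs) z)
      ≡⟨ sign-+ (Vec.count (Fin._<? v) vs) (inversions vs) z ⟨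
    sign (inversions (v ∷ vs)) z ∎
    where z = ω (toList (insert v (sort vs)))

  -- After sorting, a repetition occurs at adjacent positions, where `Alternating` applies.
  repeated-vanish : ∀ {k} ω → Alternating ω → (vs : Vec (Fin N) k) →
    WeaklyIncreasing vs → ¬ AllPairs Fin._<_ vs → ω (toList vs) ≈ 0#
  repeated-vanish ω a [] _ not = contradiction [] not
  repeated-vanish ω a (v ∷ vs) (v≤ ∷ inc) not = from v vs ω a v≤ inc not
    where
    from : ∀ {k} v (vs : Vec (Fin N) k) ω → Alternating ω → All (v Fin.≤_) vs →
      WeaklyIncreasing vs → ¬ AllPairs Fin._<_ (v ∷ vs) → ω (v ∷ toList vs) ≈ 0#
    from v []       ω a _ _ not = contradiction ([] ∷ []) not
    from v (w ∷ vs) ω a (v≤w ∷ v≤) (w≤ ∷ inc) not with v Fin.≟ w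
    ... | yes ≡.refl = a [] v (toList vs)
    ... | no  v≢w = from w vs (ι v ω) (λ us → a (v ∷ us)) w≤ inc λ inc′ →
      not ((v<w ∷ All.map (ℕ.<-≤-trans v<w) w≤) ∷ inc′)
      where
      v<w : v Fin.< w
      v<w = Fin.≤∧≢⇒< v≤w v≢w

-- Evaluating Plücker coordinates as minors of a generic matrix

rowContent : ∀ {m N} → List (Subset m N) → Exponent m N
rowContent = List.foldr (λ J e → Vec.map indicator (elements J) ⊕ e) ∅

allPairs-toList : ∀ {N k} {vs : Vec (Fin N) k} →
                  AllPairs (Fin._<_ {N} {N}) vs → Increasing (toList vs)
allPairs-toList []         = []
allPairs-toList (v< ∷ inc) = All.toList⁺ v< ∷ allPairs-toList inc

elements-increasing : ∀ {m N} (J : Subset m N) → AllPairs Fin._<_ (elements J)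
elements-increasing (subset vs inc) = recompute (allPairs? Fin._<?_ vs) inc

module Evaluation {c ℓ : Level} (K : CommutativeRing c ℓ) (m n : ℕ) where

  private N = m ℕ.+ n

  open Grassmannian K m n using (module Poly; module R; bracket; signed; monomial;
    PlückerRelation; plücker; coordinateRing)
  open MonoidAlgebra K (⊕-isCommutativeMonoid {m} {N})
  open Leading (weight 0) (weight-⊕ 0) public
  open LeadingMinors K {N} (⊕-isCommutativeMonoid {m} {N}) (weight 0) (weight-⊕ 0) (weight-∅ m N 0)
  open Forms commutativeRing (Fin N)
  open SignedForms commutativeRing (Fin N)
  open SortedForms commutativeRing N
  private
    module K = CommutativeRing K
    module S = CommutativeRing commutativeRing
  open RingProperties S.ring using (x∙y⁻¹≈ε⇒x≈y)
  open import Relation.Binary.Reasoning.Setoid S.setoid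

  private
    length-variables : length (List.map (single ∘_) (unitExponents m)) ≡ m
    length-variables = ≡.trans (List.length-map _ (unitExponents m)) (length-unitExponents m)

  opaque

    maximalMinor : Form
    maximalMinor = minor (unitExponents m)

    maximalMinor-ofDegree : OfDegree m maximalMinor
    maximalMinor-ofDegree vs ≢m = det-ofDegree (List.map (single ∘_) (unitExponents m)) vs
      λ eq → ≢m (≡.trans eq length-variables)

    maximalMinor-antisymmetric : Antisymmetric maximalMinor
    maximalMinor-antisymmetric = det-antisymmetric (List.map (single ∘_) (unitExponents m))

    maximalMinor-alternating : Alternating maximalMinor
    maximalMinor-alternating = det-alternating (List.map (single ∘_) (unitExponents m))

    maximalMinor-exchange : ∀ us ws vs → m < length vs →
      ((λ cs → maximalMinor (us ++ cs)) ∧ (λ cs → maximalMinor (cs ++ ws))) vs ≈ []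
    maximalMinor-exchange us ws vs m<∣vs∣ =
      ∧-of-minors-vanish (List.map (single ∘_) (unitExponents m)) us ws vs
        (≡.subst (ℕ._< length vs) (≡.sym length-variables) m<∣vs∣)

    maximalMinor-leads : ∀ J → Leads (Vec.map indicator (elements J)) (maximalMinor (toList (elements J)))
    maximalMinor-leads J =
      ≡.subst (λ e → Leads e (minor (unitExponents m) (toList (elements J)))) (diagonal-unitExponents (elements J))
        (minor-leads (toList (elements J)) (unitExponents-graded m 0)
          (≡.trans (Vec.length-toList (elements J)) (≡.sym (length-unitExponents m)))
          (allPairs-toList (elements-increasing J)))

  -- The homomorphism from the coordinates P_J to polynomials in the matrix entries. By `eval-resp`
  -- it descends to the coordinate ring, so coefficients of the image are well-defined functionals
  -- on that ring.
  eval : Poly.Poly → Element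
  eval (Poly.con k)   = embed k
  eval (Poly.var J)   = maximalMinor (toList (elements J))
  eval (f Poly.+ g)   = eval f ++ eval g
  eval (f Poly.* g)   = eval f * eval g
  eval (Poly.- f)     = - eval f

  eval-cong : ∀ {f g} → f Poly.≈ g → eval f ≈ eval g
  eval-cong Poly.refl              = S.refl
  eval-cong (Poly.sym p)           = S.sym (eval-cong p)
  eval-cong (Poly.trans p q)       = S.trans (eval-cong p) (eval-cong q)
  eval-cong (Poly.+-cong p q)      = S.+-cong (eval-cong p) (eval-cong q)
  eval-cong (Poly.*-cong p q)      = S.*-cong (eval-cong p) (eval-cong q)
  eval-cong (Poly.-‿cong p)        = S.-‿cong (eval-cong p)
  eval-cong (Poly.+-assoc f g h)   = S.+-assoc (eval f) (eval g) (eval h)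
  eval-cong (Poly.+-comm f g)      = S.+-comm (eval f) (eval g)
  eval-cong (Poly.+-identityˡ f)   = S.+-congʳ {eval f} embed-0
  eval-cong (Poly.-‿inverseˡ f)    = S.trans (S.-‿inverseˡ (eval f)) (S.sym embed-0)
  eval-cong (Poly.*-assoc f g h)   = S.*-assoc (eval f) (eval g) (eval h)
  eval-cong (Poly.*-comm f g)      = S.*-comm (eval f) (eval g)
  eval-cong (Poly.*-identityˡ f)   = S.*-identityˡ (eval f)
  eval-cong (Poly.distribˡ f g h)  = S.distribˡ (eval f) (eval g) (eval h)
  eval-cong (Poly.con-cong p)      = embed-cong p
  eval-cong (Poly.con-+ k l)       = embed-+ k l
  eval-cong (Poly.con-* k l)       = embed-* k l
  eval-cong (Poly.con-neg k)       = S.refl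

  eval-signed : ∀ k f → eval (signed k f) ≈ sign k (eval f)
  eval-signed zero    f = S.refl
  eval-signed (suc k) f = S.-‿cong {eval (signed k f)} {sign k (eval f)} (eval-signed k f)

  maximalMinor-cong : ∀ {us vs} → us ≡ vs → maximalMinor us ≈ maximalMinor vs
  maximalMinor-cong ≡.refl = S.refl

  eval-bracket : ∀ s → eval (bracket s) ≈ maximalMinor (toList s)
  eval-bracket s with allPairs? Fin._<?_ (sort s)
  ... | yes inc = begin
    eval (signed (inversions s) (Poly.var (subset (sort s) inc)))
      ≈⟨ eval-signed (inversions s) (Poly.var (subset (sort s) inc)) ⟩
    sign (inversions s) (maximalMinor (toList (sort s)))
      ≈⟨ sort-sign maximalMinor maximalMinor-antisymmetric s ⟨
    maximalMinor (toList s) ∎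
  ... | no ¬inc = begin
    embed K.0#
      ≈⟨ embed-0 ⟩
    []
      ≈⟨ sign-0 (inversions s) ⟨
    sign (inversions s) []
      ≈⟨ sign-cong (inversions s)
           (repeated-vanish maximalMinor maximalMinor-alternating (sort s) (sort-weaklyIncreasing s) ¬inc) ⟨
    sign (inversions s) (maximalMinor (toList (sort s)))
      ≈⟨ sort-sign maximalMinor maximalMinor-antisymmetric s ⟨
    maximalMinor (toList s) ∎

  -- The relation is the shuffle product of c′ ↦ [a c′] and c″ ↦ [c″ b], taken at c. Both factors
  -- come from the same determinant with m rows by fixing arguments, and c has more than m entries.
  eval-relation : ∀ {f} → PlückerRelation f → eval f ≈ []
  eval-relation (plücker {p} {t} {r} {q} p+t≡m r+q≡m m<t+r a c b) = begin
    _ ≈⟨ termwise (splittings t r c) ⟩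
    splitSum ω η (splittings t r c)
      ≈⟨ splittings-∧ ω-ofDegree η-ofDegree c ⟩
    (ω ∧ η) (toList c)
      ≈⟨ maximalMinor-exchange (toList a) (toList b) (toList c)
           (≡.subst (m ℕ.<_) (≡.sym (Vec.length-toList c)) m<t+r) ⟩
    [] ∎
    where
    ω η : Form
    ω vs = maximalMinor (toList a ++ vs)
    η vs = maximalMinor (vs ++ toList b)

    ω-ofDegree : OfDegree t ω
    ω-ofDegree vs ≢t = maximalMinor-ofDegree (toList a ++ vs) λ eq →
      ≢t (ℕ.+-cancelˡ-≡ p (length vs) t (≡.trans
        (≡.trans (≡.cong (ℕ._+ length vs) (≡.sym (Vec.length-toList a)))
          (≡.sym (List.length-++ (toList a)))) (≡.trans eq (≡.sym p+t≡m))))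

    η-ofDegree : OfDegree r η
    η-ofDegree vs ≢r = maximalMinor-ofDegree (vs ++ toList b) λ eq →
      ≢r (ℕ.+-cancelʳ-≡ q (length vs) r (≡.trans
        (≡.trans (≡.cong (length vs ℕ.+_) (≡.sym (Vec.length-toList b)))
          (≡.sym (List.length-++ vs))) (≡.trans eq (≡.sym r+q≡m))))

    toList-cast-++ : ∀ {i j} .(eq : i ℕ.+ j ≡ m) (us : Vec (Fin N) i) (vs : Vec (Fin N) j) →
      toList (Vec.cast eq (us Vec.++ vs)) ≡ toList us ++ toList vs
    toList-cast-++ eq us vs = ≡.trans (Vec.toList-cast eq (us Vec.++ vs)) (Vec.toList-++ us vs)

    termwise : ∀ L → eval (List.foldr Poly._+_ (Poly.con K.0#) (List.map
        (λ (k , c′ , c″) → signed k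
          ( bracket (Vec.cast p+t≡m (a Vec.++ c′))
          Poly.* bracket (Vec.cast r+q≡m (c″ Vec.++ b)) )) L)) ≈ splitSum ω η L
    termwise []                  = embed-0
    termwise ((k , c′ , c″) ∷ L) = S.+-cong (begin
      eval (signed k (bracket s Poly.* bracket s′))
        ≈⟨ eval-signed k (bracket s Poly.* bracket s′) ⟩
      sign k (eval (bracket s) * eval (bracket s′))
        ≈⟨ sign-cong k (S.*-cong (eval-bracket s) (eval-bracket s′)) ⟩
      sign k (maximalMinor (toList s) * maximalMinor (toList s′))
        ≈⟨ sign-cong k (S.*-cong
             (maximalMinor-cong (toList-cast-++ p+t≡m a c′))
             (maximalMinor-cong (toList-cast-++ r+q≡m c″ b))) ⟩
      sign k (ω (toList c′) * η (toList c″)) ∎) (termwise L)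
      where
      s = Vec.cast p+t≡m (a Vec.++ c′)
      s′ = Vec.cast r+q≡m (c″ Vec.++ b)

  eval-ideal : ∀ {f} → R.Ideal f → eval f ≈ []
  eval-ideal (R.generator g)             = eval-relation g
  eval-ideal (R.resp p i)                = S.trans (S.sym (eval-cong p)) (eval-ideal i)
  eval-ideal R.ideal-0                   = embed-0
  eval-ideal (R.ideal-+ i j)             = S.trans (S.+-cong (eval-ideal i) (eval-ideal j)) S.refl
  eval-ideal (R.ideal-* f i)             = S.trans (S.*-congˡ {eval f} (eval-ideal i)) (S.zeroʳ (eval f))

  eval-resp : ∀ {f g} → CommutativeRing._≈_ coordinateRing f g → eval f ≈ eval g
  eval-resp {f} {g} (R.mod i) = x∙y⁻¹≈ε⇒x≈y (eval f) (eval g) (eval-ideal i)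

  eval-monomial-leads : ∀ M → Leads (rowContent M) (eval (monomial M))
  eval-monomial-leads []      = leads-single ∅
  eval-monomial-leads (J ∷ M) = leads-* (maximalMinor-leads J) (eval-monomial-leads M)

-- Linear combinations and triangular families

maximal : ∀ {a} {A : Set a} (f : A → ℕ) x xs →
          ∃ λ y → y ∈ (x ∷ xs) × ListAll.All (λ z → f z ≤ f y) (x ∷ xs)
maximal f x []        = x , here ≡.refl , ℕ.≤-refl ∷ []
maximal f x (x′ ∷ xs) with maximal f x′ xs
... | y , y∈ , ≤y with ℕ.≤-total (f x) (f y)
...   | inj₁ x≤y = y , there y∈ , x≤y ∷ ≤y
...   | inj₂ y≤x = x , here ≡.refl , ℕ.≤-refl ∷ ListAll.map (λ z≤y → ℕ.≤-trans z≤y y≤x) ≤y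

module LinearCombinationProperties {c ℓ m ℓm i ℓi : Level} (K : CommutativeRing c ℓ)
  (M : LeftModule (CommutativeRing.ring K) m ℓm)
  (I : DecSetoid i ℓi) (b : DecSetoid.Carrier I → LeftModule.Carrierᴹ M) where

  private
    module K = CommutativeRing K
    module M = LeftModule M
    module I = DecSetoid I
  open M using (_≈ᴹ_; _+ᴹ_; _*ₗ_; 0ᴹ)
  open LinearCombinations K M I b

  value-++ : ∀ l l′ → value (l ++ l′) ≈ᴹ value l +ᴹ value l′
  value-++ []            l′ = M.≈ᴹ-sym (M.+ᴹ-identityˡ _)
  value-++ ((k , j) ∷ l) l′ = M.≈ᴹ-trans (M.+ᴹ-congˡ (value-++ l l′)) (M.≈ᴹ-sym (M.+ᴹ-assoc _ _ _))

  scale : K.Carrier → LinComb → LinComb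
  scale k = List.map (λ (k′ , j) → k K.* k′ , j)

  value-scale : ∀ k l → value (scale k l) ≈ᴹ k *ₗ value l
  value-scale k []             = M.≈ᴹ-sym (M.*ₗ-zeroʳ k)
  value-scale k ((k′ , j) ∷ l) = M.≈ᴹ-trans
    (M.+ᴹ-cong (M.*ₗ-assoc k k′ (b j)) (value-scale k l)) (M.≈ᴹ-sym (M.*ₗ-distribˡ k _ _))

  coefficient-++ : ∀ l l′ j → coefficient (l ++ l′) j K.≈ coefficient l j K.+ coefficient l′ j
  coefficient-++ []             l′ j = K.sym (K.+-identityˡ _)
  coefficient-++ ((k , j′) ∷ l) l′ j with j′ I.≟ j
  ... | yes _ = K.trans (K.+-congˡ (coefficient-++ l l′ j)) (K.sym (K.+-assoc _ _ _))
  ... | no  _ = coefficient-++ l l′ j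

  coefficient-scale : ∀ k l j → coefficient (scale k l) j K.≈ k K.* coefficient l j
  coefficient-scale k []              j = K.sym (K.zeroʳ k)
  coefficient-scale k ((k′ , j′) ∷ l) j with j′ I.≟ j
  ... | yes _ = K.trans (K.+-congˡ (coefficient-scale k l j)) (K.sym (K.distribˡ k _ _))
  ... | no  _ = coefficient-scale k l j

  coefficient-∷-≈ : ∀ {k i j} l → i I.≈ j → coefficient ((k , i) ∷ l) j ≡ k K.+ coefficient l j
  coefficient-∷-≈ {k} {i} {j} l i≈j with i I.≟ j
  ... | yes _   = ≡.refl
  ... | no  i≉j = contradiction i≈j i≉j

  coefficient-∷-≉ : ∀ {k i j} l → ¬ i I.≈ j → coefficient ((k , i) ∷ l) j ≡ coefficient l j
  coefficient-∷-≉ {k} {i} {j} l i≉j with i I.≟ j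
  ... | yes i≈j = contradiction i≈j i≉j
  ... | no  _   = ≡.refl

  coefficient-cong : ∀ l {j j′} → j I.≈ j′ → coefficient l j K.≈ coefficient l j′
  coefficient-cong []             j≈j′ = K.refl
  coefficient-cong ((k , i) ∷ l) {j} {j′} j≈j′ with i I.≟ j | i I.≟ j′
  ... | yes _ | yes _ = K.+-congˡ (coefficient-cong l j≈j′)
  ... | no  _ | no  _ = coefficient-cong l j≈j′
  ... | yes p | no ¬q = contradiction (I.trans p j≈j′) ¬q
  ... | no ¬p | yes q = contradiction (I.trans q (I.sym j≈j′)) ¬p

  coefficient-absent : ∀ {l j} → ListAll.All (λ (_ , i) → ¬ i I.≈ j) l → coefficient l j K.≈ K.0#
  coefficient-absent [] = K.refl
  coefficient-absent {(_ , i) ∷ _} {j} (i≉j ∷ absent) with i I.≟ j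
  ... | yes i≈j = contradiction i≈j i≉j
  ... | no  _   = coefficient-absent absent

  remove : I.Carrier → LinComb → LinComb
  remove j [] = []
  remove j ((k , i) ∷ l) with i I.≟ j
  ... | yes _ = remove j l
  ... | no  _ = (k , i) ∷ remove j l

  length-remove-≤ : ∀ j l → length (remove j l) ≤ length l
  length-remove-≤ j [] = ℕ.z≤n
  length-remove-≤ j ((k , i) ∷ l) with i I.≟ j
  ... | yes _ = ℕ.m≤n⇒m≤1+n (length-remove-≤ j l)
  ... | no  _ = ℕ.s≤s (length-remove-≤ j l)

  length-remove-< : ∀ {k j l} → (k , j) ∈ l → length (remove j l) < length l
  length-remove-< {j = j} {(_ , i) ∷ l} (here ≡.refl) with i I.≟ j
  ... | yes _   = ℕ.s≤s (length-remove-≤ j l)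
  ... | no  i≉i = contradiction I.refl i≉i
  length-remove-< {j = j} {(_ , i) ∷ l} (there p) with i I.≟ j
  ... | yes _ = ℕ.m≤n⇒m≤1+n (length-remove-< p)
  ... | no  _ = ℕ.s≤s (length-remove-< p)

  remove-all : ∀ {p} {P : Pred (K.Carrier × I.Carrier) p} j {l} → ListAll.All P l → ListAll.All P (remove j l)
  remove-all j [] = []
  remove-all j (_∷_ {x = _ , i} p ps) with i I.≟ j
  ... | yes _ = remove-all j ps
  ... | no  _ = p ∷ remove-all j ps

  coefficient-remove : ∀ j l {i} → ¬ i I.≈ j → coefficient (remove j l) i K.≈ coefficient l i
  coefficient-remove j [] i≉j = K.refl
  coefficient-remove j ((k , i′) ∷ l) {i} i≉j with i′ I.≟ j
  ... | no _ with i′ I.≟ i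
  ...   | yes _ = K.+-congˡ (coefficient-remove j l i≉j)
  ...   | no  _ = coefficient-remove j l i≉j
  coefficient-remove j ((k , i′) ∷ l) {i} i≉j | yes i′≈j with i′ I.≟ i
  ...   | yes i′≈i = contradiction (I.trans (I.sym i′≈i) i′≈j) i≉j
  ...   | no  _    = coefficient-remove j l i≉j

  module _ (b-cong : ∀ {i j} → i I.≈ j → b i ≈ᴹ b j) where

    value-remove : ∀ j l → value l ≈ᴹ coefficient l j *ₗ b j +ᴹ value (remove j l)
    value-remove j [] = M.≈ᴹ-sym (M.≈ᴹ-trans (M.+ᴹ-congʳ (M.*ₗ-zeroˡ (b j))) (M.+ᴹ-identityˡ 0ᴹ))
    value-remove j ((k , i) ∷ l) with i I.≟ j
    ... | yes i≈j = M.≈ᴹ-trans (M.+ᴹ-cong (M.*ₗ-congˡ (b-cong i≈j)) (value-remove j l))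
      (M.≈ᴹ-trans (M.≈ᴹ-sym (M.+ᴹ-assoc _ _ _)) (M.+ᴹ-congʳ (M.≈ᴹ-sym (M.*ₗ-distribʳ (b j) k _))))
    ... | no  _ = M.≈ᴹ-trans (M.+ᴹ-congˡ (value-remove j l))
      (M.≈ᴹ-trans (M.≈ᴹ-sym (M.+ᴹ-assoc _ _ _))
        (M.≈ᴹ-trans (M.+ᴹ-congʳ (M.+ᴹ-comm _ _)) (M.+ᴹ-assoc _ _ _)))

    value-remove-0 : ∀ j l → coefficient l j K.≈ K.0# → value l ≈ᴹ value (remove j l)
    value-remove-0 j l p = M.≈ᴹ-trans (value-remove j l) (M.≈ᴹ-trans
      (M.+ᴹ-congʳ (M.≈ᴹ-trans (M.*ₗ-congʳ p) (M.*ₗ-zeroˡ (b j)))) (M.+ᴹ-identityˡ _))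

  module _ {p} (P : Pred I.Carrier p) where

    Spanned : M.Carrierᴹ → Set (c ⊔ i ⊔ ℓm ⊔ p)
    Spanned v = ∃ λ l → ListAll.All (P ∘ proj₂) l × v ≈ᴹ value l

  module _ {p} {P : Pred I.Carrier p} where

    spanned-resp : ∀ {v w} → v ≈ᴹ w → Spanned P v → Spanned P w
    spanned-resp v≈w (l , ps , v≈l) = l , ps , M.≈ᴹ-trans (M.≈ᴹ-sym v≈w) v≈l

    spanned-0 : Spanned P 0ᴹ
    spanned-0 = [] , [] , M.≈ᴹ-refl

    spanned-+ : ∀ {v w} → Spanned P v → Spanned P w → Spanned P (v +ᴹ w)
    spanned-+ (l , ps , v≈l) (l′ , ps′ , w≈l′) = l ++ l′ , ListAll.++⁺ ps ps′ ,
      M.≈ᴹ-trans (M.+ᴹ-cong v≈l w≈l′) (M.≈ᴹ-sym (value-++ l l′))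

    spanned-scale : ∀ k {v} → Spanned P v → Spanned P (k *ₗ v)
    spanned-scale k (l , ps , v≈l) = scale k l , ListAll.map⁺ ps ,
      M.≈ᴹ-trans (M.*ₗ-congˡ v≈l) (M.≈ᴹ-sym (value-scale k l))

    spanned-member : ∀ {j} → P j → Spanned P (b j)
    spanned-member {j} p = (K.1# , j) ∷ [] , p ∷ [] ,
      M.≈ᴹ-sym (M.≈ᴹ-trans (M.+ᴹ-identityʳ _) (M.*ₗ-identityˡ (b j)))

    spanned-value : ∀ {l} → ListAll.All (Spanned P ∘ b ∘ proj₂) l → Spanned P (value l)
    spanned-value []       = spanned-0
    spanned-value {(k , _) ∷ _} (s ∷ ss) = spanned-+ (spanned-scale k s) (spanned-value ss)

  spanned-trans : ∀ {p q} {P : Pred I.Carrier p} {Q : Pred I.Carrier q} →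
    (∀ {j} → P j → Spanned Q (b j)) → ∀ {v} → Spanned P v → Spanned Q v
  spanned-trans P⊆Q (l , ps , v≈l) =
    spanned-resp (M.≈ᴹ-sym v≈l) (spanned-value (ListAll.map P⊆Q ps))

  independent⇒unique : LinearlyIndependent → ∀ l l′ → value l ≈ᴹ value l′ → l ≋ l′
  independent⇒unique independent l l′ eq j = x∙y⁻¹≈ε⇒x≈y (coefficient l j) (coefficient l′ j) (begin
    coefficient l j K.- coefficient l′ j
      ≈⟨ K.+-congˡ (-1*x≈-x (coefficient l′ j)) ⟨
    coefficient l j K.+ K.- K.1# K.* coefficient l′ j
      ≈⟨ K.+-congˡ (coefficient-scale (K.- K.1#) l′ j) ⟨
    coefficient l j K.+ coefficient (scale (K.- K.1#) l′) j
      ≈⟨ coefficient-++ l (scale (K.- K.1#) l′) j ⟨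
    coefficient (l ++ scale (K.- K.1#) l′) j
      ≈⟨ independent (l ++ scale (K.- K.1#) l′) difference≈0 j ⟩
    K.0# ∎)
    where
    open RingProperties K.ring using (x∙y⁻¹≈ε⇒x≈y; -1*x≈-x)
    open import Relation.Binary.Reasoning.Setoid K.setoid
    difference≈0 : value (l ++ scale (K.- K.1#) l′) ≈ᴹ 0ᴹ
    difference≈0 = M.≈ᴹ-trans (value-++ l (scale (K.- K.1#) l′)) (M.≈ᴹ-trans
      (M.+ᴹ-cong (M.≈ᴹ-trans eq (M.≈ᴹ-sym (M.*ₗ-identityˡ _))) (value-scale (K.- K.1#) l′))
      (M.≈ᴹ-trans (M.≈ᴹ-sym (M.*ₗ-distribʳ (value l′) K.1# (K.- K.1#)))
        (M.≈ᴹ-trans (M.*ₗ-congʳ (K.-‿inverseʳ K.1#)) (M.*ₗ-zeroˡ (value l′)))))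

  -- Linear functionals top j reading off the coefficient of b j from combinations in
  -- which b j has maximal weight.
  module Triangular {p} {P : Pred I.Carrier p}
    (b-cong : ∀ {i j} → i I.≈ j → b i ≈ᴹ b j)
    (weight : I.Carrier → ℕ) (weight-cong : ∀ {i j} → i I.≈ j → weight i ≡ weight j)
    (top : I.Carrier → M.Carrierᴹ → K.Carrier)
    (top-cong : ∀ j {v w} → v ≈ᴹ w → top j v K.≈ top j w)
    (top-linear : ∀ j k v w → top j (k *ₗ v +ᴹ w) K.≈ k K.* top j v K.+ top j w)
    (top-0 : ∀ j → top j 0ᴹ K.≈ K.0#)
    (top-≈ : ∀ {i j} → i I.≈ j → top j (b i) K.≈ K.1#)
    (top-≉ : ∀ {i j} → P i → P j → weight i ≤ weight j → ¬ i I.≈ j → top j (b i) K.≈ K.0#)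
    where

    top-value : ∀ l {j} → ListAll.All (P ∘ proj₂) l → P j → ListAll.All (λ (_ , i) → weight i ≤ weight j) l →
                top j (value l) K.≈ coefficient l j
    top-value [] {j} [] _ [] = top-0 j
    top-value ((k , i) ∷ l) {j} (pᵢ ∷ ps) pⱼ (i≤j ∷ ≤j) with i I.≟ j
    ... | yes i≈j = K.trans (top-linear j k (b i) (value l))
      (K.+-cong (K.trans (K.*-congˡ (top-≈ i≈j)) (K.*-identityʳ k)) (top-value l ps pⱼ ≤j))
    ... | no  i≉j = K.trans (top-linear j k (b i) (value l)) (K.trans
      (K.+-cong (K.trans (K.*-congˡ (top-≉ pᵢ pⱼ i≤j i≉j)) (K.zeroʳ k)) (top-value l ps pⱼ ≤j))
      (K.+-identityˡ _))

    -- Used in two ways. For w = 0 all coefficients at members of P vanish, which is linear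
    -- independence. For w the weight of a monomial, every term of that weight or more is discarded,
    -- which feeds the induction on the weight.
    record Reduction (w : ℕ) (l : LinComb) : Set (c ⊔ ℓ ⊔ i ⊔ ℓi ⊔ ℓm ⊔ p) where
      field
        reduct  : LinComb
        members : ListAll.All (P ∘ proj₂) reduct
        lower   : ListAll.All (λ (_ , i) → weight i < w) reduct
        value≈  : value l ≈ᴹ value reduct
        coeff≈0 : ∀ {j} → P j → w ≤ weight j → coefficient l j K.≈ K.0#

    -- The coefficients at the members of maximal weight are read off by top, so
    -- they vanish and these members can be dropped.
    reduce : ∀ w l → ListAll.All (P ∘ proj₂) l →
      (∀ {j} → P j → w ≤ weight j → top j (value l) K.≈ K.0#) → Reduction w l
    reduce w l = go l (<-wellFounded (length l))
      where
      go : ∀ l → Acc ℕ._<_ (length l) → ListAll.All (P ∘ proj₂) l →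
        (∀ {j} → P j → w ≤ weight j → top j (value l) K.≈ K.0#) → Reduction w l
      go [] _ _ _ = record
        { reduct = [] ; members = [] ; lower = [] ; value≈ = M.≈ᴹ-refl ; coeff≈0 = λ _ _ → K.refl }
      go l@(t ∷ ts) (acc rec) ps top≈0 with maximal (weight ∘ proj₂) t ts
      ... | (k , j₀) , j₀∈l , ≤j₀ with weight j₀ ℕ.<? w
      ...   | yes j₀<w = record
        { reduct = l ; members = ps ; lower = ListAll.map (λ i≤ → ℕ.≤-<-trans i≤ j₀<w) ≤j₀
        ; value≈ = M.≈ᴹ-refl
        ; coeff≈0 = λ pⱼ w≤j → coefficient-absent (ListAll.map (λ i≤ i≈j → ℕ.<⇒≱ j₀<w
            (ℕ.≤-trans w≤j (ℕ.≤-trans (ℕ.≤-reflexive (weight-cong (I.sym i≈j))) i≤))) ≤j₀) }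
      ...   | no j₀≮w = record
        { reduct = R.reduct ; members = R.members ; lower = R.lower
        ; value≈ = M.≈ᴹ-trans value≈₀ R.value≈
        ; coeff≈0 = λ {j} pⱼ w≤j → cases j (R.coeff≈0 pⱼ w≤j) }
        where
        p₀ = ListAll.lookup ps j₀∈l
        coefficient≈0 : coefficient l j₀ K.≈ K.0#
        coefficient≈0 = K.trans (K.sym (top-value l ps p₀ ≤j₀)) (top≈0 p₀ (ℕ.≮⇒≥ j₀≮w))
        value≈₀ : value l ≈ᴹ value (remove j₀ l)
        value≈₀ = value-remove-0 b-cong j₀ l coefficient≈0
        module R = Reduction (go (remove j₀ l) (rec (length-remove-< j₀∈l)) (remove-all j₀ ps)
          λ pⱼ w≤j → K.trans (top-cong _ (M.≈ᴹ-sym value≈₀)) (top≈0 pⱼ w≤j))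
        cases : ∀ j → coefficient (remove j₀ l) j K.≈ K.0# → coefficient l j K.≈ K.0#
        cases j z with j I.≟ j₀
        ... | yes j≈j₀ = K.trans (coefficient-cong l j≈j₀) coefficient≈0
        ... | no  j≉j₀ = K.trans (K.sym (coefficient-remove j₀ l j≉j₀)) z

-- Monomials compared by their leading exponents

Monomials : (m n : ℕ) → DecSetoid 0ℓ 0ℓ
Monomials m n = record
  { Carrier = Monomial m n
  ; _≈_ = _↭_
  ; isDecEquivalence = record
    { isEquivalence = record { refl = Perm.↭-refl ; sym = Perm.↭-sym ; trans = Perm.↭-trans }
    ; _≟_ = ↭-dec _≟ˢ_
    }
  }

rowContent-cong : ∀ {m N} {M M′ : List (Subset m N)} → M ↭ M′ → rowContent M ≡ rowContent M′
rowContent-cong Perm.refl = ≡.refl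
rowContent-cong (Perm.prep J p) = ≡.cong (Vec.map indicator (elements J) ⊕_) (rowContent-cong p)
rowContent-cong (Perm.swap {xs = M} J J′ p) = ≡.trans
  (≡.trans (≡.sym (E.assoc e e′ (rowContent M))) (≡.cong (_⊕ rowContent M) (E.comm e e′)))
  (≡.trans (E.assoc e′ e (rowContent M)) (≡.cong (λ r → e′ ⊕ (e ⊕ r)) (rowContent-cong p)))
  where
  open import Algebra.Structures using (IsCommutativeMonoid)
  module E = IsCommutativeMonoid ⊕-isCommutativeMonoid
  e = Vec.map indicator (elements J)
  e′ = Vec.map indicator (elements J′)
rowContent-cong (Perm.trans p q) = ≡.trans (rowContent-cong p) (rowContent-cong q)

module Independence {c ℓ : Level} (K : CommutativeRing c ℓ) (m n : ℕ) where

  private N = m ℕ.+ n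

  open Grassmannian K m n using (module Poly; coordinateRing; coordinateModule; monomial)
  open MonoidAlgebra K (⊕-isCommutativeMonoid {m} {N}) using (pair; pair-++; pair-neg; pair-embed-*; embed-0; at)
  open Evaluation K m n
  open LinearCombinations K coordinateModule (Monomials m n) monomial public
  open LinearCombinationProperties K coordinateModule (Monomials m n) monomial public
  private
    module K = CommutativeRing K
    module R = CommutativeRing coordinateRing
  open import Relation.Binary.Reasoning.Setoid K.setoid

  monomial-cong : ∀ {M M′} → M ↭ M′ → monomial M R.≈ monomial M′
  monomial-cong Perm.refl = R.refl
  monomial-cong (Perm.prep J p) = R.*-congˡ (monomial-cong p)
  monomial-cong (Perm.swap J J′ p) = R.trans (R.sym (R.*-assoc _ _ _))
    (R.trans (R.*-cong (R.*-comm _ _) (monomial-cong p)) (R.*-assoc _ _ _))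
  monomial-cong (Perm.trans p q) = R.trans (monomial-cong p) (monomial-cong q)

  leadingWeight : Monomial m n → ℕ
  leadingWeight M = weight 0 (rowContent M)

  infix 4 _≟ᵉ_
  _≟ᵉ_ : DecidableEquality (Exponent m N)
  _≟ᵉ_ = Vec.≡-dec (Vec.≡-dec ℕ._≟_)

  δ : Exponent m N → Exponent m N → K.Carrier
  δ ρ e = if does (e ≟ᵉ ρ) then K.1# else K.0#

  δ-≡ : ∀ {ρ e} → e ≡ ρ → δ ρ e ≡ K.1#
  δ-≡ {ρ} {e} p = ≡.cong (if_then K.1# else K.0#) (dec-true (e ≟ᵉ ρ) p)

  δ-≢ : ∀ {ρ e} → e ≢ ρ → δ ρ e ≡ K.0#
  δ-≢ {ρ} {e} p = ≡.cong (if_then K.1# else K.0#) (dec-false (e ≟ᵉ ρ) p)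

  δ-lower : ∀ {ρ w} → w ≤ weight 0 ρ → ∀ e → weight 0 e < w → δ ρ e K.≈ K.0#
  δ-lower {ρ} w≤ e e<w = K.reflexive (δ-≢ {ρ} {e} λ { ≡.refl → ℕ.<⇒≱ e<w w≤ })

  -- The coefficient in the image of f of the leading exponent of M.
  top : Monomial m n → Poly.Poly → K.Carrier
  top M f = pair (eval f) (δ (rowContent M))

  top-linear : ∀ M k f g → top M (Poly.con k Poly.* f Poly.+ g) K.≈ k K.* top M f K.+ top M g
  top-linear M k f g = K.trans (pair-++ (eval (Poly.con k Poly.* f)) (eval g) (δ (rowContent M)))
    (K.+-congʳ (pair-embed-* k (eval f) (δ (rowContent M))))

  top-monomial : ∀ M M′ → leadingWeight M′ ≤ leadingWeight M →
                 top M (monomial M′) K.≈ δ (rowContent M) (rowContent M′)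
  top-monomial M M′ M′≤M =
    Leads.value (eval-monomial-leads M′) (δ (rowContent M)) (δ-lower M′≤M)

  top-cong : ∀ M {f g} → f R.≈ g → top M f K.≈ top M g
  top-cong M f≈g = at (eval-resp f≈g) (δ (rowContent M))

  top-0 : ∀ M → top M R.0# K.≈ K.0#
  top-0 M = at embed-0 (δ (rowContent M))

  leadingWeight-cong : ∀ {M M′} → M ↭ M′ → leadingWeight M ≡ leadingWeight M′
  leadingWeight-cong p = ≡.cong (weight 0) (rowContent-cong p)

  Determined : ∀ {p} → Pred (Monomial m n) p → Set p
  Determined P = ∀ {M M′} → P M → P M′ → rowContent M ≡ rowContent M′ → M ↭ M′

  module LeadingExponents {p} {P : Pred (Monomial m n) p} (determined : Determined P) =
    Triangular {P = P} monomial-cong leadingWeight leadingWeight-cong top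
      top-cong top-linear top-0
      (λ {M} {M′} M↭M′ → K.trans (top-monomial M′ M (ℕ.≤-reflexive (leadingWeight-cong M↭M′)))
        (K.reflexive (δ-≡ (rowContent-cong M↭M′))))
      (λ {M} {M′} pM pM′ M≤M′ ¬M↭M′ → K.trans (top-monomial M′ M M≤M′)
        (K.reflexive (δ-≢ (¬M↭M′ ∘ determined pM pM′))))

  con-1-* : ∀ v → Poly.con (K.- K.1#) R.* v R.≈ R.- v
  con-1-* v = R.trans (R.*-congʳ (≈⇒∼ (Poly.con-neg K.1#))) (-1*x≈-x v)
    where
    open RingProperties R.ring using (-1*x≈-x)
    open Grassmannian.R K m n using (≈⇒∼)

  minus : Poly.Poly → Poly.Poly → Poly.Poly
  minus f g = f Poly.+ Poly.- g

  -- At an exponent of no smaller weight the two monomials are visible only through their common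
  -- leading exponent, where each has coefficient 1.
  top-difference : ∀ M M′ M₀ → rowContent M ≡ rowContent M′ → leadingWeight M ≤ leadingWeight M₀ →
    top M₀ (minus (monomial M) (monomial M′)) K.≈ K.0#
  top-difference M M′ M₀ eq M≤M₀ = begin
    top M₀ (minus (monomial M) (monomial M′))
      ≈⟨ pair-++ (eval (monomial M)) (eval (Poly.- monomial M′)) (δ (rowContent M₀)) ⟩
    top M₀ (monomial M) K.+ top M₀ (Poly.- monomial M′)
      ≈⟨ K.+-cong (top-monomial M₀ M M≤M₀) (pair-neg (eval (monomial M′)) (δ (rowContent M₀))) ⟩
    δ (rowContent M₀) (rowContent M) K.- top M₀ (monomial M′)
      ≈⟨ K.+-congˡ (K.-‿cong (top-monomial M₀ M′ (≡.subst (λ e → weight 0 e ≤ leadingWeight M₀) eq M≤M₀))) ⟩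
    δ (rowContent M₀) (rowContent M) K.- δ (rowContent M₀) (rowContent M′)
      ≈⟨ K.+-congˡ (K.-‿cong (K.reflexive (≡.cong (δ (rowContent M₀)) eq))) ⟨
    δ (rowContent M₀) (rowContent M) K.- δ (rowContent M₀) (rowContent M)
      ≈⟨ K.-‿inverseʳ _ ⟩
    K.0# ∎

  -- Monomials with equal row contents have equal leading exponents, so they differ
  -- by monomials of smaller weight.
  spanned-by-leading : ∀ {p q} {P : Pred (Monomial m n) p} {Q : Pred (Monomial m n) q} →
    Determined P → (∀ M → Spanned P (monomial M)) →
    (∀ {M} → P M → ∃ λ M′ → Q M′ × rowContent M ≡ rowContent M′) →
    ∀ {M} → P M → Spanned Q (monomial M)
  spanned-by-leading {P = P} {Q} determined spans match {M} pM =
    go M pM (<-wellFounded (leadingWeight M))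
    where
    go : ∀ M → P M → Acc ℕ._<_ (leadingWeight M) → Spanned Q (monomial M)
    go M pM (acc rec) = spanned-resp (R.trans
        (R.+-congʳ (R.sym (R.trans difference≈ value≈)))
        (R.trans (R.+-assoc _ _ _) (R.trans (R.+-congˡ (R.-‿inverseˡ _)) (R.+-identityʳ _))))
      (spanned-+ (spanned-value (descend reduct members lower)) (spanned-member qM′))
      where
      matched = match pM
      M′ = proj₁ matched
      qM′ = proj₁ (proj₂ matched)
      eq = proj₂ (proj₂ matched)
      -- The difference of M and M′ as a combination of members of P: M is one itself, and M′ is
      -- spanned by hypothesis. Only M has its leading exponent in P, so the reduction removes M
      -- together with everything else of its weight or more.
      spanned = spanned-+ (spanned-member {P = P} pM) (spanned-scale (K.- K.1#) (spans M′))
      d = proj₁ spanned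
      difference≈ : minus (monomial M) (monomial M′) R.≈ value d
      difference≈ = R.trans (R.+-congˡ (R.sym (con-1-* (monomial M′)))) (proj₂ (proj₂ spanned))
      open LeadingExponents determined
      open Reduction (reduce (leadingWeight M) d (proj₁ (proj₂ spanned)) λ {M₀} _ M≤M₀ →
        K.trans (K.sym (top-cong M₀ difference≈)) (top-difference M M′ M₀ eq M≤M₀))
      descend : ∀ l → ListAll.All (P ∘ proj₂) l → ListAll.All (λ (_ , M′) → leadingWeight M′ < leadingWeight M) l →
              ListAll.All (Spanned Q ∘ monomial ∘ proj₂) l
      descend []             []       []         = []
      descend ((_ , M′) ∷ l) (p ∷ ps) (lt ∷ lts) = go M′ p (rec lt) ∷ descend l ps lts

-- Cutting sequences of columns, and sums of the parts of a splitting

rest : ∀ {m} → Fin m → ℕ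
rest {suc m} zero    = m
rest {suc m} (suc k) = rest k

toℕ+rest : ∀ {m} (k : Fin m) → toℕ k ℕ.+ suc (rest k) ≡ m
toℕ+rest {suc m} zero    = ≡.refl
toℕ+rest {suc m} (suc k) = ≡.cong suc (toℕ+rest k)

suc-toℕ+rest : ∀ {m} (k : Fin m) → suc (toℕ k) ℕ.+ rest k ≡ m
suc-toℕ+rest k = ≡.trans (≡.sym (ℕ.+-suc (toℕ k) (rest k))) (toℕ+rest k)

module _ {a} {A : Set a} where

  before : ∀ {m} → Vec A m → (k : Fin m) → Vec A (toℕ k)
  before (x ∷ xs) zero    = []
  before (x ∷ xs) (suc k) = x ∷ before xs k

  upTo : ∀ {m} → Vec A m → (k : Fin m) → Vec A (suc (toℕ k))
  upTo (x ∷ xs) zero    = x ∷ []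
  upTo (x ∷ xs) (suc k) = x ∷ upTo xs k

  after : ∀ {m} → Vec A m → (k : Fin m) → Vec A (rest k)
  after {suc m} (x ∷ xs) zero    = xs
  after {suc m} (x ∷ xs) (suc k) = after xs k

  from : ∀ {m} → Vec A m → (k : Fin m) → Vec A (suc (rest k))
  from xs k = Vec.lookup xs k ∷ after xs k

  before++from : ∀ {m} (xs : Vec A m) k →
    Vec.cast (toℕ+rest k) (before xs k Vec.++ from xs k) ≡ xs
  before++from (x ∷ xs) zero    = ≡.cong (x ∷_) (Vec.cast-is-id ≡.refl xs)
  before++from (x ∷ xs) (suc k) = ≡.cong (x ∷_) (before++from xs k)

  upTo++after : ∀ {m} (xs : Vec A m) k →
    Vec.cast (suc-toℕ+rest k) (upTo xs k Vec.++ after xs k) ≡ xs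
  upTo++after (x ∷ xs) zero    = ≡.cong (x ∷_) (Vec.cast-is-id ≡.refl xs)
  upTo++after (x ∷ xs) (suc k) = ≡.cong (x ∷_) (upTo++after xs k)

module _ {N : ℕ} where

  from-≥ : ∀ {m} {vs : Vec (Fin N) m} → AllPairs Fin._<_ vs → ∀ k →
           All (Vec.lookup vs k Fin.≤_) (from vs k)
  from-≥ (v< ∷ inc) zero    = ℕ.≤-refl ∷ All.map ℕ.<⇒≤ v<
  from-≥ (v< ∷ inc) (suc k) = from-≥ inc k

  upTo-≤ : ∀ {m} {vs : Vec (Fin N) m} → AllPairs Fin._<_ vs → ∀ k →
           All (Fin._≤ Vec.lookup vs k) (upTo vs k)
  upTo-≤ (v< ∷ inc) zero    = ℕ.≤-refl ∷ []
  upTo-≤ (v< ∷ inc) (suc k) = ℕ.<⇒≤ (All.lookup⁺ v< k) ∷ upTo-≤ inc k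

  sumToℕ-++ : ∀ {i j} (us : Vec (Fin N) i) (vs : Vec (Fin N) j) →
    sumToℕ (us Vec.++ vs) ≡ sumToℕ us ℕ.+ sumToℕ vs
  sumToℕ-++ []       vs = ≡.refl
  sumToℕ-++ (u ∷ us) vs = ≡.trans (≡.cong (toℕ u ℕ.+_) (sumToℕ-++ us vs)) (≡.sym (ℕ.+-assoc (toℕ u) _ _))

  sumToℕ-cast : ∀ {i j} .(eq : i ≡ j) (vs : Vec (Fin N) i) → sumToℕ (Vec.cast eq vs) ≡ sumToℕ vs
  sumToℕ-cast {j = zero}  eq []       = ≡.refl
  sumToℕ-cast {j = suc j} eq (v ∷ vs) = ≡.cong (toℕ v ℕ.+_) (sumToℕ-cast (ℕ.suc-injective eq) vs)

  splittings-sum : ∀ t r {s} (vs : Vec (Fin N) s) →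
    ListAll.All (λ (_ , c′ , c″) → sumToℕ c′ ℕ.+ sumToℕ c″ ≡ sumToℕ vs) (splittings t r vs)
  splittings-sum t r vs = splittings-all (λ vs c′ c″ → sumToℕ c′ ℕ.+ sumToℕ c″ ≡ sumToℕ vs) ≡.refl
    (λ v {_} {_} {_} {_} {c′} eq → ≡.trans (ℕ.+-assoc (toℕ v) (sumToℕ c′) _) (≡.cong (toℕ v ℕ.+_) eq))
    (λ v {_} {_} {_} {_} {c′} {c″} eq → ≡.trans
      (solve 3 (λ a b c → a :+ (b :+ c) := b :+ (a :+ c)) ≡.refl (sumToℕ c′) (toℕ v) (sumToℕ c″))
      (≡.cong (toℕ v ℕ.+_) eq)) t r vs
    where open ℕ-Solver.+-*-Solver

  private
    Large Small : ℕ → ∀ {s} → Vec (Fin N) s → Set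
    Large θ = All (λ v → θ < toℕ v)
    Small θ = All (λ v → toℕ v ≤ θ)

  small-bound : ∀ {θ} t r {s} {vs : Vec (Fin N) s} → Small θ vs →
    ListAll.All (λ (_ , c′ , _) → sumToℕ c′ ≤ t ℕ.* θ) (splittings t r vs)
  small-bound {θ} t r {vs = vs} small = ListAll.map (λ bounded → bounded small)
    (splittings-all (λ vs {t} c′ _ → Small θ vs → sumToℕ c′ ≤ t ℕ.* θ) (λ _ → ℕ.z≤n)
      (λ { _ bounded (p ∷ ps) → ℕ.+-mono-≤ p (bounded ps) }) (λ { _ bounded (_ ∷ ps) → bounded ps }) t r vs)

  -- Choosing α + d entries means taking at least d small ones, each at most θ. Every large entry
  -- left out makes room for one more small entry, which is below it, so the bound with all of us
  -- taken persists: d grows by one and θ is paid for by the omitted entry.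
  large-bound : ∀ {θ} t r d {α β} → t ≡ α ℕ.+ d → {us : Vec (Fin N) α} {vs : Vec (Fin N) β} →
    Large θ us → Small θ vs →
    ListAll.All (λ (_ , c′ , _) → sumToℕ c′ ≤ sumToℕ us ℕ.+ d ℕ.* θ) (splittings t r (us Vec.++ vs))
  large-bound t r d ≡.refl [] small = small-bound t r small
  large-bound {θ} (suc t) r d {suc α} eq {u ∷ us} {vs} (p ∷ large) small =
    all-splittings-∷ (suc t) r u (us Vec.++ vs)
      (ListAll.map⁺ (ListAll.map (λ le → ℕ.≤-trans (ℕ.+-monoʳ-≤ (toℕ u) le)
          (ℕ.≤-reflexive (≡.sym (ℕ.+-assoc (toℕ u) _ _))))
        (large-bound t r d (ℕ.suc-injective eq) large small)))
      (right r)
    where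
    open ℕ-Solver.+-*-Solver
    right : ∀ r → ListAll.All (λ (_ , c′ , _) → sumToℕ c′ ≤ sumToℕ (u ∷ us) ℕ.+ d ℕ.* θ)
                    (rightFirst (suc t) r (u ∷ us Vec.++ vs))
    right zero    = []
    right (suc r) = ListAll.map⁺ (ListAll.map (λ {(_ , c′ , _)} le → begin
        sumToℕ c′                              ≤⟨ le ⟩
        sumToℕ us ℕ.+ (θ ℕ.+ d ℕ.* θ)          ≡⟨ solve 3 (λ a b c → a :+ (b :+ c) := b :+ a :+ c) ≡.refl (sumToℕ us) θ (d ℕ.* θ) ⟩
        θ ℕ.+ sumToℕ us ℕ.+ d ℕ.* θ            ≤⟨ ℕ.+-monoˡ-≤ (d ℕ.* θ) (ℕ.+-monoˡ-≤ (sumToℕ us) (ℕ.<⇒≤ p)) ⟩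
        toℕ u ℕ.+ sumToℕ us ℕ.+ d ℕ.* θ        ∎)
      (large-bound (suc t) r (suc d) (≡.trans eq (≡.sym (ℕ.+-suc α d))) large small))
      where open ℕ.≤-Reasoning

  -- The splitting listed first leaves us on the left, with sign exponent 0. Any other one trades an
  -- entry above θ for one at most θ, so its left sum drops. Thus a Plücker relation can be solved
  -- for its first term.
  splittings-head : ∀ {θ α β} (us : Vec (Fin N) α) (vs : Vec (Fin N) β) → Large θ us → Small θ vs →
    ∃ λ L → splittings α β (us Vec.++ vs) ≡ (0 , us , vs) ∷ L ×
            ListAll.All (λ (_ , c′ , _) → sumToℕ c′ < sumToℕ us) L
  splittings-head [] []       _ _ = [] , ≡.refl , []
  splittings-head [] (v ∷ vs) large (_ ∷ small) with splittings-head [] vs large small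
  ... | [] , eq , [] = [] , ≡.cong (List.map _) eq , []
  -- With us empty the bound on the left sum is zero, so a further splitting would have to beat zero
  -- strictly.
  ... | _ ∷ _ , _ , () ∷ _
  splittings-head {θ} {suc α} {β} (u ∷ us) vs (p ∷ large) small with splittings-head us vs large small
  ... | L , eq , below =
    List.map (λ (k , c′ , c″) → k , u ∷ c′ , c″) L ++ rightFirst (suc α) β (u ∷ us Vec.++ vs) ,
    ≡.cong (λ L′ → List.map (λ (k , c′ , c″) → k , u ∷ c′ , c″) L′ ++ rightFirst (suc α) β (u ∷ us Vec.++ vs)) eq ,
    ListAll.++⁺ (ListAll.map⁺ (ListAll.map (ℕ.+-monoʳ-< (toℕ u)) below)) (right β)
    where
    right : ∀ r → ListAll.All (λ (_ , c′ , _) → sumToℕ c′ < sumToℕ (u ∷ us))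
                    (rightFirst (suc α) r (u ∷ us Vec.++ vs))
    right zero    = []
    right (suc r) = ListAll.map⁺ (ListAll.map (λ {(_ , c′ , _)} le → begin-strict
        sumToℕ c′                   ≤⟨ le ⟩
        sumToℕ us ℕ.+ (θ ℕ.+ 0)     ≡⟨ ≡.cong (sumToℕ us ℕ.+_) (ℕ.+-identityʳ θ) ⟩
        sumToℕ us ℕ.+ θ             ≡⟨ ℕ.+-comm (sumToℕ us) θ ⟩
        θ ℕ.+ sumToℕ us             <⟨ ℕ.+-monoˡ-< (sumToℕ us) p ⟩
        toℕ u ℕ.+ sumToℕ us         ∎)
      -- d = 1: with u sent to the right, α large entries remain for α + 1 places on the left.
      (large-bound (suc α) r 1 (ℕ.+-comm 1 α) large small))
      where open ℕ.≤-Reasoning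

-- Standard monomials, and a measure for straightening

module _ {m N : ℕ} where

  infix 8 _‼_
  _‼_ : Subset m N → Fin m → Fin N
  J ‼ k = Vec.lookup (elements J) k

  infix 4 _≼_ _≼?_
  _≼_ : Subset m N → Subset m N → Set
  J ≼ J′ = ∀ k → J ‼ k Fin.≤ J′ ‼ k

  _≼?_ : ∀ J J′ → Dec (J ≼ J′)
  J ≼? J′ = Fin.all? (λ k → J ‼ k Fin.≤? J′ ‼ k)

  ≰⇒index : ∀ {J J′} → ¬ J ≼ J′ → ∃ λ k → J′ ‼ k Fin.< J ‼ k
  ≰⇒index {J} {J′} J⋠J′ =
    let k , J≰J′ = Fin.¬∀⟶∃¬ m _ (λ k → J ‼ k Fin.≤? J′ ‼ k) J⋠J′ in k , ℕ.≰⇒> J≰J′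

  Standard : List (Subset m N) → Set
  Standard = ListPairs.AllPairs _≼_

  total : Subset m N → ℕ
  total J = sumToℕ (elements J)

  -- The factor a is the one with the smaller sum, since the exchange lowers the sum of a and the
  -- sums must move apart. Incomparable factors exceed each other in both directions, so whichever
  -- of them is a, it exceeds b somewhere.
  record Straightenable (M : List (Subset m N)) : Set where
    field
      a b     : Subset m N
      others  : List (Subset m N)
      split   : M ↭ a ∷ b ∷ others
      total≤  : total a ≤ total b
      k       : Fin m
      descent : b ‼ k Fin.< a ‼ k

  private
    incomparable : ∀ {J J′} M → ¬ J ≼ J′ → ¬ J′ ≼ J → Straightenable (J ∷ J′ ∷ M)
    incomparable {J} {J′} M J⋠J′ J′⋠J with ℕ.≤-total (total J) (total J′)
    ... | inj₁ ≤ = let k , lt = ≰⇒index {J} {J′} J⋠J′ in record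
      { a = J ; b = J′ ; others = M ; split = Perm.refl ; total≤ = ≤ ; k = k ; descent = lt }
    ... | inj₂ ≥ = let k , lt = ≰⇒index {J′} {J} J′⋠J in record
      { a = J′ ; b = J ; others = M ; split = Perm.swap J J′ Perm.refl ; total≤ = ≥ ; k = k ; descent = lt }

    extend : ∀ {M M′} J → M′ ↭ J ∷ M → Straightenable M → Straightenable M′
    extend J p S = record
      { Straightenable S ; others = J ∷ S.others
      ; split = Perm.trans p (Perm.trans (Perm.prep J S.split)
          (Perm.trans (Perm.swap J S.a Perm.refl) (Perm.prep S.a (Perm.swap J S.b Perm.refl)))) }
      where module S = Straightenable S

    insert-standard : ∀ J {T} → Standard T →
      (∃ λ T′ → Standard T′ × J ∷ T ↭ T′) ⊎ Straightenable (J ∷ T)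
    insert-standard J [] = inj₁ (J ∷ [] , [] ∷ [] , Perm.refl)
    insert-standard J {J′ ∷ T} (J′≼ ∷ std) with J ≼? J′ | J′ ≼? J
    ... | yes J≼J′ | _ = inj₁ (J ∷ J′ ∷ T ,
      (J≼J′ ∷ ListAll.map (λ J′≼J″ k → ℕ.≤-trans (J≼J′ k) (J′≼J″ k)) J′≼) ∷ J′≼ ∷ std , Perm.refl)
    ... | no J⋠J′ | no J′⋠J = inj₂ (incomparable T J⋠J′ J′⋠J)
    ... | no _ | yes J′≼J with insert-standard J std
    ...   | inj₁ (T′ , std′ , p) = inj₁ (J′ ∷ T′ ,
      Perm.All-resp-↭ p (J′≼J ∷ J′≼) ∷ std′ , Perm.trans (Perm.swap J J′ Perm.refl) (Perm.prep J′ p))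
    ...   | inj₂ S = inj₂ (extend J′ (Perm.swap J J′ Perm.refl) S)

  -- Insertion sort for a partial order: either it ends in a chain, or it meets two incomparable
  -- factors.
  standard-or-straightenable : ∀ M → (∃ λ T → Standard T × M ↭ T) ⊎ Straightenable M
  standard-or-straightenable [] = inj₁ ([] , [] , Perm.refl)
  standard-or-straightenable (J ∷ M) with standard-or-straightenable M
  ... | inj₂ S = inj₂ (extend J Perm.refl S)
  ... | inj₁ (T , std , p) with insert-standard J std
  ...   | inj₁ (T′ , std′ , p′) = inj₁ (T′ , std′ , Perm.trans (Perm.prep J p) p′)
  ...   | inj₂ S = inj₂ (record { Straightenable S ; split = Perm.trans (Perm.prep J p) (Straightenable.split S) })

  sumTotal pairTotal : List (Subset m N) → ℕ
  sumTotal []      = 0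
  sumTotal (J ∷ M) = total J ℕ.+ sumTotal M
  -- The second elementary symmetric function of the totals. It decreases under
  -- straightening since the totals of the two factors move apart.
  pairTotal []      = 0
  pairTotal (J ∷ M) = total J ℕ.* sumTotal M ℕ.+ pairTotal M

  sumTotal-cong : ∀ {M M′} → M ↭ M′ → sumTotal M ≡ sumTotal M′
  sumTotal-cong Perm.refl          = ≡.refl
  sumTotal-cong (Perm.prep J p)    = ≡.cong (total J ℕ.+_) (sumTotal-cong p)
  sumTotal-cong (Perm.swap {xs = M} J J′ p) = ≡.trans
    (solve 3 (λ a b c → a :+ (b :+ c) := b :+ (a :+ c)) ≡.refl (total J) (total J′) (sumTotal M))
    (≡.cong (λ s → total J′ ℕ.+ (total J ℕ.+ s)) (sumTotal-cong p))
    where open ℕ-Solver.+-*-Solver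
  sumTotal-cong (Perm.trans p q)   = ≡.trans (sumTotal-cong p) (sumTotal-cong q)

  pairTotal-cong : ∀ {M M′} → M ↭ M′ → pairTotal M ≡ pairTotal M′
  pairTotal-cong Perm.refl          = ≡.refl
  pairTotal-cong (Perm.prep J p)    =
    ≡.cong₂ (λ s e → total J ℕ.* s ℕ.+ e) (sumTotal-cong p) (pairTotal-cong p)
  pairTotal-cong (Perm.swap {xs = M} J J′ p) = ≡.trans
    (solve 4 (λ a b s e → a :* (b :+ s) :+ (b :* s :+ e) := b :* (a :+ s) :+ (a :* s :+ e)) ≡.refl
      (total J) (total J′) (sumTotal M) (pairTotal M))
    (≡.cong₂ (λ s e → total J′ ℕ.* (total J ℕ.+ s) ℕ.+ (total J ℕ.* s ℕ.+ e))
      (sumTotal-cong p) (pairTotal-cong p))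
    where open ℕ-Solver.+-*-Solver
  pairTotal-cong (Perm.trans p q)   = ≡.trans (pairTotal-cong p) (pairTotal-cong q)

  product-< : ∀ {x y a b} → x < a → a ≤ b → x ℕ.+ y ≡ a ℕ.+ b → x ℕ.* y < a ℕ.* b
  product-< {x} {y} {a} {b} x<a a≤b eq with ℕ.m≤n⇒∃[o]m+o≡n x<a
  ... | d , ≡.refl = begin-strict
    x ℕ.* y                             ≡⟨ ≡.cong (x ℕ.*_) y≡ ⟩
    x ℕ.* (suc d ℕ.+ b)                 ≡⟨ solve 3 (λ x d b → x :* (d :+ b) := d :* x :+ x :* b) ≡.refl x (suc d) b ⟩
    suc d ℕ.* x ℕ.+ x ℕ.* b             <⟨ ℕ.+-monoˡ-< (x ℕ.* b) (ℕ.*-monoʳ-< (suc d) (ℕ.<-≤-trans x<a a≤b)) ⟩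
    suc d ℕ.* b ℕ.+ x ℕ.* b             ≡⟨ solve 3 (λ x d b → (con 1 :+ d) :* b :+ x :* b := (con 1 :+ x :+ d) :* b) ≡.refl x d b ⟩
    suc (x ℕ.+ d) ℕ.* b                 ∎
    where
    open ℕ.≤-Reasoning
    open ℕ-Solver.+-*-Solver
    y≡ : y ≡ suc d ℕ.+ b
    y≡ = ℕ.+-cancelˡ-≡ x y (suc d ℕ.+ b) (≡.trans eq
      (solve 3 (λ x d b → (con 1 :+ x :+ d) :+ b := x :+ (con 1 :+ d :+ b)) ≡.refl x d b))

  pairTotal-< : ∀ {x y a b} M → total x < total a → total a ≤ total b →
    total x ℕ.+ total y ≡ total a ℕ.+ total b → pairTotal (x ∷ y ∷ M) < pairTotal (a ∷ b ∷ M)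
  pairTotal-< {x} {y} {a} {b} M x<a a≤b eq = begin-strict
    pairTotal (x ∷ y ∷ M)
      ≡⟨ expand (total x) (total y) ⟩
    total x ℕ.* total y ℕ.+ ((total x ℕ.+ total y) ℕ.* sumTotal M ℕ.+ pairTotal M)
      ≡⟨ ≡.cong (λ s → total x ℕ.* total y ℕ.+ (s ℕ.* sumTotal M ℕ.+ pairTotal M)) eq ⟩
    total x ℕ.* total y ℕ.+ ((total a ℕ.+ total b) ℕ.* sumTotal M ℕ.+ pairTotal M)
      <⟨ ℕ.+-monoˡ-< _ (product-< x<a a≤b eq) ⟩
    total a ℕ.* total b ℕ.+ ((total a ℕ.+ total b) ℕ.* sumTotal M ℕ.+ pairTotal M)
      ≡⟨ expand (total a) (total b) ⟨
    pairTotal (a ∷ b ∷ M) ∎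
    where
    open ℕ.≤-Reasoning
    open ℕ-Solver.+-*-Solver
    expand : ∀ u v → u ℕ.* (v ℕ.+ sumTotal M) ℕ.+ (v ℕ.* sumTotal M ℕ.+ pairTotal M) ≡
                     u ℕ.* v ℕ.+ ((u ℕ.+ v) ℕ.* sumTotal M ℕ.+ pairTotal M)
    expand u v = solve 4 (λ u v s e → u :* (v :+ s) :+ (v :* s :+ e) := u :* v :+ ((u :+ v) :* s :+ e))
      ≡.refl u v (sumTotal M) (pairTotal M)

-- Straightening along the Plücker relations

module Straightening {c ℓ : Level} (K : CommutativeRing c ℓ) (m n : ℕ) where

  private N = m ℕ.+ n

  open Grassmannian K m n using (module Poly; module R; bracket; signed; monomial; plücker;
    coordinateRing; coordinateModule)
  open Poly using (_*_)
  open Independence K m n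
  private
    module K = CommutativeRing K
    module A = CommutativeRing coordinateRing
  open RingProperties A.ring using (-‿distribˡ-*; +-inverseˡ-unique)
  open CommutativeSemigroupProperties A.*-commutativeSemigroup using (x∙yz≈y∙xz)

  bracket-cases : ∀ s → (∃ λ J → total J ≡ sumToℕ s × bracket s ≡ signed (inversions s) (Poly.var J))
                        ⊎ bracket s ≡ Poly.con K.0#
  bracket-cases s with allPairs? Fin._<?_ (sort s)
  ... | yes inc = inj₁ (subset (sort s) inc , sumToℕ-sort s , ≡.refl)
  ... | no  _   = inj₂ ≡.refl

  bracket-elements : ∀ J → bracket (elements J) ≡ Poly.var J
  bracket-elements (subset vs inc) with allPairs? Fin._<?_ (sort vs)
  ... | yes inc′ = ≡.cong₂ signed (inversions-increasing (elements-increasing (subset vs inc)))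
    (≡.cong Poly.var (same (sort-increasing (elements-increasing (subset vs inc))) inc′))
    where
    same : ∀ {us} → us ≡ vs → .(inc′ : AllPairs Fin._<_ us) → subset us inc′ ≡ subset vs inc
    same ≡.refl _ = ≡.refl
  ... | no ¬inc = contradiction
    (≡.subst (AllPairs Fin._<_) (≡.sym (sort-increasing inc₀)) inc₀) ¬inc
    where inc₀ = elements-increasing (subset vs inc)

  module _ {p} {P : Pred (Monomial m n) p} where

    spanned-neg : ∀ f → Spanned P f → Spanned P (Poly.- f)
    spanned-neg f s = spanned-resp (con-1-* f) (spanned-scale (K.- K.1#) s)

    spanned-signed-* : ∀ k f g → Spanned P (f * g) → Spanned P (signed k f * g)
    spanned-signed-* zero    f g s = s
    spanned-signed-* (suc k) f g s = spanned-resp (-‿distribˡ-* (signed k f) g)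
      (spanned-neg (signed k f * g) (spanned-signed-* k f g s))

    spanned-zero-* : ∀ g → Spanned P (Poly.con K.0# * g)
    spanned-zero-* g = spanned-resp (A.sym (A.zeroˡ g)) spanned-0

    -- Each bracket is a signed coordinate or zero. Sorting its columns keeps their sum, so
    -- membership in P can be required in terms of sums alone.
    spanned-brackets : ∀ k s s′ M →
      (∀ {x y} → total x ≡ sumToℕ s → total y ≡ sumToℕ s′ → P (x ∷ y ∷ M)) →
      Spanned P (signed k (bracket s * bracket s′) * monomial M)
    spanned-brackets k s s′ M member =
      spanned-signed-* k (bracket s * bracket s′) (monomial M)
        (spanned-resp (A.sym (A.*-assoc (bracket s) (bracket s′) (monomial M)))
          (outer (bracket-cases s)))
      where
      inner : ∀ {x} → total x ≡ sumToℕ s →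
        (∃ λ y → total y ≡ sumToℕ s′ × bracket s′ ≡ signed (inversions s′) (Poly.var y)) ⊎
        bracket s′ ≡ Poly.con K.0# →
        Spanned P (bracket s′ * (Poly.var x * monomial M))
      inner {x} x≡ (inj₁ (y , y≡ , eq)) =
        ≡.subst (λ B → Spanned P (B * (Poly.var x * monomial M))) (≡.sym eq)
          (spanned-signed-* (inversions s′) (Poly.var y) (Poly.var x * monomial M)
            (spanned-resp (monomial-cong (Perm.swap {xs = M} x y Perm.refl))
              (spanned-member (member x≡ y≡))))
      inner {x} _ (inj₂ eq) =
        ≡.subst (λ B → Spanned P (B * (Poly.var x * monomial M))) (≡.sym eq)
          (spanned-zero-* (Poly.var x * monomial M))

      outer : (∃ λ x → total x ≡ sumToℕ s × bracket s ≡ signed (inversions s) (Poly.var x)) ⊎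
        bracket s ≡ Poly.con K.0# →
        Spanned P (bracket s * (bracket s′ * monomial M))
      outer (inj₁ (x , x≡ , eq)) =
        ≡.subst (λ B → Spanned P (B * (bracket s′ * monomial M))) (≡.sym eq)
          (spanned-signed-* (inversions s) (Poly.var x) (bracket s′ * monomial M)
            (spanned-resp (x∙yz≈y∙xz (bracket s′) (Poly.var x) (monomial M))
              (inner x≡ (bracket-cases s′))))
      outer (inj₂ eq) =
        ≡.subst (λ B → Spanned P (B * (bracket s′ * monomial M))) (≡.sym eq)
          (spanned-zero-* (bracket s′ * monomial M))

  Lower : (a b : Subset m N) → Monomial m n → Pred (Monomial m n) _
  Lower a b M M′ = ∃₂ λ x y →
    M′ ≡ x ∷ y ∷ M × total x < total a × total x ℕ.+ total y ≡ total a ℕ.+ total b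

  -- By the Plücker relation in which the entries of a from index k on, all larger,
  -- are exchanged with those of b up to index k.
  exchange : ∀ a b k → b ‼ k Fin.< a ‼ k → ∀ M → Spanned (Lower a b M) (monomial (a ∷ b ∷ M))
  exchange a b k b<a M = spanned-resp (A.sym monomial≈)
    (spanned-neg (sumTerms rest′ * monomial M) (spanned-sum rest′ sums))
    where
    u₁ = before (elements a) k
    a₂ = from (elements a) k
    b₁ = upTo (elements b) k
    u₂ = after (elements b) k
    c′ = a₂ Vec.++ b₁

    s₁ : Vec (Fin N) (suc (rest k)) → Vec (Fin N) m
    s₁ v = Vec.cast (toℕ+rest k) (u₁ Vec.++ v)
    s₂ : Vec (Fin N) (suc (toℕ k)) → Vec (Fin N) m
    s₂ v = Vec.cast (suc-toℕ+rest k) (v Vec.++ u₂)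

    Splitting = ℕ × Vec (Fin N) (suc (rest k)) × Vec (Fin N) (suc (toℕ k))

    term : Splitting → Poly.Poly
    term (j , v , w) = signed j (bracket (s₁ v) * bracket (s₂ w))

    sumTerms : List Splitting → Poly.Poly
    sumTerms L = List.foldr Poly._+_ (Poly.con K.0#) (List.map term L)

    -- There are m - k entries in a₂ and k + 1 in b₁, together m + 1, just enough for a relation.
    m< : m < suc (rest k) ℕ.+ suc (toℕ k)
    m< = ℕ.≤-reflexive (≡.trans (≡.cong suc (≡.sym (suc-toℕ+rest k)))
      (solve 2 (λ x y → con 1 :+ (con 1 :+ x :+ y) := (con 1 :+ y) :+ (con 1 :+ x)) ≡.refl (toℕ k) (rest k)))
      where open ℕ-Solver.+-*-Solver

    relation : sumTerms (splittings (suc (rest k)) (suc (toℕ k)) c′) A.≈ A.0#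
    relation = R.mod (R.resp (Poly.sym (Poly.trans (Poly.+-cong Poly.refl -0#≈0#)
      (P.+-identityʳ _))) (R.generator (plücker (toℕ+rest k) (suc-toℕ+rest k) m< u₁ c′ u₂)))
      where
      module P = CommutativeRing Poly.commutativeRing
      open RingProperties P.ring using (-0#≈0#)

    head : ∃ λ L → splittings (suc (rest k)) (suc (toℕ k)) c′ ≡ (0 , a₂ , b₁) ∷ L ×
      ListAll.All (λ (_ , v , _) → sumToℕ v < sumToℕ a₂) L
    -- The threshold θ is `b ‼ k`: b₁ ends there, and `b<a` puts all of a₂ above it.
    head = splittings-head a₂ b₁
      (All.map (ℕ.<-≤-trans b<a) (from-≥ (elements-increasing a) k))
      (upTo-≤ (elements-increasing b) k)

    rest′ = proj₁ head

    sums : ListAll.All (λ (_ , v , w) → sumToℕ v < sumToℕ a₂ ×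
             sumToℕ v ℕ.+ sumToℕ w ≡ sumToℕ a₂ ℕ.+ sumToℕ b₁) rest′
    sums = ListAll.zip (proj₂ (proj₂ head) , ListAll.map (λ eq → ≡.trans eq (sumToℕ-++ a₂ b₁))
      (ListAll.tail (≡.subst (ListAll.All _) (proj₁ (proj₂ head))
        (splittings-sum (suc (rest k)) (suc (toℕ k)) c′))))

    sum-s₁ : ∀ v → sumToℕ (s₁ v) ≡ sumToℕ u₁ ℕ.+ sumToℕ v
    sum-s₁ v = ≡.trans (sumToℕ-cast (toℕ+rest k) (u₁ Vec.++ v)) (sumToℕ-++ u₁ v)

    sum-s₂ : ∀ w → sumToℕ (s₂ w) ≡ sumToℕ w ℕ.+ sumToℕ u₂
    sum-s₂ w = ≡.trans (sumToℕ-cast (suc-toℕ+rest k) (w Vec.++ u₂)) (sumToℕ-++ w u₂)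

    s₁≡a : s₁ a₂ ≡ elements a
    s₁≡a = before++from (elements a) k

    s₂≡b : s₂ b₁ ≡ elements b
    s₂≡b = upTo++after (elements b) k

    member : ∀ {v w x y} → sumToℕ v < sumToℕ a₂ →
      sumToℕ v ℕ.+ sumToℕ w ≡ sumToℕ a₂ ℕ.+ sumToℕ b₁ →
      total x ≡ sumToℕ (s₁ v) → total y ≡ sumToℕ (s₂ w) → Lower a b M (x ∷ y ∷ M)
    member {v} {w} {x} {y} v< eq x≡ y≡ = x , y , ≡.refl ,
      ≡.subst₂ ℕ._<_ (≡.sym (≡.trans x≡ (sum-s₁ v)))
        (≡.trans (≡.sym (sum-s₁ a₂)) (≡.cong sumToℕ s₁≡a)) (ℕ.+-monoʳ-< (sumToℕ u₁) v<) ,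
      (begin
        total x ℕ.+ total y
          ≡⟨ ≡.cong₂ ℕ._+_ (≡.trans x≡ (sum-s₁ v)) (≡.trans y≡ (sum-s₂ w)) ⟩
        (sumToℕ u₁ ℕ.+ sumToℕ v) ℕ.+ (sumToℕ w ℕ.+ sumToℕ u₂)
          ≡⟨ regroup (sumToℕ u₁) (sumToℕ v) (sumToℕ w) (sumToℕ u₂) ⟩
        sumToℕ u₁ ℕ.+ (sumToℕ v ℕ.+ sumToℕ w) ℕ.+ sumToℕ u₂
          ≡⟨ ≡.cong (λ s → sumToℕ u₁ ℕ.+ s ℕ.+ sumToℕ u₂) eq ⟩
        sumToℕ u₁ ℕ.+ (sumToℕ a₂ ℕ.+ sumToℕ b₁) ℕ.+ sumToℕ u₂
          ≡⟨ regroup (sumToℕ u₁) (sumToℕ a₂) (sumToℕ b₁) (sumToℕ u₂) ⟨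
        (sumToℕ u₁ ℕ.+ sumToℕ a₂) ℕ.+ (sumToℕ b₁ ℕ.+ sumToℕ u₂)
          ≡⟨ ≡.cong₂ ℕ._+_ (≡.trans (≡.sym (sum-s₁ a₂)) (≡.cong sumToℕ s₁≡a))
               (≡.trans (≡.sym (sum-s₂ b₁)) (≡.cong sumToℕ s₂≡b)) ⟩
        total a ℕ.+ total b ∎)
      where
      open ≡.≡-Reasoning
      regroup : ∀ p q r s → (p ℕ.+ q) ℕ.+ (r ℕ.+ s) ≡ p ℕ.+ (q ℕ.+ r) ℕ.+ s
      regroup = solve 4 (λ p q r s → (p :+ q) :+ (r :+ s) := p :+ (q :+ r) :+ s) ≡.refl
        where open ℕ-Solver.+-*-Solver

    spanned-sum : ∀ L → ListAll.All (λ (_ , v , w) → sumToℕ v < sumToℕ a₂ ×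
        sumToℕ v ℕ.+ sumToℕ w ≡ sumToℕ a₂ ℕ.+ sumToℕ b₁) L →
      Spanned (Lower a b M) (sumTerms L * monomial M)
    spanned-sum [] [] = spanned-zero-* (monomial M)
    spanned-sum ((j , v , w) ∷ L) ((v< , eq) ∷ ps) =
      spanned-resp (A.sym (A.distribʳ (monomial M) (term (j , v , w)) (sumTerms L)))
        (spanned-+ (spanned-brackets j (s₁ v) (s₂ w) M (member v< eq)) (spanned-sum L ps))

    leading : term (0 , a₂ , b₁) ≡ Poly.var a * Poly.var b
    leading = ≡.cong₂ _*_ (≡.trans (≡.cong bracket s₁≡a) (bracket-elements a))
      (≡.trans (≡.cong bracket s₂≡b) (bracket-elements b))

    product≈ : Poly.var a * Poly.var b A.≈ Poly.- sumTerms rest′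
    product≈ = A.trans (A.reflexive (≡.sym leading))
      (+-inverseˡ-unique (term (0 , a₂ , b₁)) (sumTerms rest′)
        (≡.subst (λ L → sumTerms L A.≈ A.0#) (proj₁ (proj₂ head)) relation))

    monomial≈ : monomial (a ∷ b ∷ M) A.≈ Poly.- (sumTerms rest′ * monomial M)
    monomial≈ = A.trans (A.sym (A.*-assoc (Poly.var a) (Poly.var b) (monomial M)))
      (A.trans (A.*-congʳ product≈) (A.sym (-‿distribˡ-* (sumTerms rest′) (monomial M))))

  straighten : ∀ M → Spanned Standard (monomial M)
  straighten M = go M (<-wellFounded (pairTotal M))
    where
    go : ∀ M → Acc ℕ._<_ (pairTotal M) → Spanned Standard (monomial M)
    step : ∀ {M} → Acc ℕ._<_ (pairTotal M) →
      (∃ λ T → Standard T × M ↭ T) ⊎ Straightenable M → Spanned Standard (monomial M)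
    go M wf = step wf (standard-or-straightenable M)
    step _ (inj₁ (T , std , p)) = spanned-resp (A.sym (monomial-cong p)) (spanned-member std)
    step {M} (acc rec) (inj₂ S) = spanned-resp (A.sym (monomial-cong split))
      (spanned-trans (λ { {j} (x , y , ≡.refl , x<a , eq) → go (x ∷ y ∷ others)
          (rec (≡.subst (pairTotal (x ∷ y ∷ others) ℕ.<_) (≡.sym (pairTotal-cong split))
            (pairTotal-< {x = x} {y} {a} {b} others x<a total≤ eq))) })
        (exchange a b k descent others))
      where open Straightenable S

-- Counting by finite sums, injections of finite sets, ranks

Injection : ∀ {a b} → (Fin a → Fin b) → Set
Injection f = ∀ {x y} → f x ≡ f y → x ≡ y

mark : ∀ {p} {P : Set p} → Dec P → ℕ
mark P? = if does P? then 1 else 0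

mark-yes : ∀ {p} {P : Set p} (P? : Dec P) → P → mark P? ≡ 1
mark-yes P? p = ≡.cong (if_then 1 else 0) (dec-true P? p)

mark-no : ∀ {p} {P : Set p} (P? : Dec P) → ¬ P → mark P? ≡ 0
mark-no P? ¬p = ≡.cong (if_then 1 else 0) (dec-false P? ¬p)

mark-≤ : ∀ {p q} {P : Set p} {Q : Set q} (P? : Dec P) (Q? : Dec Q) → (P → Q) → mark P? ≤ mark Q?
mark-≤ (no _)  Q? P⇒Q = ℕ.z≤n
mark-≤ (yes p) Q? P⇒Q = ℕ.≤-reflexive (≡.sym (mark-yes Q? (P⇒Q p)))

mark-< : ∀ {p q} {P : Set p} {Q : Set q} (P? : Dec P) (Q? : Dec Q) → ¬ P → Q → mark P? < mark Q?
mark-< P? Q? ¬p q = ≡.subst₂ ℕ._<_ (≡.sym (mark-no P? ¬p)) (≡.sym (mark-yes Q? q)) ℕ.≤-refl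

mark-⇔ : ∀ {p q} {P : Set p} {Q : Set q} (P? : Dec P) (Q? : Dec Q) → (P → Q) → (Q → P) → mark P? ≡ mark Q?
mark-⇔ P? Q? P⇒Q Q⇒P = ℕ.≤-antisym (mark-≤ P? Q? P⇒Q) (mark-≤ Q? P? Q⇒P)

sum-≤ : ∀ {h} {f g : Fin h → ℕ} → (∀ i → f i ≤ g i) → sum f ≤ sum g
sum-≤ {zero}  f≤g = ℕ.z≤n
sum-≤ {suc h} f≤g = ℕ.+-mono-≤ (f≤g zero) (sum-≤ (f≤g ∘ suc))

sum-< : ∀ {h} {f g : Fin h → ℕ} → (∀ i → f i ≤ g i) → ∀ i → f i < g i → sum f < sum g
sum-< f≤g zero    lt = ℕ.+-mono-<-≤ lt (sum-≤ (f≤g ∘ suc))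
sum-< f≤g (suc i) lt = ℕ.+-mono-≤-< (f≤g zero) (sum-< (f≤g ∘ suc) i lt)

sum-1 : ∀ h → sum {h} (λ _ → 1) ≡ h
sum-1 zero    = ≡.refl
sum-1 (suc h) = ≡.cong suc (sum-1 h)

sum-δ : ∀ {h} (g : Fin h → ℕ) i → sum (λ j → g j ℕ.* mark (i Fin.≟ j)) ≡ g i
sum-δ {suc h} g zero = ≡.trans (≡.cong₂ ℕ._+_ (ℕ.*-identityʳ (g zero))
  (≡.trans (sum-cong-≗ (λ j → ℕ.*-zeroʳ (g (suc j)))) (sum-replicate-zero h))) (ℕ.+-identityʳ _)
sum-δ {suc h} g (suc i) = ≡.trans
  (≡.cong₂ ℕ._+_ (ℕ.*-zeroʳ (g zero)) (sum-cong-≗ λ j → ≡.cong (g (suc j) ℕ.*_)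
    (mark-⇔ (suc i Fin.≟ suc j) (i Fin.≟ j) Fin.suc-injective (≡.cong suc))))
  (sum-δ (g ∘ suc) i)

sum-↑ : ∀ a {b} (f : Fin (a ℕ.+ b) → ℕ) → sum f ≡ sum (λ i → f (i Fin.↑ˡ b)) ℕ.+ sum (λ j → f (a Fin.↑ʳ j))
sum-↑ zero    f = ≡.refl
sum-↑ (suc a) f = ≡.trans (≡.cong (f zero ℕ.+_) (sum-↑ a (f ∘ suc))) (≡.sym (ℕ.+-assoc (f zero) _ _))

sum-combine : ∀ a {b} (f : Fin (a ℕ.* b) → ℕ) → sum f ≡ sum (λ (i : Fin a) → sum (λ (j : Fin b) → f (Fin.combine i j)))
sum-combine zero        f = ≡.refl
sum-combine (suc a) {b} f = ≡.trans (sum-↑ b f)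
  (≡.cong (sum (λ j → f (j Fin.↑ˡ (a ℕ.* b))) ℕ.+_) (sum-combine a (λ e → f (b Fin.↑ʳ e))))

sum-filter : ∀ {a p} {A : Set a} {P : Pred A p} (P? : Decidable P) (g : A → ℕ) {h} (f : Fin h → A) →
  ℕ.sum (List.map g (List.filter P? (List.tabulate f))) ≡ sum (λ i → mark (P? (f i)) ℕ.* g (f i))
sum-filter P? g {zero}  f = ≡.refl
sum-filter P? g {suc h} f with does (P? (f zero))
... | true  = ≡.cong₂ ℕ._+_ (≡.sym (ℕ.+-identityʳ _)) (sum-filter P? g (f ∘ suc))
... | false = sum-filter P? g (f ∘ suc)

length-filter : ∀ {a p} {A : Set a} {P : Pred A p} (P? : Decidable P) xs →
  List.length (List.filter P? xs) ≡ sum (λ i → mark (P? (List.lookup xs i)))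
length-filter P? []       = ≡.refl
length-filter P? (x ∷ xs) with does (P? x)
... | true  = ≡.cong suc (length-filter P? xs)
... | false = length-filter P? xs

injection⇒surjection : ∀ {h} {f : Fin h → Fin h} → Injection f → ∀ y → ∃ λ x → f x ≡ y
injection⇒surjection {zero}  inj ()
injection⇒surjection {suc h} {f} inj y with Fin.any? (λ x → f x Fin.≟ y)
... | yes found = found
... | no  ¬found = contradiction
  (Fin.injective⇒≤ {f = λ x → punchOut (λ y≡fx → ¬found (x , ≡.sym y≡fx))}
    (λ {x} {x′} eq → inj (Fin.punchOut-injective (λ p → ¬found (x , ≡.sym p)) (λ p → ¬found (x′ , ≡.sym p)) eq)))
  ℕ.1+n≰n

module Inverse {h} {f : Fin h → Fin h} (inj : Injection f) where

  inverse : Fin h → Fin h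
  inverse y = proj₁ (injection⇒surjection inj y)

  inverseˡ : ∀ y → f (inverse y) ≡ y
  inverseˡ y = proj₂ (injection⇒surjection inj y)

  inverseʳ : ∀ x → inverse (f x) ≡ x
  inverseʳ x = inj (inverseˡ (f x))

  inverse-injection : Injection inverse
  inverse-injection {y} {y′} eq = ≡.trans (≡.sym (inverseˡ y)) (≡.trans (≡.cong f eq) (inverseˡ y′))

  sum-rearrange : ∀ g → sum (g ∘ f) ≡ sum g
  sum-rearrange g = ≡.sym (sum-permute g (Permutation.permutation f inverse inverseˡ inverseʳ))

tabulate-punchIn : ∀ {a} {A : Set a} {h} (f : Fin (suc h) → A) i →
  List.tabulate f ↭ f i ∷ List.tabulate (f ∘ punchIn i)
tabulate-punchIn         f zero    = Perm.refl
tabulate-punchIn {h = suc h} f (suc i) = Perm.trans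
  (Perm.prep (f zero) (tabulate-punchIn (f ∘ suc) i)) (Perm.swap (f zero) (f (suc i)) Perm.refl)

tabulate-rearrange : ∀ {a} {A : Set a} {h} (f : Fin h → A) {σ : Fin h → Fin h} → Injection σ →
  List.tabulate (f ∘ σ) ↭ List.tabulate f
tabulate-rearrange {h = zero}  f inj = Perm.refl
tabulate-rearrange {h = suc h} f {σ} inj = Perm.trans
  (Perm.prep (f (σ zero)) (Perm.trans
    (Perm.↭-reflexive (List.tabulate-cong λ i → ≡.cong f (≡.sym (Fin.punchIn-punchOut (σ0≢ i)))))
    (tabulate-rearrange (f ∘ punchIn (σ zero)) {λ i → punchOut (σ0≢ i)}
      (λ {i} {j} eq → Fin.suc-injective (inj (Fin.punchOut-injective (σ0≢ i) (σ0≢ j) eq))))))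
  (Perm.↭-sym (tabulate-punchIn f (σ zero)))
  where
  import Data.List.Properties as List
  σ0≢ : ∀ i → σ zero ≢ σ (suc i)
  σ0≢ i eq with inj eq
  ... | ()

module Ranking {h} (p : Fin h → ℕ) (p-injective : ∀ {i j} → p i ≡ p j → i ≡ j) where

  rankℕ : Fin h → ℕ
  rankℕ i = sum (λ j → mark (p j ℕ.<? p i))

  rankℕ<h : ∀ i → rankℕ i < h
  rankℕ<h i = ≡.subst (rankℕ i ℕ.<_) (sum-1 h) (sum-<
    -- Any inhabited type has mark 1; here ℕ with the element `p j` provides the constant summand 1.
    (λ j → mark-≤ (p j ℕ.<? p i) (yes (p j)) (λ _ → p j)) i
    (mark-< (p i ℕ.<? p i) (yes (p i)) (ℕ.<-irrefl ≡.refl) (p i)))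

  rank : Fin h → Fin h
  rank i = Fin.fromℕ< (rankℕ<h i)

  toℕ-rank : ∀ i → toℕ (rank i) ≡ rankℕ i
  toℕ-rank i = Fin.toℕ-fromℕ< (rankℕ<h i)

  rank-mono : ∀ {i j} → p i < p j → rank i Fin.< rank j
  rank-mono {i} {j} lt = ≡.subst₂ ℕ._<_ (≡.sym (toℕ-rank i)) (≡.sym (toℕ-rank j)) (sum-<
    (λ l → mark-≤ (p l ℕ.<? p i) (p l ℕ.<? p j) (λ l<i → ℕ.<-trans l<i lt)) i
    (mark-< (p i ℕ.<? p i) (p i ℕ.<? p j) (ℕ.<-irrefl ≡.refl) lt))

  rank-cancel : ∀ {i j} → rank i Fin.< rank j → p i < p j
  rank-cancel {i} {j} lt with ℕ.<-cmp (p i) (p j)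
  ... | tri< pi<pj _ _ = pi<pj
  ... | tri≈ _ pi≡pj _ = contradiction (≡.cong (toℕ ∘ rank) (p-injective pi≡pj)) (ℕ.<⇒≢ lt)
  ... | tri> _ _ pj<pi = contradiction (rank-mono pj<pi) (ℕ.<-asym lt)

  rank-injection : Injection rank
  rank-injection {i} {j} eq with ℕ.<-cmp (p i) (p j)
  ... | tri< pi<pj _ _ = contradiction (≡.cong toℕ eq) (ℕ.<⇒≢ (rank-mono pi<pj))
  ... | tri≈ _ pi≡pj _ = p-injective pi≡pj
  ... | tri> _ _ pj<pi = contradiction (≡.cong toℕ (≡.sym eq)) (ℕ.<⇒≢ (rank-mono pj<pi))

strictlyMonotone⇒id : ∀ {m} {φ : Fin m → Fin m} → (∀ {k l} → k Fin.< l → φ k Fin.< φ l) → φ ≗ id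
strictlyMonotone⇒id {zero}  mono ()
strictlyMonotone⇒id {suc m} {φ} mono k = Fin.≤-antisym (upper k) (lower k)
  where
  step : ∀ i → φ (Fin.inject₁ i) Fin.< φ (suc i)
  step i = mono (ℕ.≤-reflexive (≡.cong suc (Fin.toℕ-inject₁ i)))
  lower : ∀ k → k Fin.≤ φ k
  lower = Fin.<-weakInduction (λ k → k Fin.≤ φ k) ℕ.z≤n λ i le →
    ℕ.≤-<-trans (≡.subst (ℕ._≤ toℕ (φ (Fin.inject₁ i))) (Fin.toℕ-inject₁ i) le) (step i)
  upper : ∀ k → φ k Fin.≤ k
  upper = Fin.>-weakInduction (λ k → φ k Fin.≤ k) (Fin.≤fromℕ (φ (Fin.fromℕ m))) λ i le →
    ≡.subst (toℕ (φ (Fin.inject₁ i)) ℕ.≤_) (≡.sym (Fin.toℕ-inject₁ i))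
      (ℕ.≤-pred (ℕ.<-≤-trans (step i) le))

-- Sorted rows and non-crossing matchings between them

module _ {h N : ℕ} where

  Monotone : (Fin h → Fin N) → Set
  Monotone R = ∀ {x y} → x Fin.≤ y → R x Fin.≤ R y

  countAbove : (Fin h → Fin N) → Fin N → ℕ
  countAbove R u = sum (λ x → mark (u Fin.≤? R x))

  -- At the threshold `R′ x` the index x counts for R′ alone. An index counted for R must lie after
  -- x, as R is monotone, and is then counted for R′ as well.
  countAbove-< : ∀ {R R′} → Monotone R → Monotone R′ → ∀ x → R x Fin.< R′ x →
                 countAbove R (R′ x) < countAbove R′ (R′ x)
  countAbove-< {R} {R′} mono mono′ x lt = sum-<
    (λ y → mark-≤ (R′ x Fin.≤? R y) (R′ x Fin.≤? R′ y) λ R′x≤Ry →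
      mono′ (ℕ.<⇒≤ (ℕ.≰⇒> λ y≤x → ℕ.<⇒≱ lt (ℕ.≤-trans R′x≤Ry (mono y≤x)))))
    x (mark-< (R′ x Fin.≤? R x) (R′ x Fin.≤? R′ x) (ℕ.<⇒≱ lt) ℕ.≤-refl)

  monotone-unique : ∀ {R R′} → Monotone R → Monotone R′ → countAbove R ≗ countAbove R′ → R ≗ R′
  monotone-unique {R} {R′} mono mono′ eq x with Fin.<-cmp (R x) (R′ x)
  ... | tri< lt _ _ = contradiction (eq (R′ x)) (ℕ.<⇒≢ (countAbove-< mono mono′ x lt))
  ... | tri≈ _ e _  = e
  ... | tri> _ _ gt = contradiction (≡.sym (eq (R x))) (ℕ.<⇒≢ (countAbove-< mono′ mono x gt))

  -- τ matches each opening x, at R x, with a closing τ x, at Q (τ x), so that no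
  -- two of the arcs cross.
  record Matching (R Q : Fin h → Fin N) (τ : Fin h → Fin h) : Set where
    field
      injection : Injection τ
      closes    : ∀ x → R x Fin.< Q (τ x)
      uncrossed : ∀ {x y} → x Fin.< y → τ x Fin.< τ y → Q (τ x) Fin.≤ R y

  -- Induction from the last opening downwards. If τ x < τ′ x, then τ′ matches the closing τ x with
  -- some z other than x. For z > x this contradicts the agreement already known. For z < x the arcs
  -- of τ′ from z and x force Q (τ x) ≤ R x, whereas τ closes x strictly after R x.
  matching-unique : ∀ {R Q τ τ′} → Matching R Q τ → Matching R Q τ′ → τ ≗ τ′
  matching-unique {R} {Q} {τ} {τ′} M M′ x = go x (Fin.>-wellFounded x)
    where
    earlier : ∀ {τ τ′} → Matching R Q τ → Matching R Q τ′ → ∀ x →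
      (∀ {y} → x Fin.< y → τ y ≡ τ′ y) → ¬ τ x Fin.< τ′ x
    earlier {τ} {τ′} M M′ x agree τx<τ′x with injection⇒surjection (Matching.injection M′) (τ x)
    ... | z , τ′z≡τx with Fin.<-cmp z x
    ...   | tri< z<x _ _ = ℕ.<⇒≱ (Matching.closes M x)
      (≡.subst (λ w → Q w Fin.≤ R x) τ′z≡τx (Matching.uncrossed M′ z<x
        (≡.subst (Fin._< τ′ x) (≡.sym τ′z≡τx) τx<τ′x)))
    ...   | tri≈ _ ≡.refl _ = ℕ.<⇒≢ τx<τ′x (≡.cong toℕ (≡.sym τ′z≡τx))
    ...   | tri> _ _ x<z = ℕ.<⇒≢ x<z (≡.cong toℕ
      (Matching.injection M (≡.sym (≡.trans (agree x<z) τ′z≡τx))))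

    go : ∀ x → Acc Fin._>_ x → τ x ≡ τ′ x
    go x (acc rec) with Fin.<-cmp (τ x) (τ′ x)
    ... | tri≈ _ e _ = e
    ... | tri< lt _ _ = contradiction lt (earlier M M′ x (λ {y} x<y → go y (rec x<y)))
    ... | tri> _ _ gt = contradiction gt (earlier M′ M x (λ {y} x<y → ≡.sym (go y (rec x<y))))

last : ∀ {n p} {P : Pred (Fin n) p} → Decidable P →
  (∀ j → ¬ P j) ⊎ ∃ λ i → P i × ∀ {j} → i Fin.< j → ¬ P j
last {zero}  P? = inj₁ λ ()
last {suc n} P? with last (P? ∘ suc)
... | inj₂ (i , pi , none) = inj₂ (suc i , pi , λ { {suc j} (ℕ.s≤s i<j) → none i<j })
... | inj₁ none with P? zero
...   | yes p0 = inj₂ (zero , p0 , λ { {suc j} _ → none j })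
...   | no ¬p0 = inj₁ λ { zero → ¬p0 ; (suc j) → none j }

-- The first closing is matched with the last opening before it.
matching-exists : ∀ {h N} {R Q : Fin h → Fin N} → Monotone R → Monotone Q → (∀ x → R x Fin.< Q x) →
  ∃ λ (σ : Fin h → Fin h) → Injection σ × (∀ y → R (σ y) Fin.< Q y) ×
    (∀ {y z} → y Fin.< z → σ y Fin.< σ z → Q y Fin.≤ R (σ z))
matching-exists {zero}  _ _ _ = id , id , (λ ()) , λ { {()} }
matching-exists {suc h} {N} {R} {Q} monoR monoQ below with last (λ x → R x Fin.<? Q zero)
... | inj₁ none = contradiction (below zero) (none zero)
... | inj₂ (i , Ri<Q0 , none) with matching-exists {R = R ∘ punchIn i} {Q ∘ suc}
        (λ {x} {y} x≤y → monoR (Fin.punchIn-mono-≤ i x y x≤y)) (λ x≤y → monoQ (ℕ.s≤s x≤y)) below′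
    where
    punchIn-≤ : ∀ {n} (i : Fin (suc n)) x → punchIn i x Fin.≤ suc x
    punchIn-≤ zero    x       = ℕ.≤-refl
    punchIn-≤ (suc i) zero    = ℕ.z≤n
    punchIn-≤ (suc i) (suc x) = ℕ.s≤s (punchIn-≤ i x)
    -- After the deletions the x-th remaining closing has index x + 1 and the x-th remaining opening
    -- an index at most x + 1, so openings still precede closings.
    below′ : ∀ x → R (punchIn i x) Fin.< Q (suc x)
    below′ x = ℕ.≤-<-trans (monoR (punchIn-≤ i x)) (below (suc x))
... | σ , inj , lt , nest = σ′ , inj′ , lt′ , nest′
  where
  σ′ : Fin (suc h) → Fin (suc h)
  σ′ zero    = i
  σ′ (suc y) = punchIn i (σ y)
  inj′ : Injection σ′
  inj′ {zero}  {zero}  eq = ≡.refl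
  inj′ {zero}  {suc y} eq = contradiction (≡.sym eq) (Fin.punchInᵢ≢i i (σ y))
  inj′ {suc x} {zero}  eq = contradiction eq (Fin.punchInᵢ≢i i (σ x))
  inj′ {suc x} {suc y} eq = ≡.cong suc (inj (Fin.punchIn-injective i (σ x) (σ y) eq))
  lt′ : ∀ y → R (σ′ y) Fin.< Q y
  lt′ zero    = Ri<Q0
  lt′ (suc y) = lt y
  nest′ : ∀ {y z} → y Fin.< z → σ′ y Fin.< σ′ z → Q y Fin.≤ R (σ′ z)
  nest′ {zero}  {suc z} _ i<σz = ℕ.≮⇒≥ (none i<σz)
  nest′ {suc y} {suc z} (ℕ.s≤s y<z) lt = nest y<z
    (ℕ.≰⇒> λ σz≤σy → ℕ.<⇒≱ lt (Fin.punchIn-mono-≤ i (σ z) (σ y) σz≤σy))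

-- Nested families and their uniqueness

lookup-indicator : ∀ {N} (v u : Fin N) → Vec.lookup (indicator v) u ≡ mark (u Fin.≤? v)
lookup-indicator zero    zero    = ≡.refl
lookup-indicator {suc N} zero    (suc u) = Vec.lookup-replicate u 0
lookup-indicator (suc v) zero    = ≡.refl
lookup-indicator (suc v) (suc u) = ≡.trans (lookup-indicator v u)
  (mark-⇔ (u Fin.≤? v) (suc u Fin.≤? suc v) ℕ.s≤s ℕ.≤-pred)

module _ {m N : ℕ} where

  row : ∀ {h} → (Fin h → Subset m N) → Fin m → Fin h → Fin N
  row f k i = f i ‼ k

  lookup-rowContent : ∀ {h} (f : Fin h → Subset m N) k u →
    Vec.lookup (Vec.lookup (rowContent (List.tabulate f)) k) u ≡ countAbove (row f k) u
  lookup-rowContent {zero}  f k u = ≡.trans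
    (≡.cong (λ r → Vec.lookup r u) (Vec.lookup-replicate k (Vec.replicate N 0)))
    (Vec.lookup-replicate u 0)
  lookup-rowContent {suc h} f k u = begin
    Vec.lookup (Vec.lookup (Vec.map indicator (elements J) ⊕ rest′) k) u
      ≡⟨ ≡.cong (λ r → Vec.lookup r u) (Vec.lookup-zipWith (Vec.zipWith ℕ._+_) k (Vec.map indicator (elements J)) rest′) ⟩
    Vec.lookup (Vec.zipWith ℕ._+_ (Vec.lookup (Vec.map indicator (elements J)) k) (Vec.lookup rest′ k)) u
      ≡⟨ Vec.lookup-zipWith ℕ._+_ u (Vec.lookup (Vec.map indicator (elements J)) k) (Vec.lookup rest′ k) ⟩
    Vec.lookup (Vec.lookup (Vec.map indicator (elements J)) k) u ℕ.+ Vec.lookup (Vec.lookup rest′ k) u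
      ≡⟨ ≡.cong₂ ℕ._+_
           (≡.trans (≡.cong (λ r → Vec.lookup r u) (Vec.lookup-map k indicator (elements J))) (lookup-indicator (J ‼ k) u))
           (lookup-rowContent (f ∘ suc) k u) ⟩
    countAbove (row f k) u ∎
    where
    open ≡.≡-Reasoning
    J = f zero
    rest′ = rowContent (List.tabulate (f ∘ suc))

  lookup-injective : ∀ {a} {A : Set a} {n} {xs ys : Vec A n} → Vec.lookup xs ≗ Vec.lookup ys → xs ≡ ys
  lookup-injective {xs = xs} {ys} eq = ≡.trans (≡.sym (Vec.tabulate∘lookup xs))
    (≡.trans (Vec.tabulate-cong eq) (Vec.tabulate∘lookup ys))

  rowContent-≡ : ∀ {h h′} (f : Fin h → Subset m N) (f′ : Fin h′ → Subset m N) →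
    (∀ k → countAbove (row f k) ≗ countAbove (row f′ k)) →
    rowContent (List.tabulate f) ≡ rowContent (List.tabulate f′)
  rowContent-≡ f f′ eq = lookup-injective λ k → lookup-injective λ u →
    ≡.trans (lookup-rowContent f k u) (≡.trans (eq k u) (≡.sym (lookup-rowContent f′ k u)))

  countAbove-≡ : ∀ {h h′} (f : Fin h → Subset m N) (f′ : Fin h′ → Subset m N) →
    rowContent (List.tabulate f) ≡ rowContent (List.tabulate f′) →
    ∀ k → countAbove (row f k) ≗ countAbove (row f′ k)
  countAbove-≡ f f′ eq k u = ≡.trans (≡.sym (lookup-rowContent f k u))
    (≡.trans (≡.cong (λ r → Vec.lookup (Vec.lookup r k) u) eq) (lookup-rowContent f′ k u))

  subset-≡ : {J J′ : Subset m N} → (∀ k → J ‼ k ≡ J′ ‼ k) → J ≡ J′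
  subset-≡ {subset us _} {subset vs _} eq with lookup-injective {xs = us} {vs} eq
  ... | ≡.refl = ≡.refl

  ‼-increasing : ∀ (J : Subset m N) {k l} → k Fin.< l → J ‼ k Fin.< J ‼ l
  ‼-increasing J = lookup-mono (elements-increasing J)
    where
    lookup-mono : ∀ {n} {vs : Vec (Fin N) n} → AllPairs Fin._<_ vs →
                  ∀ {k l} → k Fin.< l → Vec.lookup vs k Fin.< Vec.lookup vs l
    lookup-mono (v< ∷ _)  {zero}  {suc l} _           = All.lookup⁺ v< l
    lookup-mono (_ ∷ inc) {suc k} {suc l} (ℕ.s≤s k<l) = lookup-mono inc k<l

  ‼-injective : ∀ (J : Subset m N) {k l} → J ‼ k ≡ J ‼ l → k ≡ l
  ‼-injective J {k} {l} eq with Fin.<-cmp k l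
  ... | tri< k<l _ _ = contradiction (≡.cong toℕ eq) (ℕ.<⇒≢ (‼-increasing J k<l))
  ... | tri≈ _ k≡l _ = k≡l
  ... | tri> _ _ l<k = contradiction (≡.cong toℕ (≡.sym eq)) (ℕ.<⇒≢ (‼-increasing J l<k))

  -- For every level k, an order pos ∙ k of the k-th entries refining the order of
  -- their values, such that no two arcs from level k to level k⁺ = k + 1 cross. All
  -- entries of level k⁺ come before those of level k with the same value.
  record Nested {h} (f : Fin h → Subset m N) : Set where
    field
      {bound}       : ℕ
      pos           : Fin h → Fin m → Fin bound
      pos-injective : ∀ {i j} k → pos i k ≡ pos j k → i ≡ j
      pos-mono      : ∀ {i j} k → pos i k Fin.< pos j k → f i ‼ k Fin.≤ f j ‼ k
      pos-nested    : ∀ {i j} k k⁺ → toℕ k⁺ ≡ suc (toℕ k) →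
                      pos i k Fin.< pos j k → pos i k⁺ Fin.< pos j k⁺ → f i ‼ k⁺ Fin.≤ f j ‼ k

  -- Positions are compressed to ranks below h, so that families with different bounds become
  -- comparable row by row.
  module Levels {h} {f : Fin h → Subset m N} (nested : Nested f) where

    open Nested nested

    private
      module Rank k = Ranking (λ i → toℕ (pos i k)) (λ eq → pos-injective k (Fin.toℕ-injective eq))
      module Unrank k = Inverse (Rank.rank-injection k)

    level : Fin m → Fin h → Fin h
    level k = Rank.rank k

    unlevel : Fin m → Fin h → Fin h
    unlevel k = Unrank.inverse k

    level-injection : ∀ k → Injection (level k)
    level-injection k = Rank.rank-injection k

    level-unlevel : ∀ k x → level k (unlevel k x) ≡ x
    level-unlevel k = Unrank.inverseˡ k

    unlevel-level : ∀ k i → unlevel k (level k i) ≡ i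
    unlevel-level k = Unrank.inverseʳ k

    sortedRow : Fin m → Fin h → Fin N
    sortedRow k x = f (unlevel k x) ‼ k

    sortedRow-level : ∀ k i → sortedRow k (level k i) ≡ f i ‼ k
    sortedRow-level k i = ≡.cong (λ j → f j ‼ k) (unlevel-level k i)

    private
      pos-unlevel : ∀ k {x y} → x Fin.< y → pos (unlevel k x) k Fin.< pos (unlevel k y) k
      pos-unlevel k {x} {y} x<y = Rank.rank-cancel k
        (≡.subst₂ Fin._<_ (≡.sym (level-unlevel k x)) (≡.sym (level-unlevel k y)) x<y)

    sortedRow-monotone : ∀ k → Monotone (sortedRow k)
    sortedRow-monotone k {x} {y} x≤y with Fin.<-cmp x y
    ... | tri< x<y _ _ = pos-mono k (pos-unlevel k x<y)
    ... | tri≈ _ ≡.refl _ = ℕ.≤-refl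
    ... | tri> _ _ y<x = contradiction x≤y (ℕ.<⇒≱ y<x)

    countAbove-sortedRow : ∀ k → countAbove (sortedRow k) ≗ countAbove (row f k)
    countAbove-sortedRow k u = Inverse.sum-rearrange (Unrank.inverse-injection k) (λ i → mark (u Fin.≤? f i ‼ k))

    matching : ∀ k k⁺ → toℕ k⁺ ≡ suc (toℕ k) →
      Matching (sortedRow k) (sortedRow k⁺) (level k⁺ ∘ unlevel k)
    matching k k⁺ k⁺≡ = record
      { injection = Unrank.inverse-injection k ∘ level-injection k⁺
      ; closes = λ x → ≡.subst (λ v → sortedRow k x Fin.< v) (≡.sym (sortedRow-level k⁺ (unlevel k x)))
          (‼-increasing (f (unlevel k x)) (ℕ.≤-reflexive (≡.sym k⁺≡)))
      ; uncrossed = λ {x} {y} x<y lt → ≡.subst (λ v → v Fin.≤ sortedRow k y)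
          (≡.sym (sortedRow-level k⁺ (unlevel k x)))
          (pos-nested k k⁺ k⁺≡ (pos-unlevel k x<y) (Rank.rank-cancel k⁺ lt))
      }

-- Equal counts give equal sorted rows, and between equal rows the matchings agree by
-- `matching-unique`. Once σ aligns the two families in row zero, following the matchings aligns
-- them in every row.
nested-unique : ∀ {m N h} {f f′ : Fin h → Subset m N} → Nested f → Nested f′ →
  (∀ k → countAbove (row f k) ≗ countAbove (row f′ k)) → List.tabulate f ↭ List.tabulate f′
nested-unique {zero} {f = f} {f′} _ _ _ = Perm.↭-reflexive (List.tabulate-cong λ i → subset-≡ {J = f i} {f′ i} λ ())
nested-unique {suc m} {f = f} {f′} nested nested′ counts = Perm.trans
  (Perm.↭-reflexive (List.tabulate-cong λ i → subset-≡ {J = f i} {f′ (σ i)} (same i)))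
  (tabulate-rearrange f′ σ-injection)
  where
  module L = Levels nested
  module L′ = Levels nested′
  rows : ∀ k → L.sortedRow k ≗ L′.sortedRow k
  rows k = monotone-unique (L.sortedRow-monotone k) (L′.sortedRow-monotone k) λ u →
    ≡.trans (L.countAbove-sortedRow k u) (≡.trans (counts k u) (≡.sym (L′.countAbove-sortedRow k u)))

  σ : Fin _ → Fin _
  σ i = L′.unlevel zero (L.level zero i)

  σ-injection : Injection σ
  σ-injection {i} {j} eq = L.level-injection zero (≡.trans (≡.sym (L′.level-unlevel zero _))
    (≡.trans (≡.cong (L′.level zero) eq) (L′.level-unlevel zero _)))

  matching′ : ∀ k k⁺ → toℕ k⁺ ≡ suc (toℕ k) →
    Matching (L.sortedRow k) (L.sortedRow k⁺) (L′.level k⁺ ∘ L′.unlevel k)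
  matching′ k k⁺ k⁺≡ = record
    { injection = injection
    ; closes = λ x → ≡.subst₂ Fin._<_ (≡.sym (rows k x)) (≡.sym (rows k⁺ _)) (closes x)
    ; uncrossed = λ {x} {y} x<y lt → ≡.subst₂ Fin._≤_ (≡.sym (rows k⁺ _)) (≡.sym (rows k y)) (uncrossed x<y lt) }
    where open Matching (L′.matching k k⁺ k⁺≡)

  levels : ∀ k i → L′.level k (σ i) ≡ L.level k i
  levels = Fin.<-weakInduction (λ k → ∀ i → L′.level k (σ i) ≡ L.level k i)
    (λ i → L′.level-unlevel zero (L.level zero i))
    λ k ih i → let k⁺≡ = ≡.cong suc (≡.sym (Fin.toℕ-inject₁ k)) in begin
      L′.level (suc k) (σ i)
        ≡⟨ ≡.cong (L′.level (suc k)) (≡.trans (≡.sym (L′.unlevel-level (Fin.inject₁ k) (σ i)))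
             (≡.cong (L′.unlevel (Fin.inject₁ k)) (ih i))) ⟩
      L′.level (suc k) (L′.unlevel (Fin.inject₁ k) (L.level (Fin.inject₁ k) i))
        ≡⟨ matching-unique (matching′ (Fin.inject₁ k) (suc k) k⁺≡) (L.matching (Fin.inject₁ k) (suc k) k⁺≡)
             (L.level (Fin.inject₁ k) i) ⟩
      L.level (suc k) (L.unlevel (Fin.inject₁ k) (L.level (Fin.inject₁ k) i))
        ≡⟨ ≡.cong (L.level (suc k)) (L.unlevel-level (Fin.inject₁ k) i) ⟩
      L.level (suc k) i ∎
    where open ≡.≡-Reasoning

  same : ∀ i k → f i ‼ k ≡ f′ (σ i) ‼ k
  same i k = begin
    f i ‼ k                               ≡⟨ L.sortedRow-level k i ⟨
    L.sortedRow k (L.level k i)           ≡⟨ rows k (L.level k i) ⟩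
    L′.sortedRow k (L.level k i)          ≡⟨ ≡.cong (L′.sortedRow k) (levels k i) ⟨
    L′.sortedRow k (L′.level k (σ i))     ≡⟨ L′.sortedRow-level k (σ i) ⟩
    f′ (σ i) ‼ k                          ∎
    where open ≡.≡-Reasoning

-- The rows R are given sorted, and the i-th factor under construction takes the entry at position
-- `level k i` of row k.
record Nesting {m h N} (R : Fin m → Fin h → Fin N) : Set where
  field
    level     : Fin m → Fin h → Fin h
    injection : ∀ k → Injection (level k)
    ascends   : ∀ k k⁺ → toℕ k⁺ ≡ suc (toℕ k) → ∀ i → R k (level k i) Fin.< R k⁺ (level k⁺ i)
    nests     : ∀ k k⁺ → toℕ k⁺ ≡ suc (toℕ k) → ∀ {i j} → level k i Fin.< level k j →
                level k⁺ i Fin.< level k⁺ j → R k⁺ (level k⁺ i) Fin.≤ R k (level k j)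

-- Built from the last row upwards: σ sends a closing in row one to its opening in row zero, so it
-- turns the level of a factor in row one into its level in row zero.
nesting : ∀ {m h N} (R : Fin m → Fin h → Fin N) → (∀ k → Monotone (R k)) →
  (∀ k k⁺ → toℕ k⁺ ≡ suc (toℕ k) → ∀ x → R k x Fin.< R k⁺ x) → Nesting R
nesting {zero} R mono below = record
  { level = λ () ; injection = λ () ; ascends = λ () ; nests = λ () }
nesting {suc zero} R mono below = record
  { level = λ _ → id ; injection = λ _ → id
  ; ascends = λ { zero zero () } ; nests = λ { zero zero () } }
nesting {suc (suc m)} R mono below
  with nesting (R ∘ suc) (mono ∘ suc) (λ k k⁺ eq → below (suc k) (suc k⁺) (≡.cong suc eq))
     | matching-exists {R = R zero} {R (suc zero)} (mono zero) (mono (suc zero)) (below zero (suc zero) ≡.refl)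
... | record { level = level ; injection = injection ; ascends = ascends ; nests = nests }
    | σ , σ-injection , σ-below , σ-nests = record
  { level = level′
  ; injection = λ { zero → injection zero ∘ σ-injection ; (suc k) → injection k }
  ; ascends = λ
    { zero (suc zero) _ i → σ-below (level zero i)
    ; (suc k) (suc k⁺) eq i → ascends k k⁺ (ℕ.suc-injective eq) i }
  ; nests = λ
    { zero (suc zero) _ lt lt⁺ → σ-nests lt⁺ lt
    ; (suc k) (suc k⁺) eq lt lt⁺ → nests k k⁺ (ℕ.suc-injective eq) lt lt⁺ }
  }
  where
  level′ : Fin (suc (suc m)) → Fin _ → Fin _
  level′ zero    = σ ∘ level zero
  level′ (suc k) = level k

adjacent⇒allPairs : ∀ {m N} (v : Fin m → Fin N) →
  (∀ k k⁺ → toℕ k⁺ ≡ suc (toℕ k) → v k Fin.< v k⁺) → AllPairs Fin._<_ (Vec.tabulate v)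
adjacent⇒allPairs {zero}  v inc = []
adjacent⇒allPairs {suc m} v inc = All.tabulate⁺ (first v inc) ∷
  adjacent⇒allPairs (v ∘ suc) λ k k⁺ eq → inc (suc k) (suc k⁺) (≡.cong suc eq)
  where
  first : ∀ {m N} (v : Fin (suc m) → Fin N) →
    (∀ k k⁺ → toℕ k⁺ ≡ suc (toℕ k) → v k Fin.< v k⁺) → ∀ k → v zero Fin.< v (suc k)
  first v inc zero    = inc zero (suc zero) ≡.refl
  first v inc (suc k) = ℕ.<-trans (inc zero (suc zero) ≡.refl)
    (first (v ∘ suc) (λ k k⁺ eq → inc (suc k) (suc k⁺) (≡.cong suc eq)) k)

module _ {m N h : ℕ} (g : Fin h → Subset m N) (g-mono : ∀ {x y} → x Fin.≤ y → g x ≼ g y) where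

  private
    R : Fin m → Fin h → Fin N
    R = row g

  open Nesting (nesting R (λ k x≤y → g-mono x≤y k)
    (λ k k⁺ eq x → ‼-increasing (g x) (ℕ.≤-reflexive (≡.sym eq))))

  -- Each row is only permuted, which keeps the row content; what changes is how the rows are joined
  -- into factors.
  unstandardise : Fin h → Subset m N
  unstandardise i = subset (Vec.tabulate (λ k → R k (level k i)))
    (adjacent⇒allPairs _ λ k k⁺ eq → ascends k k⁺ eq i)

  unstandardise-‼ : ∀ i k → unstandardise i ‼ k ≡ R k (level k i)
  unstandardise-‼ i = Vec.lookup∘tabulate (λ k → R k (level k i))

  unstandardise-nested : Nested unstandardise
  unstandardise-nested = record
    { pos = λ i k → level k i
    ; pos-injective = λ k → injection k
    ; pos-mono = λ {i} {j} k lt → ≡.subst₂ Fin._≤_ (≡.sym (unstandardise-‼ i k)) (≡.sym (unstandardise-‼ j k))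
        (g-mono (ℕ.<⇒≤ lt) k)
    ; pos-nested = λ {i} {j} k k⁺ eq lt lt⁺ →
        ≡.subst₂ Fin._≤_ (≡.sym (unstandardise-‼ i k⁺)) (≡.sym (unstandardise-‼ j k)) (nests k k⁺ eq lt lt⁺)
    }

  unstandardise-rowContent : rowContent (List.tabulate g) ≡ rowContent (List.tabulate unstandardise)
  unstandardise-rowContent = rowContent-≡ g unstandardise λ k u → ≡.sym (≡.trans
    (sum-cong-≗ (λ i → ≡.cong (λ v → mark (u Fin.≤? v)) (unstandardise-‼ i k)))
    (Inverse.sum-rearrange (injection k) (λ x → mark (u Fin.≤? R k x))))

-- Monomials determined by their row content

tabulated : ∀ {a} {A : Set a} {h} (xs : List A) → List.length xs ≡ h → ∃ λ (f : Fin h → A) → List.tabulate f ≡ xs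
tabulated xs ≡.refl = List.lookup xs , List.tabulate-lookup xs

allPairs-tabulate⁻ : ∀ {a r} {A : Set a} {_~_ : A → A → Set r} {h} (f : Fin h → A) →
  ListPairs.AllPairs _~_ (List.tabulate f) → ∀ {i j} → i Fin.< j → f i ~ f j
allPairs-tabulate⁻ f (f0~ ∷ _)  {zero}  {suc j} _           = ListAll.tabulate⁻ f0~ j
allPairs-tabulate⁻ f (_ ∷ prs) {suc i} {suc j} (ℕ.s≤s i<j) = allPairs-tabulate⁻ (f ∘ suc) prs i<j

module _ {m N : ℕ} where

  standard-monotone : ∀ {h} (f : Fin h → Subset m N) → Standard (List.tabulate f) →
    ∀ {x y} → x Fin.≤ y → f x ≼ f y
  standard-monotone f std {x} {y} x≤y with Fin.<-cmp x y
  ... | tri< x<y _ _ = allPairs-tabulate⁻ f std x<y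
  ... | tri≈ _ ≡.refl _ = λ k → ℕ.≤-refl
  ... | tri> _ _ y<x = contradiction x≤y (ℕ.<⇒≱ y<x)

  standard-unique : ∀ {h} {f f′ : Fin h → Subset m N} →
    Standard (List.tabulate f) → Standard (List.tabulate f′) →
    (∀ k → countAbove (row f k) ≗ countAbove (row f′ k)) → List.tabulate f ↭ List.tabulate f′
  standard-unique {f = f} {f′} std std′ counts = Perm.↭-reflexive (List.tabulate-cong λ i →
    subset-≡ {J = f i} {f′ i} λ k → monotone-unique
      (λ x≤y → standard-monotone f std x≤y k) (λ x≤y → standard-monotone f′ std′ x≤y k) (counts k) i)

-- The first entry of row zero counts the factors whose least column is at least zero, hence all
-- factors. Here m ≥ 1 enters, as there must be a row.
length-determined : ∀ {m N} {M M′ : List (Subset (suc m) (suc N))} →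
  rowContent M ≡ rowContent M′ → List.length M ≡ List.length M′
length-determined {m} {N} {M} {M′} eq = begin
  List.length M                                                   ≡⟨ total-count M ⟨
  Vec.lookup (Vec.lookup (rowContent M) zero) zero                ≡⟨ ≡.cong (λ e → Vec.lookup (Vec.lookup e zero) zero) eq ⟩
  Vec.lookup (Vec.lookup (rowContent M′) zero) zero               ≡⟨ total-count M′ ⟩
  List.length M′                                                  ∎
  where
  open ≡.≡-Reasoning
  total-count : ∀ (M : List (Subset (suc m) (suc N))) → Vec.lookup (Vec.lookup (rowContent M) zero) zero ≡ List.length M
  total-count M = begin
    Vec.lookup (Vec.lookup (rowContent M) zero) zero
      ≡⟨ ≡.cong (λ M → Vec.lookup (Vec.lookup (rowContent M) zero) zero) (List.tabulate-lookup M) ⟨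
    Vec.lookup (Vec.lookup (rowContent (List.tabulate (List.lookup M))) zero) zero
      ≡⟨ lookup-rowContent (List.lookup M) zero zero ⟩
    countAbove (row (List.lookup M) zero) zero
      ≡⟨ sum-cong-≗ (λ i → mark-yes (Fin.zero {N} Fin.≤? List.lookup M i ‼ zero) ℕ.z≤n) ⟩
    sum {List.length M} (λ _ → 1)
      ≡⟨ sum-1 (List.length M) ⟩
    List.length M ∎

-- Uniqueness compares families over the same `Fin h`; `length-determined` provides the common
-- number of factors.
determined-by-families : ∀ {m N p} {P : List (Subset (suc m) (suc N)) → Set p} →
  (∀ {h} {f f′ : Fin h → Subset (suc m) (suc N)} → P (List.tabulate f) → P (List.tabulate f′) →
    (∀ k → countAbove (row f k) ≗ countAbove (row f′ k)) → List.tabulate f ↭ List.tabulate f′) →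
  ∀ {M M′} → P M → P M′ → rowContent M ≡ rowContent M′ → M ↭ M′
determined-by-families {P = P} unique {M} {M′} p p′ eq
  with tabulated M (length-determined {M = M} {M′} eq) | tabulated M′ ≡.refl
... | f , ≡.refl | f′ , eq′ = ≡.subst (List.tabulate f ↭_) eq′
  (unique p (≡.subst P (≡.sym eq′) p′) (countAbove-≡ f f′ (≡.trans eq (≡.cong rowContent (≡.sym eq′)))))

-- Semi-noncrossing multisets are the nested families

∈⇒index : ∀ {m N} (J : Subset m N) {u} → u ∈ˢ J → ∃ λ k → u ≡ J ‼ k
∈⇒index (subset vs _) = go vs
  where
  go : ∀ {m N} (vs : Vec (Fin N) m) {u} → u ∈ᵛ vs → ∃ λ k → u ≡ Vec.lookup vs k
  go (_ ∷ _)  (here u≡)  = zero , u≡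
  go (_ ∷ vs) (there u∈) = let k , u≡ = go vs u∈ in suc k , u≡

module _ {m n : ℕ} (M : Monomial m n) where

  private
    N = m ℕ.+ n
    h = List.length M

  -- Here an element of `Fin (m ℕ.* h)` is a name for an entry of M, coding its level and its
  -- factor. It is not the place of that entry in the set partition.
  blockOf : Fin (m ℕ.* h) → Fin h
  blockOf e = proj₂ (Fin.remQuot {m} h e)

  levelOf : Fin (m ℕ.* h) → Fin m
  levelOf e = proj₁ (Fin.remQuot {m} h e)

  entry : Fin (m ℕ.* h) → Fin N
  entry e = List.lookup M (blockOf e) ‼ levelOf e

  entry-combine : ∀ k i → entry (Fin.combine k i) ≡ List.lookup M i ‼ k
  entry-combine k i = ≡.cong (λ (l , j) → List.lookup M j ‼ l) (Fin.remQuot-combine k i)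

  mark-∈ : ∀ u (J : Subset m N) → mark (u ∈ˢ? J) ≡ sum (λ k → mark (J ‼ k Fin.≟ u))
  mark-∈ u J with u ∈ˢ? J
  ... | no u∉J = ≡.sym (≡.trans (sum-cong-≗ λ k → mark-no (J ‼ k Fin.≟ u)
    λ eq → u∉J (≡.subst (_∈ˢ J) eq (∈-lookup k (elements J)))) (sum-replicate-zero m))
  ... | yes u∈J with ∈⇒index J u∈J
  ...   | l , ≡.refl = ≡.sym (≡.trans (sum-cong-≗ λ k → ≡.trans
    (mark-⇔ (J ‼ k Fin.≟ J ‼ l) (l Fin.≟ k) (≡.sym ∘ ‼-injective J) (≡.cong (J ‼_) ∘ ≡.sym))
    (≡.sym (ℕ.*-identityˡ _))) (sum-δ (λ _ → 1) l))

  multiplicity-sum : ∀ u → multiplicity M u ≡ sum (λ e → mark (entry e Fin.≟ u))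
  multiplicity-sum u = begin
    multiplicity M u
      ≡⟨ length-filter (u ∈ˢ?_) M ⟩
    sum (λ i → mark (u ∈ˢ? List.lookup M i))
      ≡⟨ sum-cong-≗ (λ i → mark-∈ u (List.lookup M i)) ⟩
    sum (λ i → sum (λ k → mark (List.lookup M i ‼ k Fin.≟ u)))
      ≡⟨ ∑-comm (λ i k → mark (List.lookup M i ‼ k Fin.≟ u)) ⟩
    sum (λ k → sum (λ i → mark (List.lookup M i ‼ k Fin.≟ u)))
      ≡⟨ sum-cong-≗ (λ k → sum-cong-≗ λ i → ≡.cong (λ v → mark (v Fin.≟ u)) (entry-combine k i)) ⟨
    sum (λ (k : Fin m) → sum (λ (i : Fin h) → mark (entry (Fin.combine k i) Fin.≟ u)))
      ≡⟨ sum-combine m (λ e → mark (entry e Fin.≟ u)) ⟨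
    sum (λ e → mark (entry e Fin.≟ u)) ∎
    where open ≡.≡-Reasoning

  -- Segment ends become counts of entries by value, sums of the same kind as those by which
  -- `Ranking` assigns places.
  segmentStart-sum : ∀ u → segmentStart M u ≡ sum (λ e → mark (entry e Fin.<? u))
  segmentStart-sum u = begin
    segmentStart M u
      ≡⟨ sum-filter (Fin._<? u) (multiplicity M) id ⟩
    sum (λ w → mark (w Fin.<? u) ℕ.* multiplicity M w)
      ≡⟨ sum-cong-≗ (λ w → ≡.trans (≡.cong (mark (w Fin.<? u) ℕ.*_) (multiplicity-sum w))
           (*-distribˡ-sum (mark (w Fin.<? u)) (λ e → mark (entry e Fin.≟ w)))) ⟩
    sum (λ w → sum (λ e → mark (w Fin.<? u) ℕ.* mark (entry e Fin.≟ w)))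
      ≡⟨ ∑-comm (λ w e → mark (w Fin.<? u) ℕ.* mark (entry e Fin.≟ w)) ⟩
    sum (λ e → sum (λ w → mark (w Fin.<? u) ℕ.* mark (entry e Fin.≟ w)))
      ≡⟨ sum-cong-≗ (λ e → sum-δ (λ w → mark (w Fin.<? u)) (entry e)) ⟩
    sum (λ e → mark (entry e Fin.<? u)) ∎
    where open ≡.≡-Reasoning

  segmentEnd-sum : ∀ u → segmentStart M u ℕ.+ multiplicity M u ≡ sum (λ e → mark (entry e Fin.≤? u))
  segmentEnd-sum u = begin
    segmentStart M u ℕ.+ multiplicity M u
      ≡⟨ ≡.cong₂ ℕ._+_ (segmentStart-sum u) (multiplicity-sum u) ⟩
    sum (λ e → mark (entry e Fin.<? u)) ℕ.+ sum (λ e → mark (entry e Fin.≟ u))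
      ≡⟨ ∑-distrib-+ (λ e → mark (entry e Fin.<? u)) (λ e → mark (entry e Fin.≟ u)) ⟨
    sum (λ e → mark (entry e Fin.<? u) ℕ.+ mark (entry e Fin.≟ u))
      ≡⟨ sum-cong-≗ (λ e → split (entry e)) ⟩
    sum (λ e → mark (entry e Fin.≤? u)) ∎
    where
    open ≡.≡-Reasoning
    split : ∀ v → mark (v Fin.<? u) ℕ.+ mark (v Fin.≟ u) ≡ mark (v Fin.≤? u)
    split v with Fin.<-cmp v u
    ... | tri< v<u v≢u _ = ≡.trans (≡.cong₂ ℕ._+_ (mark-yes (v Fin.<? u) v<u) (mark-no (v Fin.≟ u) v≢u))
      (≡.sym (mark-yes (v Fin.≤? u) (ℕ.<⇒≤ v<u)))
    ... | tri≈ v≮u v≡u _ = ≡.trans (≡.cong₂ ℕ._+_ (mark-no (v Fin.<? u) v≮u) (mark-yes (v Fin.≟ u) v≡u))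
      (≡.sym (mark-yes (v Fin.≤? u) (ℕ.≤-reflexive (≡.cong toℕ v≡u))))
    ... | tri> v≮u v≢u u<v = ≡.trans (≡.cong₂ ℕ._+_ (mark-no (v Fin.<? u) v≮u) (mark-no (v Fin.≟ u) v≢u))
      (≡.sym (mark-no (v Fin.≤? u) (ℕ.<⇒≱ u<v)))

  segments-ordered : ∀ {u w e e′} → InSegment M u e → InSegment M w e′ → u Fin.< w → e Fin.< e′
  segments-ordered {u} {w} {e} {e′} (_ , e<end) (start≤e′ , _) u<w = begin-strict
    toℕ e
      <⟨ e<end ⟩
    segmentStart M u ℕ.+ multiplicity M u
      ≡⟨ segmentEnd-sum u ⟩
    sum (λ e → mark (entry e Fin.≤? u))
      ≤⟨ sum-≤ (λ e → mark-≤ (entry e Fin.≤? u) (entry e Fin.<? w) (λ le → ℕ.≤-<-trans le u<w)) ⟩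
    sum (λ e → mark (entry e Fin.<? w))
      ≡⟨ segmentStart-sum w ⟨
    segmentStart M w
      ≤⟨ start≤e′ ⟩
    toℕ e′ ∎
    where open ℕ.≤-Reasoning

  -- The places in the blocks serve as positions. Once the k-th place of a block is known to lie in
  -- the segment of the k-th column, orders of columns pass to places, and a violation of
  -- `pos-nested` would be a crossing.
  semiNonCrossing⇒nested : SemiNonCrossing M → Nested (List.lookup M)
  semiNonCrossing⇒nested S = record
    { pos = λ i k → block i ‼ k
    ; pos-injective = λ {i} {j} k eq → disjoint (block i ‼ k) (∈-lookup k (elements (block i)))
        (≡.subst (_∈ˢ block j) (≡.sym eq) (∈-lookup k (elements (block j))))
    ; pos-mono = λ {i} {j} k lt → ℕ.≮⇒≥ λ gt →
        ℕ.<-asym lt (segments-ordered (inSegment j k) (inSegment i k) gt)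
    ; pos-nested = λ {i} {j} k k⁺ k⁺≡ lt lt⁺ → ℕ.≮⇒≥ λ gt →
        proj₁ (nonCrossing (λ { ≡.refl → ℕ.<-irrefl ≡.refl lt }) k k⁺ k⁺≡)
          (lt , segments-ordered (inSegment j k) (inSegment i k⁺) gt , lt⁺)
    }
    where
    open SemiNonCrossing S

    chosen : ∀ i k → ∃ λ e → e ∈ˢ block i × InSegment M (List.lookup M i ‼ k) e
    chosen i k = Equivalence.to (relabelled i (List.lookup M i ‼ k)) (∈-lookup k (elements (List.lookup M i)))

    index : ∀ i k → ∃ λ l → proj₁ (chosen i k) ≡ block i ‼ l
    index i k = ∈⇒index (block i) (proj₁ (proj₂ (chosen i k)))

    -- `relabelled` yields an element of the block in the segment of the k-th column, but at an
    -- unspecified index. Since segments are ordered like their columns, φ i is strictly monotone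
    -- and therefore the identity.
    φ : Fin h → Fin m → Fin m
    φ i k = proj₁ (index i k)

    inSegmentφ : ∀ i k → InSegment M (List.lookup M i ‼ k) (block i ‼ φ i k)
    inSegmentφ i k = ≡.subst (InSegment M (List.lookup M i ‼ k)) (proj₂ (index i k)) (proj₂ (proj₂ (chosen i k)))

    φ-mono : ∀ i {k l} → k Fin.< l → φ i k Fin.< φ i l
    φ-mono i {k} {l} k<l with Fin.<-cmp (φ i k) (φ i l)
      | segments-ordered (inSegmentφ i k) (inSegmentφ i l) (‼-increasing (List.lookup M i) k<l)
    ... | tri< lt _ _ | _  = lt
    ... | tri≈ _ eq _ | lt = contradiction (≡.cong (λ l → toℕ (block i ‼ l)) eq) (ℕ.<⇒≢ lt)
    ... | tri> _ _ gt | lt = contradiction (‼-increasing (block i) gt) (ℕ.<-asym lt)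

    inSegment : ∀ i k → InSegment M (List.lookup M i ‼ k) (block i ‼ k)
    inSegment i k = ≡.subst (λ l → InSegment M (List.lookup M i ‼ k) (block i ‼ l))
      (strictlyMonotone⇒id (φ-mono i) k) (inSegmentφ i k)

  -- The entries are placed in the order of their values, those with equal values by
  -- descending level, and those of the same level and value by pos.
  nested⇒semiNonCrossing : Nested (List.lookup M) → SemiNonCrossing M
  nested⇒semiNonCrossing nested = record
    { block = block
    ; covering = λ e → covering e
    ; disjoint = λ {i} {j} e e∈i e∈j → let
        k , e≡ = ∈⇒place i e∈i
        l , e≡′ = ∈⇒place j e∈j
      in proj₂ (place-injective (≡.trans (≡.sym e≡) e≡′))
    ; nonCrossing = λ {i} {j} _ k k⁺ k⁺≡ →
        (λ (lt , mid , lt⁺) → crossing i j k k⁺ k⁺≡ lt mid lt⁺) ,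
        (λ (lt , mid , lt⁺) → crossing j i k k⁺ k⁺≡ lt mid lt⁺)
    ; atMostOne = λ i u {e} {e′} e∈ e′∈ s s′ → let
        k , e≡ = ∈⇒place i e∈
        l , e′≡ = ∈⇒place i e′∈
        u≡ = segment-value k i (≡.subst (InSegment M u) e≡ s)
        u≡′ = segment-value l i (≡.subst (InSegment M u) e′≡ s′)
      in ≡.trans e≡ (≡.trans (≡.cong (λ k → place k i)
           (‼-injective (List.lookup M i) (≡.trans (≡.sym u≡) u≡′))) (≡.sym e′≡))
    ; relabelled = λ i u → mk⇔
        (λ u∈ → let k , u≡ = ∈⇒index (List.lookup M i) u∈ in
          place k i , place∈ k i , ≡.subst (λ u → InSegment M u (place k i)) (≡.sym u≡) (inSegment k i))
        (λ (e , e∈ , s) → let k , e≡ = ∈⇒place i e∈ in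
          ≡.subst (_∈ˢ List.lookup M i) (≡.sym (segment-value k i (≡.subst (InSegment M u) e≡ s)))
            (∈-lookup k (elements (List.lookup M i))))
    }
    where
    open Nested nested

    v : Fin m → Fin h → Fin N
    v k i = List.lookup M i ‼ k

    key : Fin m → Fin h → Fin ((N ℕ.* m) ℕ.* bound)
    key k i = Fin.combine (Fin.combine (v k i) (Fin.opposite k)) (pos i k)

    keyOf : Fin (m ℕ.* h) → ℕ
    keyOf e = toℕ (key (levelOf e) (blockOf e))

    keyOf-combine : ∀ k i → keyOf (Fin.combine k i) ≡ toℕ (key k i)
    keyOf-combine k i = ≡.cong (λ (l , j) → toℕ (key l j)) (Fin.remQuot-combine k i)

    opposite-injective : ∀ {n} {k l : Fin n} → Fin.opposite k ≡ Fin.opposite l → k ≡ l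
    opposite-injective {k = k} {l} eq = ≡.trans (≡.sym (Fin.opposite-involutive k))
      (≡.trans (≡.cong Fin.opposite eq) (Fin.opposite-involutive l))

    keyOf-injective : ∀ {e e′} → keyOf e ≡ keyOf e′ → e ≡ e′
    keyOf-injective {e} {e′} eq = begin
      e                                                ≡⟨ Fin.combine-remQuot {m} h e ⟨
      Fin.combine (levelOf e) (blockOf e)              ≡⟨ ≡.cong₂ Fin.combine level≡ block≡ ⟩
      Fin.combine (levelOf e′) (blockOf e′)            ≡⟨ Fin.combine-remQuot {m} h e′ ⟩
      e′ ∎
      where
      open ≡.≡-Reasoning
      outer = Fin.combine-injective _ (pos (blockOf e) (levelOf e)) _ (pos (blockOf e′) (levelOf e′)) (Fin.toℕ-injective eq)
      level≡ : levelOf e ≡ levelOf e′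
      level≡ = opposite-injective (proj₂ (Fin.combine-injective (entry e) _ (entry e′) _ (proj₁ outer)))
      block≡ : blockOf e ≡ blockOf e′
      block≡ = pos-injective (levelOf e)
        (≡.trans (proj₂ outer) (≡.cong (pos (blockOf e′)) (≡.sym level≡)))

    open Ranking keyOf keyOf-injective

    place : Fin m → Fin h → Fin (m ℕ.* h)
    place k i = rank (Fin.combine k i)

    place-injective : ∀ {k l i j} → place k i ≡ place l j → k ≡ l × i ≡ j
    place-injective {k} {l} {i} {j} eq = Fin.combine-injective k i l j (rank-injection eq)

    key<⇒place< : ∀ {k l i j} → key k i Fin.< key l j → place k i Fin.< place l j
    key<⇒place< {k} {l} {i} {j} lt = rank-mono
      (≡.subst₂ ℕ._<_ (≡.sym (keyOf-combine k i)) (≡.sym (keyOf-combine l j)) lt)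

    value<⇒place< : ∀ {k l i j} → v k i Fin.< v l j → place k i Fin.< place l j
    value<⇒place< {k} {l} {i} {j} lt = key<⇒place< (Fin.combine-monoˡ-< (pos i k) (pos j l)
      (Fin.combine-monoˡ-< (Fin.opposite k) (Fin.opposite l) lt))

    place<⇒pos< : ∀ {k i j} → place k i Fin.< place k j → pos i k Fin.< pos j k
    place<⇒pos< {k} {i} {j} lt with Fin.<-cmp (pos i k) (pos j k)
    ... | tri< pos< _ _ = pos<
    ... | tri≈ _ pos≡ _ = contradiction (≡.cong (λ i → toℕ (place k i)) (pos-injective k pos≡)) (ℕ.<⇒≢ lt)
    ... | tri> _ _ pos> with ℕ.m≤n⇒m<n∨m≡n (pos-mono k pos>)
    ...   | inj₁ v> = contradiction (value<⇒place< v>) (ℕ.<-asym lt)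
    ...   | inj₂ v≡ = contradiction (key<⇒place< {k} {k} {j} {i} (begin-strict
        toℕ (key k j)
          ≡⟨ Fin.toℕ-combine (Fin.combine (v k j) (Fin.opposite k)) (pos j k) ⟩
        bound ℕ.* toℕ (Fin.combine (v k j) (Fin.opposite k)) ℕ.+ toℕ (pos j k)
          <⟨ ℕ.+-monoʳ-< _ pos> ⟩
        bound ℕ.* toℕ (Fin.combine (v k j) (Fin.opposite k)) ℕ.+ toℕ (pos i k)
          ≡⟨ ≡.cong (λ w → bound ℕ.* toℕ (Fin.combine w (Fin.opposite k)) ℕ.+ toℕ (pos i k)) (Fin.toℕ-injective v≡) ⟩
        bound ℕ.* toℕ (Fin.combine (v k i) (Fin.opposite k)) ℕ.+ toℕ (pos i k)
          ≡⟨ Fin.toℕ-combine (Fin.combine (v k i) (Fin.opposite k)) (pos i k) ⟨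
        toℕ (key k i) ∎)) (ℕ.<-asym lt)
      where open ℕ.≤-Reasoning

    -- Within one value the reversed levels put k⁺ before k, so an entry of level k that comes first
    -- must have a smaller value. This makes the weak inequality of `pos-nested` enough to exclude
    -- crossings.
    place<⇒value< : ∀ {k k⁺ i j} → toℕ k⁺ ≡ suc (toℕ k) → place k j Fin.< place k⁺ i → v k j Fin.< v k⁺ i
    place<⇒value< {k} {k⁺} {i} {j} k⁺≡ lt with Fin.<-cmp (v k j) (v k⁺ i)
    ... | tri< v< _ _ = v<
    ... | tri> _ _ v> = contradiction (value<⇒place< v>) (ℕ.<-asym lt)
    ... | tri≈ _ v≡ _ = contradiction (key<⇒place< {k⁺} {k} {i} {j}
        (Fin.combine-monoˡ-< (pos i k⁺) (pos j k) (begin-strict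
          toℕ (Fin.combine (v k⁺ i) (Fin.opposite k⁺))
            ≡⟨ Fin.toℕ-combine (v k⁺ i) (Fin.opposite k⁺) ⟩
          m ℕ.* toℕ (v k⁺ i) ℕ.+ toℕ (Fin.opposite k⁺)
            <⟨ ℕ.+-monoʳ-< _ opposite< ⟩
          m ℕ.* toℕ (v k⁺ i) ℕ.+ toℕ (Fin.opposite k)
            ≡⟨ ≡.cong (λ w → m ℕ.* toℕ w ℕ.+ toℕ (Fin.opposite k)) v≡ ⟨
          m ℕ.* toℕ (v k j) ℕ.+ toℕ (Fin.opposite k)
            ≡⟨ Fin.toℕ-combine (v k j) (Fin.opposite k) ⟨
          toℕ (Fin.combine (v k j) (Fin.opposite k)) ∎))) (ℕ.<-asym lt)
      where
      open ℕ.≤-Reasoning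
      opposite< : Fin.opposite k⁺ Fin.< Fin.opposite k
      opposite< = ≡.subst₂ ℕ._<_ (≡.sym (Fin.opposite-prop k⁺)) (≡.sym (Fin.opposite-prop k))
        (ℕ.∸-monoʳ-< (ℕ.s≤s (ℕ.≤-reflexive (≡.sym k⁺≡))) (Fin.toℕ<n k⁺))

    block : Fin h → Subset m (m ℕ.* h)
    block i = subset (Vec.tabulate (λ k → place k i))
      (adjacent⇒allPairs (λ k → place k i) λ k k⁺ k⁺≡ →
        value<⇒place< (‼-increasing (List.lookup M i) (ℕ.≤-reflexive (≡.sym k⁺≡))))

    block-‼ : ∀ i k → block i ‼ k ≡ place k i
    block-‼ i = Vec.lookup∘tabulate (λ k → place k i)

    -- The middle inequality gives j at level k a strictly smaller value than i at level k⁺; the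
    -- outer two give the opposite by `pos-nested`.
    crossing : ∀ i j k k⁺ → toℕ k⁺ ≡ suc (toℕ k) → block i ‼ k Fin.< block j ‼ k →
      block j ‼ k Fin.< block i ‼ k⁺ → ¬ block i ‼ k⁺ Fin.< block j ‼ k⁺
    crossing i j k k⁺ k⁺≡ lt mid lt⁺ = ℕ.<⇒≱
      (place<⇒value< k⁺≡ (≡.subst₂ Fin._<_ (block-‼ j k) (block-‼ i k⁺) mid))
      (pos-nested k k⁺ k⁺≡ (place<⇒pos< (≡.subst₂ Fin._<_ (block-‼ i k) (block-‼ j k) lt))
        (place<⇒pos< (≡.subst₂ Fin._<_ (block-‼ i k⁺) (block-‼ j k⁺) lt⁺)))

    place∈ : ∀ k i → place k i ∈ˢ block i
    place∈ k i = ∈-tabulate⁺ (λ k → place k i) k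

    ∈⇒place : ∀ i {e} → e ∈ˢ block i → ∃ λ k → e ≡ place k i
    ∈⇒place i e∈ = let k , e≡ = ∈⇒index (block i) e∈ in k , ≡.trans e≡ (block-‼ i k)

    covering : ∀ e → ∃ λ i → e ∈ˢ block i
    covering e with injection⇒surjection rank-injection e
    ... | e′ , ≡.refl = blockOf e′ , ≡.subst (λ e → rank e ∈ˢ block (blockOf e′))
      (Fin.combine-remQuot {m} h e′) (place∈ (levelOf e′) (blockOf e′))

    entry<⇒key< : ∀ {e e′} → entry e Fin.< entry e′ → keyOf e < keyOf e′
    entry<⇒key< {e} {e′} lt = Fin.combine-monoˡ-< (pos (blockOf e) (levelOf e)) (pos (blockOf e′) (levelOf e′))
      (Fin.combine-monoˡ-< (Fin.opposite (levelOf e)) (Fin.opposite (levelOf e′)) lt)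

    -- The rank counts the entries with a smaller key. These include all entries of smaller value
    -- and none of larger value; e itself is left out, which makes the upper bound strict.
    inSegment-rank : ∀ e → InSegment M (entry e) (rank e)
    inSegment-rank e = (begin
        segmentStart M (entry e)
          ≡⟨ segmentStart-sum (entry e) ⟩
        sum (λ e′ → mark (entry e′ Fin.<? entry e))
          ≤⟨ sum-≤ (λ e′ → mark-≤ (entry e′ Fin.<? entry e) (keyOf e′ ℕ.<? keyOf e) (entry<⇒key< {e′} {e})) ⟩
        rankℕ e
          ≡⟨ toℕ-rank e ⟨
        toℕ (rank e) ∎) , (begin-strict
        toℕ (rank e)
          ≡⟨ toℕ-rank e ⟩
        rankℕ e
          <⟨ sum-< (λ e′ → mark-≤ (keyOf e′ ℕ.<? keyOf e) (entry e′ Fin.≤? entry e)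
               (λ lt → ℕ.≮⇒≥ λ gt → ℕ.<-asym lt (entry<⇒key< {e} {e′} gt))) e
               (mark-< (keyOf e ℕ.<? keyOf e) (entry e Fin.≤? entry e) (ℕ.<-irrefl ≡.refl) ℕ.≤-refl) ⟩
        sum (λ e′ → mark (entry e′ Fin.≤? entry e))
          ≡⟨ segmentEnd-sum (entry e) ⟨
        segmentStart M (entry e) ℕ.+ multiplicity M (entry e) ∎)
      where open ℕ.≤-Reasoning

    inSegment : ∀ k i → InSegment M (v k i) (place k i)
    inSegment k i = ≡.subst (λ u → InSegment M u (place k i)) (entry-combine k i) (inSegment-rank (Fin.combine k i))

    segment-value : ∀ {u} k i → InSegment M u (place k i) → u ≡ v k i
    segment-value {u} k i s with Fin.<-cmp u (v k i)
    ... | tri< lt _ _ = contradiction (segments-ordered s (inSegment k i) lt) (ℕ.<-irrefl ≡.refl)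
    ... | tri≈ _ eq _ = eq
    ... | tri> _ _ gt = contradiction (segments-ordered (inSegment k i) s gt) (ℕ.<-irrefl ≡.refl)

-- Serves to pass between f and the lookup function of its list, whose index type is `Fin` of the
-- length of that list.
nested-reindex : ∀ {m N h h′} {f : Fin h → Subset m N} {f′ : Fin h′ → Subset m N}
  (ρ : Fin h′ → Fin h) → Injection ρ → (∀ i → f (ρ i) ≡ f′ i) → Nested f → Nested f′
nested-reindex ρ inj eq nested = record
  { pos = pos ∘ ρ
  ; pos-injective = λ k → inj ∘ pos-injective k
  ; pos-mono = λ {i} {j} k lt → ≡.subst₂ (λ J J′ → J ‼ k Fin.≤ J′ ‼ k) (eq i) (eq j) (pos-mono k lt)
  ; pos-nested = λ {i} {j} k k⁺ k⁺≡ lt lt⁺ →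
      ≡.subst₂ (λ J J′ → J ‼ k⁺ Fin.≤ J′ ‼ k) (eq i) (eq j) (pos-nested k k⁺ k⁺≡ lt lt⁺)
  }
  where open Nested nested

module _ {m N h} {f : Fin h → Subset m N} where

  private
    cast-injection : ∀ {a b} .{eq : a ≡ b} → Injection (Fin.cast eq)
    cast-injection {eq = eq} p = Fin.toℕ-injective
      (≡.trans (≡.sym (Fin.toℕ-cast eq _)) (≡.trans (≡.cong toℕ p) (Fin.toℕ-cast eq _)))

  nested-lookup⁻ : Nested (List.lookup (List.tabulate f)) → Nested f
  nested-lookup⁻ = nested-reindex (Fin.cast (≡.sym (List.length-tabulate f))) cast-injection (List.lookup-tabulate f)

  nested-lookup⁺ : Nested f → Nested (List.lookup (List.tabulate f))
  nested-lookup⁺ = nested-reindex (Fin.cast (List.length-tabulate f)) cast-injection λ i →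
    ≡.trans (≡.sym (List.lookup-tabulate f (Fin.cast (List.length-tabulate f) i)))
      (≡.cong (List.lookup (List.tabulate f)) (≡.trans
        (Fin.cast-trans (List.length-tabulate f) (≡.sym (List.length-tabulate f)) i)
        (Fin.cast-is-id ≡.refl i)))

module _ (m n : ℕ) where

  standard-determined : {M M′ : Monomial (suc m) n} → Standard M → Standard M′ →
    rowContent M ≡ rowContent M′ → M ↭ M′
  standard-determined = determined-by-families {P = Standard} standard-unique

  semiNonCrossing-determined : {M M′ : Monomial (suc m) n} → SemiNonCrossing M → SemiNonCrossing M′ →
    rowContent M ≡ rowContent M′ → M ↭ M′
  semiNonCrossing-determined = determined-by-families {P = SemiNonCrossing {suc m} {n}} λ s s′ →
    nested-unique (nested-lookup⁻ (semiNonCrossing⇒nested {suc m} {n} _ s))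
                  (nested-lookup⁻ (semiNonCrossing⇒nested {suc m} {n} _ s′))

standard⇒semiNonCrossing : ∀ {m n} {M : Monomial m n} → Standard M →
  ∃ λ (M′ : Monomial m n) → SemiNonCrossing M′ × rowContent M ≡ rowContent M′
standard⇒semiNonCrossing {m} {n} {M} std =
  List.tabulate g , nested⇒semiNonCrossing {m} {n} _ (nested-lookup⁺ (unstandardise-nested f mono)) ,
  ≡.trans (≡.cong rowContent (≡.sym (List.tabulate-lookup M))) (unstandardise-rowContent f mono)
  where
  f = List.lookup M
  mono : ∀ {x y} → x Fin.≤ y → f x ≼ f y
  mono = standard-monotone f (≡.subst Standard (≡.sym (List.tabulate-lookup M)) std)
  g = unstandardise f mono

-- The non-crossing monomials form a basis

module Basis {c ℓ : Level} (K : CommutativeRing c ℓ) (m n : ℕ) where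

  open Grassmannian K (suc m) n
  open Poly using (_*_)
  private
    module K = CommutativeRing K
    module A = CommutativeRing coordinateRing
    module I = Independence K (suc m) n
    module S = Straightening K (suc m) n
    module NC = LinearCombinationProperties K coordinateModule (NCMs (suc m) n) (monomial ∘ factors)
  open CommutativeSemigroupProperties A.*-commutativeSemigroup using (x∙yz≈y∙xz)

  monomial-spanned : ∀ M → I.Spanned SemiNonCrossing (monomial M)
  monomial-spanned M = I.spanned-trans
    (I.spanned-by-leading (standard-determined m n) S.straighten standard⇒semiNonCrossing) (S.straighten M)

  monomial-++ : ∀ M M′ → monomial M * monomial M′ A.≈ monomial (M ++ M′)
  monomial-++ []      M′ = A.*-identityˡ (monomial M′)
  monomial-++ (J ∷ M) M′ = A.trans (A.*-assoc (Poly.var J) (monomial M) (monomial M′))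
    (A.*-congˡ (monomial-++ M M′))

  Every : Monomial (suc m) n → Set
  Every _ = ⊤

  product-spanned : ∀ l l′ → I.Spanned Every (I.value l * I.value l′)
  product-spanned []            l′ = I.spanned-resp (A.sym (A.zeroˡ (I.value l′))) I.spanned-0
  product-spanned ((k , M) ∷ l) l′ = I.spanned-resp
    (A.sym (A.trans (A.distribʳ (I.value l′) _ (I.value l)) (A.+-congʳ (A.*-assoc _ (monomial M) (I.value l′)))))
    (I.spanned-+ (I.spanned-scale k (times l′)) (product-spanned l l′))
    where
    times : ∀ l′ → I.Spanned Every (monomial M * I.value l′)
    times []              = I.spanned-resp (A.sym (A.zeroʳ (monomial M))) I.spanned-0
    times ((k′ , M′) ∷ l′) = I.spanned-resp
      (A.sym (A.trans (A.distribˡ (monomial M) _ (I.value l′)) (A.+-congʳ (x∙yz≈y∙xz (monomial M) (Poly.con k′) (monomial M′)))))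
      (I.spanned-+ (I.spanned-scale k′ (I.spanned-resp (A.sym (monomial-++ M M′)) (I.spanned-member {j = M ++ M′} _))) (times l′))

  poly-spanned : ∀ f → I.Spanned Every f
  poly-spanned (Poly.con k)   = I.spanned-resp (A.*-identityʳ (Poly.con k))
    (I.spanned-scale k (I.spanned-member {j = []} _))
  poly-spanned (Poly.var J)   = I.spanned-resp (A.*-identityʳ (Poly.var J)) (I.spanned-member {j = J ∷ []} _)
  poly-spanned (f Poly.+ g)   = I.spanned-+ (poly-spanned f) (poly-spanned g)
  poly-spanned (f Poly.* g)   = let l , _ , f≈ = poly-spanned f ; l′ , _ , g≈ = poly-spanned g in
    I.spanned-resp (A.sym (A.*-cong f≈ g≈)) (product-spanned l l′)
  poly-spanned (Poly.- f)     = S.spanned-neg f (poly-spanned f)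

  value-factors : ∀ l → I.value (List.map (λ (k , M) → k , factors M) l) ≡ value l
  value-factors []            = ≡.refl
  value-factors ((k , M) ∷ l) = ≡.cong (Poly.con k * monomial (factors M) Poly.+_) (value-factors l)

  -- Non-crossing monomials are compared by their factors alone, so coefficients may be computed
  -- among all monomials, where the triangular reduction takes place.
  coefficient-factors : ∀ l M →
    I.coefficient (List.map (λ (k , M) → k , factors M) l) (factors M) ≡ coefficient l M
  coefficient-factors []             M = ≡.refl
  coefficient-factors ((k , M′) ∷ l) M = cases (↭-dec _≟ˢ_ (factors M′) (factors M))
    where
    cases : Dec (factors M′ ↭ factors M) →
      I.coefficient (List.map (λ (k , M) → k , factors M) ((k , M′) ∷ l)) (factors M) ≡ coefficient ((k , M′) ∷ l) M
    cases (yes p) = ≡.trans (I.coefficient-∷-≈ _ p)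
      (≡.trans (≡.cong (k K.+_) (coefficient-factors l M)) (≡.sym (NC.coefficient-∷-≈ {i = M′} l p)))
    cases (no ¬p) = ≡.trans (I.coefficient-∷-≉ _ ¬p)
      (≡.trans (coefficient-factors l M) (≡.sym (NC.coefficient-∷-≉ {i = M′} l ¬p)))

  fromSpanned : ∀ {f} → I.Spanned SemiNonCrossing f → ∃ λ l → f A.≈ value l
  fromSpanned (l , ps , f≈) = ncms l ps , A.trans f≈ (A.reflexive (value-ncms l ps))
    where
    ncms : ∀ l → ListAll.All (SemiNonCrossing ∘ proj₂) l → LinComb
    ncms []            []       = []
    ncms ((k , M) ∷ l) (p ∷ ps) = (k , ncm M p) ∷ ncms l ps
    value-ncms : ∀ l ps → I.value l ≡ value (ncms l ps)
    value-ncms []            []       = ≡.refl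
    value-ncms ((k , M) ∷ l) (p ∷ ps) = ≡.cong (Poly.con k * monomial M Poly.+_) (value-ncms l ps)

  spanning : Spanning
  spanning f = fromSpanned (I.spanned-trans (λ {M} _ → monomial-spanned M) (poly-spanned f))

  independent : LinearlyIndependent
  independent l l≈0 M = K.trans (K.reflexive (≡.sym (coefficient-factors l M)))
    -- The bound w = 0 lies below every weight, so the coefficient of each non-crossing monomial is
    -- among those shown to vanish.
    (coeff≈0 (NCM.semiNonCrossing M) ℕ.z≤n)
    where
    open I.LeadingExponents (semiNonCrossing-determined m n)
    l′ = List.map (λ (k , M) → k , factors M) l
    open Reduction (reduce 0 l′ (ListAll.map⁺ (ListAll.universal (NCM.semiNonCrossing ∘ proj₂) l)) λ {M} _ _ →
      K.trans (I.top-cong M (A.trans (A.reflexive (value-factors l)) l≈0)) (I.top-0 M))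

  unique-expansion : ∀ f → ∃! _≋_ (λ l → f ≈ value l)
  unique-expansion f = let l , f≈l = spanning f in
    l , f≈l , λ {l′} f≈l′ → NC.independent⇒unique independent l l′ (A.trans (A.sym f≈l) f≈l′)

theorem24 : (m n : ℕ) → 1 ≤ m → 1 ≤ n →
    let open Grassmannian ℂ m n in
    ((M : Monomial m n) → ∃! _≋_ (λ l → monomial M ≈ value l))
    × IsBasis
theorem24 (suc m) n _ _ = (λ M → unique-expansion (monomial M)) , spanning , independent
  where
  open Grassmannian ℂ (suc m) n using (monomial)
  open Basis ℂ m n
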